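{- Each of the rules $\mathsf{ai}{\uparrow}$, $\mathsf{ss}{\uparrow}$, $\mathsf{p}{\uparrow}$ is admissible for $\mathsf{GS}$; that is, for each of these rules and each instance $X\longrightarrow Y$ of it, $\vdash_{\mathsf{GS}} X$ implies $\vdash_{\mathsf{GS}} Y$.
   Context: Atoms: fix a countable set $\mathcal V$ of propositional variables and a disjoint copy $\overline{\mathcal V}=\{\overline a: a\in\mathcal V\}$; atoms are elements of $\mathcal V\cup\overline{\mathcal V}$, with $\overline{\overline a}=a$. A graph is a finite simple undirected graph $G=(V_G,E_G)$ whose vertices are each labelled by an atom; graphs are identified up to label-preserving isomorphism. $\emptyset$ is the empty graph; an atom $a$ also denotes the one-vertex graph labelled $a$. For graphs $G,H$ on disjoint vertex sets, $G\sqcup H$ (par) is their disjoint union and $G\otimes H$ (tensor) is their disjoint union plus all edges between $V_G$ and $V_H$. The dual $\overline G$ has the same vertices, complementary edge set, and dualized labels. A context is a graph $C$ with a subset $R\subseteq V_C$; $C[M]_R$ is $C\sqcup M$ plus all edges between $V_M$ and $R$. A module of $G$ is an induced subgraph $M$ such that each vertex outside $M$ is adjacent to all of $M$ or none of it; $P$ is prime if $|V_P|\ge2$ and its only modules are $\emptyset$, singletons and $P$. For $G$ with vertices $v_1,\dots,v_n$, $G\langle H_1,\dots,H_n\rangle$ replaces each $v_i$ by $H_i$, keeps edges inside each $H_i$, and joins $H_i$ to $H_j$ ($i\neq j$) completely iff $v_iv_j\in E_G$; $\overline G\langle\cdots\rangle$ uses the same vertex order. Rules (premise $\longrightarrow$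 conclusion): $\mathsf{ai}{\downarrow}$: $\emptyset\longrightarrow\overline a\sqcup a$; $\mathsf{ss}{\downarrow}$: $B[A]_S\longrightarrow B\sqcup A$ with $S\subseteq V_B$, $S\ne\emptyset$, $A\ne\emptyset$; $\mathsf{p}{\downarrow}$: $(M_1\sqcup N_1)\otimes\cdots\otimes(M_n\sqcup N_n)\longrightarrow\overline P\langle M_1,\dots,M_n\rangle\sqcup P\langle N_1,\dots,N_n\rangle$ with $P$ prime, $n=|V_P|\ge4$, all $M_i\ne\emptyset$; $\mathsf{ai}{\uparrow}$: $a\otimes\overline a\longrightarrow\emptyset$; $\mathsf{ss}{\uparrow}$: $B\otimes A\longrightarrow B[A]_S$ with $S\subseteq V_B$, $S\ne V_B$, $A\ne\emptyset$; $\mathsf{p}{\uparrow}$: $P\langle M_1,\dots,M_n\rangle\otimes\overline P\langle N_1,\dots,N_n\rangle\longrightarrow(M_1\otimes N_1)\sqcup\cdots\sqcup(M_n\otimes N_n)$ with $P$ prime, $n=|V_P|\ge4$, all $M_i\ne\emptyset$. $\mathsf{GS}=\{\mathsf{ai}{\downarrow},\mathsf{ss}{\downarrow},\mathsf{p}{\downarrow}\}$. A derivation in a system $\mathsf S$ from $G$ to $H$ is a finite sequence $G=G_0,\dots,G_k=H$ where each step is a label-preserving isomorphism or replaces $C[X]_R$ by $C[Y]_R$ for a context and an instance $X\longrightarrow Y$ of a rule of $\mathsf S$. A proof is a derivation from $\emptyset$; $\vdash_{\mathsf S}G$ means $G$ has a proof in $\mathsf S$. -}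

module Defs where

open import Data.Nat using (ℕ; zero; suc; _+_; _≤_; _<_)
open import Data.Bool using (Bool; true; false; not)
open import Data.Product using (Σ; ∃; _×_; _,_; proj₁; proj₂)
open import Data.Sum using (_⊎_; inj₁; inj₂; [_,_]′)
open import Data.Fin using (Fin; zero; suc; splitAt)
import Data.Fin as Fin
open import Data.Empty using (⊥-elim)
open import Relation.Nullary using (yes; no; ¬_)
open import Relation.Binary.PropositionalEquality using (_≡_; refl; cong)
open import Relation.Binary.Construct.Closure.ReflexiveTransitive using (Star)
open import Function.Bundles using (_↔_; Inverse)

-- Atoms: a propositional variable (ℕ, countably many) together with a
-- polarity flag; (x , false) is the variable x, (x , true) is its dual x̄.

Atom : Set
Atom = ℕ × Bool

dualAtom : Atom → Atom
dualAtom (x , b) = (x , not b)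

record Graph : Set where
  constructor mkGraph
  field
    size    : ℕ
    lab     : Fin size → Atom
    adj     : Fin size → Fin size → Bool
    adj-sym : ∀ i j → adj i j ≡ adj j i
    adj-irr : ∀ i → adj i i ≡ false
open Graph public

record _≅_ (G H : Graph) : Set where
  field
    iso      : Fin (size G) ↔ Fin (size H)
    lab-pres : ∀ i → lab H (Inverse.to iso i) ≡ lab G i
    adj-pres : ∀ i j → adj H (Inverse.to iso i) (Inverse.to iso j) ≡ adj G i j

emptyG : Graph
emptyG = mkGraph 0 (λ ()) (λ ()) (λ ()) (λ ())

atomG : Atom → Graph
atomG a = mkGraph 1 (λ _ → a) (λ _ _ → false) (λ _ _ → refl) (λ _ → refl)

module _ (G H : Graph) (cross : Fin (size G) → Fin (size H) → Bool) where
  private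
    adjJ : Fin (size G) ⊎ Fin (size H) → Fin (size G) ⊎ Fin (size H) → Bool
    adjJ (inj₁ i) (inj₁ j) = adj G i j
    adjJ (inj₂ i) (inj₂ j) = adj H i j
    adjJ (inj₁ i) (inj₂ j) = cross i j
    adjJ (inj₂ i) (inj₁ j) = cross j i

    adjJ-sym : ∀ p q → adjJ p q ≡ adjJ q p
    adjJ-sym (inj₁ i) (inj₁ j) = adj-sym G i j
    adjJ-sym (inj₂ i) (inj₂ j) = adj-sym H i j
    adjJ-sym (inj₁ i) (inj₂ j) = refl
    adjJ-sym (inj₂ i) (inj₁ j) = refl

    adjJ-irr : ∀ p → adjJ p p ≡ false
    adjJ-irr (inj₁ i) = adj-irr G i
    adjJ-irr (inj₂ i) = adj-irr H i

  joinG : Graph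
  joinG = mkGraph (size G + size H)
    (λ u → [ lab G , lab H ]′ (splitAt (size G) u))
    (λ u v → adjJ (splitAt (size G) u) (splitAt (size G) v))
    (λ u v → adjJ-sym (splitAt (size G) u) (splitAt (size G) v))
    (λ u → adjJ-irr (splitAt (size G) u))

_⊔_ : Graph → Graph → Graph
G ⊔ H = joinG G H (λ _ _ → false)

_⊗_ : Graph → Graph → Graph
G ⊗ H = joinG G H (λ _ _ → true)

infixr 6 _⊔_
infixr 7 _⊗_

private
  dualAdj : (G : Graph) → Fin (size G) → Fin (size G) → Bool
  dualAdj G i j with i Fin.≟ j
  ... | yes _ = false
  ... | no  _ = not (adj G i j)

  dualAdj-sym : (G : Graph) → ∀ i j → dualAdj G i j ≡ dualAdj G j i
  dualAdj-sym G i j with i Fin.≟ j | j Fin.≟ i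
  ... | yes _ | yes _ = refl
  ... | yes p | no ¬q = ⊥-elim (¬q (Relation.Binary.PropositionalEquality.sym p))
  ... | no ¬p | yes q = ⊥-elim (¬p (Relation.Binary.PropositionalEquality.sym q))
  ... | no _  | no _  = cong not (adj-sym G i j)

  dualAdj-irr : (G : Graph) → ∀ i → dualAdj G i i ≡ false
  dualAdj-irr G i with i Fin.≟ i
  ... | yes _ = refl
  ... | no ¬p = ⊥-elim (¬p refl)

dual : Graph → Graph
dual G = mkGraph (size G) (λ i → dualAtom (lab G i)) (dualAdj G) (dualAdj-sym G) (dualAdj-irr G)

record Context : Set where
  constructor mkContext
  field
    ctx : Graph
    R   : Fin (size ctx) → Bool
open Context public

plug : Context → Graph → Graph
plug C M = joinG (ctx C) M (λ i _ → R C i)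

NonEmpty : Graph → Set
NonEmpty G = 0 < size G

IsModule : (G : Graph) → (Fin (size G) → Bool) → Set
IsModule G M = ∀ v → M v ≡ false →
  (∀ x → M x ≡ true → adj G v x ≡ true) ⊎ (∀ x → M x ≡ true → adj G v x ≡ false)

IsTrivialModule : (G : Graph) → (Fin (size G) → Bool) → Set
IsTrivialModule G M =
  (∀ x → M x ≡ false)
  ⊎ (∃ λ v → M v ≡ true × (∀ x → M x ≡ true → x ≡ v))
  ⊎ (∀ x → M x ≡ true)

Prime : Graph → Set
Prime P = 2 ≤ size P × (∀ M → IsModule P M → IsTrivialModule P M)

mutual
  composeRaw : (n : ℕ) → (Fin n → Fin n → Bool) → (Fin n → Graph) → Graph
  composeRaw zero    g Hs = emptyG
  composeRaw (suc n) g Hs =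
    joinG (Hs zero) (composeRaw n (λ i j → g (suc i) (suc j)) (λ i → Hs (suc i)))
          (λ _ v → g zero (suc (block n (λ i j → g (suc i) (suc j)) (λ i → Hs (suc i)) v)))

  block : (n : ℕ) → (g : Fin n → Fin n → Bool) → (Hs : Fin n → Graph)
        → Fin (size (composeRaw n g Hs)) → Fin n
  block zero    g Hs ()
  block (suc n) g Hs v with splitAt (size (Hs zero)) v
  ... | inj₁ _ = zero
  ... | inj₂ w = suc (block n (λ i j → g (suc i) (suc j)) (λ i → Hs (suc i)) w)

_⟨_⟩ : (G : Graph) → (Fin (size G) → Graph) → Graph
G ⟨ Hs ⟩ = composeRaw (size G) (adj G) Hs

bigTensor : (n : ℕ) → (Fin n → Graph) → Graph
bigTensor zero    Gs = emptyG
bigTensor (suc n) Gs = Gs zero ⊗ bigTensor n (λ i → Gs (suc i))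

bigPar : (n : ℕ) → (Fin n → Graph) → Graph
bigPar zero    Gs = emptyG
bigPar (suc n) Gs = Gs zero ⊔ bigPar n (λ i → Gs (suc i))

-- Rules (premise → conclusion)

data ai↓ : Graph → Graph → Set where
  ai↓-inst : (a : Atom) → ai↓ emptyG (atomG (dualAtom a) ⊔ atomG a)

data ss↓ : Graph → Graph → Set where
  ss↓-inst : (B A : Graph) (S : Fin (size B) → Bool)
           → (∃ λ i → S i ≡ true) → NonEmpty A
           → ss↓ (plug (mkContext B S) A) (B ⊔ A)

data p↓ : Graph → Graph → Set where
  p↓-inst : (P : Graph) → Prime P → 4 ≤ size P
          → (Ms Ns : Fin (size P) → Graph) → (∀ i → NonEmpty (Ms i))
          → p↓ (bigTensor (size P) (λ i → Ms i ⊔ Ns i))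
               ((dual P ⟨ Ms ⟩) ⊔ (P ⟨ Ns ⟩))

data ai↑ : Graph → Graph → Set where
  ai↑-inst : (a : Atom) → ai↑ (atomG a ⊗ atomG (dualAtom a)) emptyG

data ss↑ : Graph → Graph → Set where
  ss↑-inst : (B A : Graph) (S : Fin (size B) → Bool)
           → (∃ λ i → S i ≡ false) → NonEmpty A
           → ss↑ (B ⊗ A) (plug (mkContext B S) A)

data p↑ : Graph → Graph → Set where
  p↑-inst : (P : Graph) → Prime P → 4 ≤ size P
          → (Ms Ns : Fin (size P) → Graph) → (∀ i → NonEmpty (Ms i))
          → p↑ ((P ⟨ Ms ⟩) ⊗ (dual P ⟨ Ns ⟩))
               (bigPar (size P) (λ i → Ms i ⊗ Ns i))

data GS : Graph → Graph → Set where
  gs-ai↓ : ∀ {X Y} → ai↓ X Y → GS X Y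
  gs-ss↓ : ∀ {X Y} → ss↓ X Y → GS X Y
  gs-p↓  : ∀ {X Y} → p↓ X Y → GS X Y

data Step (Rule : Graph → Graph → Set) : Graph → Graph → Set where
  iso-step  : ∀ {G H} → G ≅ H → Step Rule G H
  rule-step : ∀ {X Y} (C : Context) → Rule X Y → Step Rule (plug C X) (plug C Y)

Derivation : (Graph → Graph → Set) → Graph → Graph → Set
Derivation Rule = Star (Step Rule)

Provable : (Graph → Graph → Set) → Graph → Set
Provable Rule G = Derivation Rule emptyG G

Admissible : (Graph → Graph → Set) → (Graph → Graph → Set) → Set
Admissible Rule S = ∀ X Y → Rule X Y → Provable S X → Provable S Y

{-# OPTIONS --safe #-}
module Submission where

-- Cut elimination by a double-glueing model instead of syntactic splitting. Fix an
-- ambient graph. Each vertex set S receives a class 𝕌 S of graphs, its realizers, by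
-- recursion on the size of S; in the end these are the graphs z with ⊢ z ⊔ S. The
-- realizers of a par split D | E map realizers of the dual of D to realizers of E (and
-- conversely), those of a tensor split are sums, and those of a prime graph P⟨M⟩ are
-- graphs P̄⟨u⟩ with uᵢ realizing Mᵢ, or sums in which one component has been split off.
-- Realizers of S and of its dual are orthogonal: z ⊔ x is provable. Every rule X → Y of
-- GS, in any context, gives 𝕌 X ⊆ 𝕌 Y and 𝕌 Ȳ ⊆ 𝕌 X̄, and the second inclusion is the
-- statement for the dual rule. Since X realizes X̄, the empty graph realizes X exactly
-- when X is provable, and both inclusions together yield the admissibility of the
-- up-rules.

open import Defs
open import Data.Product using (_×_)
open import Level using (Lift; lift) renaming (suc to lsuc; zero to lzero)
open import Data.Nat as ℕ using (ℕ; zero; suc; _+_; _≤_; _<_; z≤n; s≤s)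
import Data.Nat.Properties as ℕₚ
open import Data.Bool using (Bool; true; false; not; _∧_; _∨_; if_then_else_)
import Data.Bool.Properties as Boolₚ
open import Data.Product using (Σ; ∃; _,_; proj₁; proj₂)
open import Data.Sum using (_⊎_; inj₁; inj₂; [_,_]′)
import Data.Sum.Function.Propositional as ⊎F
open import Data.Fin as Fin using (Fin; zero; suc; splitAt)
import Data.Fin.Properties as Finₚ
import Data.Fin.Subset.Properties as Subsetₚ
open import Data.Vec using (lookup; tabulate)
import Data.Vec.Properties as Vecₚ
open import Data.Empty using (⊥; ⊥-elim)
open import Data.Unit using (⊤; tt)
open import Relation.Nullary using (Dec; yes; no; ¬_; does)
open import Relation.Nullary.Decidable using (dec-true; dec-false; _×-dec_; _→-dec_; ¬?)
open import Relation.Binary.PropositionalEquality using (_≡_; _≢_; refl; sym; trans; cong; cong₂; subst)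
open import Relation.Binary.Construct.Closure.ReflexiveTransitive using (ε; _◅_; _◅◅_)
open import Function.Base using (_∘_; id)
open import Function.Bundles using (_↔_; Inverse; mk↔ₛ′)
open import Function.Construct.Composition using (_↔-∘_)
open import Function.Construct.Identity using (↔-id)
open import Function.Construct.Symmetry using (↔-sym)
open import Algebra.Bundles using (CommutativeMonoid)
import Algebra.Solver.CommutativeMonoid as CMSolver
open Inverse using (to; from; strictlyInverseˡ; strictlyInverseʳ)

-- Labelled graphs on finite vertex types

-- Classes are indexed by vertex sets of one fixed graph because passing to modules, contexts and
-- fibres then leaves the graph unchanged, and recursion on the number of vertices is available. The
-- obstacle is the prime case: removing a module may empty a component, and the graph that remains
-- need not be prime. So no connective can be treated in isolation. Orthogonality, sums along a
-- module, the two cuts at a module and composition along an arbitrary quotient are proved together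
-- in `Core`, by induction on the number of vertices. This induction builds derivations but never
-- asks which rules occur in one; that is done only for soundness, one step at a time. The rule `p↓`
-- enters it through a single syntactic fact, `comp-cut`: the rule extends from prime graphs to
-- compositions along any graph, with one pair of components left unproved. Polarity is a flag on
-- the graph, so that a statement and its dual are two instances of one statement; this is also why
-- soundness of the down-rules in both directions already contains the up-rules.

record Finite (A : Set) : Set where
  constructor finite
  field
    card : ℕ
    enum : A ↔ Fin card
open Finite

finite-⊥ : Finite ⊥
finite-⊥ = finite 0 (mk↔ₛ′ (λ ()) (λ ()) (λ ()) (λ ()))

finite-⊤ : Finite ⊤
finite-⊤ = finite 1 (mk↔ₛ′ (λ _ → zero) (λ _ → tt) (λ { zero → refl }) (λ _ → refl))

finite-Fin : ∀ n → Finite (Fin n)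
finite-Fin n = finite n (↔-id _)

finite-↔ : ∀ {A B} → A ↔ B → Finite B → Finite A
finite-↔ f (finite n e) = finite n (e ↔-∘ f)

finite-⊎ : ∀ {A B} → Finite A → Finite B → Finite (A ⊎ B)
finite-⊎ (finite m e) (finite n f) = finite (m + n) (↔-sym Finₚ.+↔⊎ ↔-∘ (e ⊎F.⊎-↔ f))

finite-≡ : ∀ (b : Bool) → Finite (b ≡ true)
finite-≡ true  = finite-↔ (mk↔ₛ′ (λ _ → tt) (λ _ → refl) (λ _ → refl) (λ { refl → refl })) finite-⊤
finite-≡ false = finite-↔ (mk↔ₛ′ (λ ()) (λ ()) (λ ()) (λ ())) finite-⊥

-- Splitting off the fibre over the first enumerated element leaves a family over a base with one
-- element less.
finite-× : ∀ {A : Set} {B : A → Set} → ∀ {n} → (A ↔ Fin n) → (∀ a → Finite (B a)) → Finite (Σ A B)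
finite-× {A} {B} {zero} e f =
  finite-↔ (mk↔ₛ′ (λ (a , _) → ⊥-elim (none a)) (λ ()) (λ ()) (λ (a , _) → ⊥-elim (none a))) finite-⊥
  where
  none : A → ⊥
  none a with to e a
  ... | ()
finite-× {A} {B} {suc n} e f =
  finite-↔ (mk↔ₛ′ fwd bwd fwd-bwd bwd-fwd)
    (finite-⊎ (f (from e zero)) (finite-× {B = B ∘ from e ∘ suc} (↔-id (Fin n)) (f ∘ from e ∘ suc)))
  where
  cls : (i : Fin (suc n)) → B (from e i) → B (from e zero) ⊎ Σ (Fin n) (B ∘ from e ∘ suc)
  cls zero b    = inj₁ b
  cls (suc i) b = inj₂ (i , b)
  fwd : Σ A B → B (from e zero) ⊎ Σ (Fin n) (B ∘ from e ∘ suc)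
  fwd (a , b) = cls (to e a) (subst B (sym (strictlyInverseʳ e a)) b)
  bwd : B (from e zero) ⊎ Σ (Fin n) (B ∘ from e ∘ suc) → Σ A B
  bwd (inj₁ b)       = from e zero , b
  bwd (inj₂ (i , b)) = from e (suc i) , b
  bwd-cls : ∀ i b → bwd (cls i b) ≡ (from e i , b)
  bwd-cls zero b    = refl
  bwd-cls (suc i) b = refl
  bwd-fwd : ∀ x → bwd (fwd x) ≡ x
  bwd-fwd (a , b) = trans (bwd-cls (to e a) _) (aux (strictlyInverseʳ e a) b)
    where
    aux : ∀ {a a′} (eq : a′ ≡ a) (b : B a) → _≡_ {A = Σ A B} (a′ , subst B (sym eq) b) (a , b)
    aux refl b = refl
  -- Both indices are variables here, so that the transport disappears by matching on the two
  -- equations.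
  cls-at : ∀ i j (eq : i ≡ j) b (eq′ : from e i ≡ from e j) → cls i (subst B (sym eq′) b) ≡ cls j b
  cls-at i .i refl b refl = refl
  fwd-bwd : ∀ y → fwd (bwd y) ≡ y
  fwd-bwd (inj₁ b) = cls-at _ zero (strictlyInverseˡ e zero) b _
  fwd-bwd (inj₂ (i , b)) = cls-at _ (suc i) (strictlyInverseˡ e (suc i)) b _

finite-Σ : ∀ {A : Set} {B : A → Set} → Finite A → (∀ a → Finite (B a)) → Finite (Σ A B)
finite-Σ (finite n e) f = finite-× e f

-- Vertices form an arbitrary finite type: sums and dependent sums then serve directly as vertex
-- sets, and isomorphisms are defined by cases instead of arithmetic in `Fin`.
record FG : Set₁ where
  no-eta-equality
  constructor mkFG
  field
    V    : Set
    fin  : Finite V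
    labF : V → Atom
    adjF : V → V → Bool
    symF : ∀ v w → adjF v w ≡ adjF w v
    irrF : ∀ v → adjF v v ≡ false
open FG

infix 4 _≃_
record _≃_ (G H : FG) : Set where
  constructor mk≃
  field
    bij    : V G ↔ V H
    lab-eq : ∀ v → labF H (to bij v) ≡ labF G v
    adj-eq : ∀ v w → adjF H (to bij v) (to bij w) ≡ adjF G v w
open _≃_

≃-refl : ∀ {G} → G ≃ G
≃-refl = mk≃ (↔-id _) (λ _ → refl) (λ _ _ → refl)

≃-sym : ∀ {G H} → G ≃ H → H ≃ G
≃-sym {G} {H} f = mk≃ (↔-sym (bij f))
  (λ v → trans (sym (lab-eq f _)) (cong (labF H) (strictlyInverseˡ (bij f) v)))
  (λ v w → trans (sym (adj-eq f _ _)) (cong₂ (adjF H) (strictlyInverseˡ (bij f) v) (strictlyInverseˡ (bij f) w)))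

≃-trans : ∀ {G H K} → G ≃ H → H ≃ K → G ≃ K
≃-trans f g = mk≃ (bij g ↔-∘ bij f) (λ v → trans (lab-eq g _) (lab-eq f v))
  (λ v w → trans (adj-eq g _ _) (adj-eq f v w))

enc : FG → Graph
enc G = mkGraph (card (fin G)) (λ u → labF G (at u)) (λ u v → adjF G (at u) (at v))
  (λ u v → symF G (at u) (at v)) (λ u → irrF G (at u))
  where
  at : Fin (card (fin G)) → V G
  at = from (enum (fin G))

⌜_⌝ : Graph → FG
⌜ G ⌝ = mkFG (Fin (size G)) (finite-Fin _) (lab G) (adj G) (adj-sym G) (adj-irr G)

⌜enc⌝ : ∀ G → ⌜ enc G ⌝ ≃ G
⌜enc⌝ G = mk≃ (↔-sym (enum (fin G))) (λ _ → refl) (λ _ _ → refl)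

≃⇒≅ : ∀ {G H} → G ≃ H → enc G ≅ enc H
≃⇒≅ {G} {H} f = record { iso = bij h ; lab-pres = lab-eq h ; adj-pres = adj-eq h }
  where h = ≃-trans (⌜enc⌝ G) (≃-trans f (≃-sym (⌜enc⌝ H)))

≅⇒≃ : ∀ {G H} → G ≅ H → ⌜ G ⌝ ≃ ⌜ H ⌝
≅⇒≃ f = mk≃ (_≅_.iso f) (_≅_.lab-pres f) (_≅_.adj-pres f)

emptyF : FG
emptyF = ⌜ emptyG ⌝

atomF : Atom → FG
atomF a = ⌜ atomG a ⌝

joinF : (G H : FG) → (V G → V H → Bool) → FG
joinF G H c = mkFG (V G ⊎ V H) (finite-⊎ (fin G) (fin H)) [ labF G , labF H ]′ adjJ adjJ-sym adjJ-irr
  where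
  adjJ : V G ⊎ V H → V G ⊎ V H → Bool
  adjJ (inj₁ v) (inj₁ w) = adjF G v w
  adjJ (inj₁ v) (inj₂ w) = c v w
  adjJ (inj₂ v) (inj₁ w) = c w v
  adjJ (inj₂ v) (inj₂ w) = adjF H v w
  adjJ-sym : ∀ v w → adjJ v w ≡ adjJ w v
  adjJ-sym (inj₁ v) (inj₁ w) = symF G v w
  adjJ-sym (inj₁ v) (inj₂ w) = refl
  adjJ-sym (inj₂ v) (inj₁ w) = refl
  adjJ-sym (inj₂ v) (inj₂ w) = symF H v w
  adjJ-irr : ∀ v → adjJ v v ≡ false
  adjJ-irr (inj₁ v) = irrF G v
  adjJ-irr (inj₂ v) = irrF H v

infixr 6 _⊔F_
opaque
  -- Opaque, so that par is an indivisible operation for unification and for the commutative monoid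
  -- solver.
  _⊔F_ : FG → FG → FG
  G ⊔F H = joinF G H (λ _ _ → false)

plugF : (C : FG) → (V C → Bool) → FG → FG
plugF C R M = joinF C M (λ v _ → R v)

joinG≃joinF : ∀ G H c → ⌜ joinG G H c ⌝ ≃ joinF ⌜ G ⌝ ⌜ H ⌝ c
joinG≃joinF G H c = mk≃ Finₚ.+↔⊎ lab-ok adj-ok
  where
  lab-ok : ∀ v → labF (joinF ⌜ G ⌝ ⌜ H ⌝ c) (splitAt (size G) v) ≡ lab (joinG G H c) v
  lab-ok v = refl
  adj-ok : ∀ v w → adjF (joinF ⌜ G ⌝ ⌜ H ⌝ c) (splitAt (size G) v) (splitAt (size G) w) ≡ adj (joinG G H c) v w
  adj-ok v w with splitAt (size G) v | splitAt (size G) w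
  ... | inj₁ _ | inj₁ _ = refl
  ... | inj₁ _ | inj₂ _ = refl
  ... | inj₂ _ | inj₁ _ = refl
  ... | inj₂ _ | inj₂ _ = refl

joinF-cong : ∀ {G G′ H H′ c c′} (f : G ≃ G′) (g : H ≃ H′) →
  (∀ v w → c′ (to (bij f) v) (to (bij g) w) ≡ c v w) → joinF G H c ≃ joinF G′ H′ c′
joinF-cong f g h = mk≃ (bij f ⊎F.⊎-↔ bij g)
  (λ { (inj₁ v) → lab-eq f v ; (inj₂ v) → lab-eq g v })
  (λ { (inj₁ v) (inj₁ w) → adj-eq f v w ; (inj₁ v) (inj₂ w) → h v w
     ; (inj₂ v) (inj₁ w) → h w v ; (inj₂ v) (inj₂ w) → adj-eq g v w })

joinF-comm : ∀ G H c → joinF G H c ≃ joinF H G (λ w v → c v w)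
joinF-comm G H c = mk≃
  (mk↔ₛ′ (λ { (inj₁ v) → inj₂ v ; (inj₂ v) → inj₁ v }) (λ { (inj₁ v) → inj₂ v ; (inj₂ v) → inj₁ v })
     (λ { (inj₁ v) → refl ; (inj₂ v) → refl }) (λ { (inj₁ v) → refl ; (inj₂ v) → refl }))
  (λ { (inj₁ v) → refl ; (inj₂ v) → refl })
  (λ { (inj₁ v) (inj₁ w) → refl ; (inj₁ v) (inj₂ w) → refl ; (inj₂ v) (inj₁ w) → refl ; (inj₂ v) (inj₂ w) → refl })

joinF-assoc : ∀ A B C c d → 
  joinF (joinF A B c) C d ≃ joinF A (joinF B C (λ v → d (inj₂ v))) (λ v → [ c v , d (inj₁ v) ]′)
joinF-assoc A B C c d = mk≃
  (mk↔ₛ′ (λ { (inj₁ (inj₁ v)) → inj₁ v ; (inj₁ (inj₂ v)) → inj₂ (inj₁ v) ; (inj₂ v) → inj₂ (inj₂ v) })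
         (λ { (inj₁ v) → inj₁ (inj₁ v) ; (inj₂ (inj₁ v)) → inj₁ (inj₂ v) ; (inj₂ (inj₂ v)) → inj₂ v })
         (λ { (inj₁ v) → refl ; (inj₂ (inj₁ v)) → refl ; (inj₂ (inj₂ v)) → refl })
         (λ { (inj₁ (inj₁ v)) → refl ; (inj₁ (inj₂ v)) → refl ; (inj₂ v) → refl }))
  (λ { (inj₁ (inj₁ v)) → refl ; (inj₁ (inj₂ v)) → refl ; (inj₂ v) → refl })
  (λ { (inj₁ (inj₁ v)) (inj₁ (inj₁ w)) → refl ; (inj₁ (inj₁ v)) (inj₁ (inj₂ w)) → refl ; (inj₁ (inj₁ v)) (inj₂ w) → refl
     ; (inj₁ (inj₂ v)) (inj₁ (inj₁ w)) → refl ; (inj₁ (inj₂ v)) (inj₁ (inj₂ w)) → refl ; (inj₁ (inj₂ v)) (inj₂ w) → refl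
     ; (inj₂ v) (inj₁ (inj₁ w)) → refl ; (inj₂ v) (inj₁ (inj₂ w)) → refl ; (inj₂ v) (inj₂ w) → refl })

joinF-emptyʳ : ∀ G H c → ¬ V H → joinF G H c ≃ G
joinF-emptyʳ G H c ∄ = mk≃
  (mk↔ₛ′ (λ { (inj₁ v) → v ; (inj₂ v) → ⊥-elim (∄ v) }) inj₁ (λ _ → refl)
     (λ { (inj₁ v) → refl ; (inj₂ v) → ⊥-elim (∄ v) }))
  (λ { (inj₁ v) → refl ; (inj₂ v) → ⊥-elim (∄ v) })
  (λ { (inj₁ v) (inj₁ w) → refl ; (inj₂ v) _ → ⊥-elim (∄ v) ; (inj₁ _) (inj₂ w) → ⊥-elim (∄ w) })

joinF-emptyˡ : ∀ G H c → ¬ V G → joinF G H c ≃ H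
joinF-emptyˡ G H c ∄ = ≃-trans (joinF-comm G H c) (joinF-emptyʳ H G _ ∄)

empty≃empty : ∀ {G H} → ¬ V G → ¬ V H → G ≃ H
empty≃empty ∄ ∄′ = mk≃ (mk↔ₛ′ (λ v → ⊥-elim (∄ v)) (λ v → ⊥-elim (∄′ v)) (λ v → ⊥-elim (∄′ v)) (λ v → ⊥-elim (∄ v)))
  (λ v → ⊥-elim (∄ v)) (λ v → ⊥-elim (∄ v))

opaque
  unfolding _⊔F_

  ⊔F-join : ∀ G H → G ⊔F H ≃ joinF G H (λ _ _ → false)
  ⊔F-join G H = ≃-refl

  ⊔-comm : ∀ G H → G ⊔F H ≃ H ⊔F G
  ⊔-comm G H = joinF-comm G H _

  ⊔-emptyˡ : ∀ {G H} → ¬ V G → G ⊔F H ≃ H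
  ⊔-emptyˡ {G} {H} = joinF-emptyˡ G H _

  ⊔-emptyʳ : ∀ {G H} → ¬ V H → G ⊔F H ≃ G
  ⊔-emptyʳ {G} {H} = joinF-emptyʳ G H _

  ⌜⊔⌝ : ∀ G H → ⌜ G ⊔ H ⌝ ≃ ⌜ G ⌝ ⊔F ⌜ H ⌝
  ⌜⊔⌝ G H = joinG≃joinF G H _

  ⊔F-cong : ∀ {G G′ H H′} → G ≃ G′ → H ≃ H′ → G ⊔F H ≃ G′ ⊔F H′
  ⊔F-cong f g = joinF-cong f g (λ _ _ → refl)

  ⊔F-assoc : ∀ A B C → (A ⊔F B) ⊔F C ≃ A ⊔F (B ⊔F C)
  ⊔F-assoc A B C = ≃-trans (joinF-assoc A B C (λ _ _ → false) (λ _ _ → false))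
    (joinF-cong ≃-refl ≃-refl (λ { v (inj₁ w) → refl ; v (inj₂ w) → refl }))

⊔F-commutativeMonoid : CommutativeMonoid (lsuc lzero) lzero
⊔F-commutativeMonoid = record
  { Carrier = FG ; _≈_ = _≃_ ; _∙_ = _⊔F_ ; ε = emptyF
  ; isCommutativeMonoid = record
    { isMonoid = record
      { isSemigroup = record
        { isMagma = record
          { isEquivalence = record { refl = ≃-refl ; sym = ≃-sym ; trans = ≃-trans }
          ; ∙-cong = ⊔F-cong }
        ; assoc = ⊔F-assoc }
      ; identity = (λ G → ⊔-emptyˡ (λ ())) , (λ G → ⊔-emptyʳ (λ ())) }
    ; comm = ⊔-comm } }

module ⊔-Solver = CMSolver ⊔F-commutativeMonoid

-- Derivations, contexts and provable surroundings

infix 4 _⟶_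
record _⟶_ (G H : FG) : Set where
  no-eta-equality
  pattern
  constructor ⟨_⟩ᵈ
  field derivation : Derivation GS (enc G) (enc H)
open _⟶_

≃⇒⟶ : ∀ {G H} → G ≃ H → G ⟶ H
≃⇒⟶ f = ⟨ iso-step (≃⇒≅ f) ◅ ε ⟩ᵈ

infixr 5 _▸_
_▸_ : ∀ {G H K} → G ⟶ H → H ⟶ K → G ⟶ K
⟨ d ⟩ᵈ ▸ ⟨ e ⟩ᵈ = ⟨ d ◅◅ e ⟩ᵈ

enc-join : ∀ G H c → enc (joinF G H c) ≅ joinG (enc G) (enc H) (λ u v → c (from (enum (fin G)) u) (from (enum (fin H)) v))
enc-join G H c = record { iso = bij h ; lab-pres = lab-eq h ; adj-pres = adj-eq h }
  where
  h = ≃-trans (⌜enc⌝ (joinF G H c)) (≃-trans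
        (joinF-cong (≃-sym (⌜enc⌝ G)) (≃-sym (⌜enc⌝ H))
          (λ v w → cong₂ c (strictlyInverseʳ (enum (fin G)) v) (strictlyInverseʳ (enum (fin H)) w)))
        (≃-sym (joinG≃joinF (enc G) (enc H) _)))

≅-sym : ∀ {G H} → G ≅ H → H ≅ G
≅-sym f = record { iso = bij h ; lab-pres = lab-eq h ; adj-pres = adj-eq h }
  where h = ≃-sym (≅⇒≃ f)

plug-cong : ∀ C {X Y} → X ≅ Y → plug C X ≅ plug C Y
plug-cong C {X} {Y} f = record { iso = bij h ; lab-pres = lab-eq h ; adj-pres = adj-eq h }
  where
  h = ≃-trans (joinG≃joinF (ctx C) X _) (≃-trans (joinF-cong ≃-refl (≅⇒≃ f) (λ _ _ → refl)) (≃-sym (joinG≃joinF (ctx C) Y _)))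

_⊚_ : Context → Context → Context
C ⊚ D = mkContext (plug C (ctx D)) (λ u → [ R C , R D ]′ (splitAt (size (ctx C)) u))

plug-⊚ : ∀ C D X → plug C (plug D X) ≅ plug (C ⊚ D) X
plug-⊚ C D X = record { iso = bij h ; lab-pres = lab-eq h ; adj-pres = adj-eq h }
  where
  c = ⌜ ctx C ⌝
  d = ⌜ ctx D ⌝
  h = ≃-trans (joinG≃joinF (ctx C) (plug D X) _)
     (≃-trans (joinF-cong ≃-refl (joinG≃joinF (ctx D) X _) (λ _ _ → refl))
     (≃-trans (≃-sym (≃-trans (joinF-assoc c d ⌜ X ⌝ (λ v _ → R C v) (λ v _ → [ R C , R D ]′ v))
                       (joinF-cong ≃-refl ≃-refl (λ { v (inj₁ w) → refl ; v (inj₂ w) → refl }))))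
     (≃-trans (joinF-cong (≃-sym (joinG≃joinF (ctx C) (ctx D) _)) ≃-refl
                 (λ v w → cong [ R C , R D ]′ (strictlyInverseˡ (Finₚ.+↔⊎ {size (ctx C)}) v)))
              (≃-sym (joinG≃joinF (plug C (ctx D)) X _)))))

plug-step : ∀ C {X Y} → Derivation GS X Y → Derivation GS (plug C X) (plug C Y)
plug-step C ε = ε
plug-step C (iso-step f ◅ d) = iso-step (plug-cong C f) ◅ plug-step C d
plug-step C (rule-step D r ◅ d) =
  iso-step (plug-⊚ C D _) ◅ rule-step (C ⊚ D) r ◅ iso-step (≅-sym (plug-⊚ C D _)) ◅ plug-step C d

plugF-mono : ∀ C R {X Y} → X ⟶ Y → plugF C R X ⟶ plugF C R Y
plugF-mono C R {X} {Y} ⟨ d ⟩ᵈ =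
  ⟨ iso-step (enc-join C X _) ◅ plug-step (mkContext (enc C) _) d ◅◅ iso-step (≅-sym (enc-join C Y _)) ◅ ε ⟩ᵈ

rule⇒derivation : ∀ {X Y} → GS X Y → Derivation GS X Y
rule⇒derivation {X} {Y} r = iso-step (un X) ◅ rule-step (mkContext emptyG (λ ())) r ◅ iso-step (≅-sym (un Y)) ◅ ε
  where
  un : ∀ X → X ≅ plug (mkContext emptyG (λ ())) X
  un X = record { iso = bij h ; lab-pres = lab-eq h ; adj-pres = adj-eq h }
    where h = ≃-sym (≃-trans (joinG≃joinF emptyG X _) (joinF-emptyˡ emptyF ⌜ X ⌝ (λ ()) (λ ())))

infix 3 ⊢_
⊢_ : FG → Set
⊢ G = emptyF ⟶ G

inhabited? : ∀ G → Dec (V G)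
inhabited? G with fin G
... | finite zero e = no (λ v → Finₚ.¬Fin0 (to e v))
... | finite (suc n) e = yes (from e zero)

card>0 : ∀ {A : Set} (f : Finite A) → A → 0 < card f
card>0 (finite zero e) a = ⊥-elim (Finₚ.¬Fin0 (to e a))
card>0 (finite (suc n) e) a = s≤s z≤n

enc-NonEmpty : ∀ G → V G → NonEmpty (enc G)
enc-NonEmpty G v = card>0 (fin G) v

any-V? : ∀ G (R : V G → Bool) → Dec (∃ λ v → R v ≡ true)
any-V? G R with Finₚ.any? (λ i → R (from (enum (fin G)) i) Boolₚ.≟ true)
... | yes (i , e) = yes (_ , e)
... | no ∄ = no λ (v , e) → ∄ (to (enum (fin G)) v , trans (cong R (strictlyInverseʳ (enum (fin G)) v)) e)

opaque
  unfolding _⊔F_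

  -- If `A` has no vertex or is attached to nothing, both sides are isomorphic; in all other cases
  -- the side conditions of `ss↓` hold.
  plug⟶par : ∀ B R A → plugF B R A ⟶ B ⊔F A
  plug⟶par B R A with inhabited? A
  ... | no ∄ = ≃⇒⟶ (≃-trans (joinF-emptyʳ B A _ ∄) (≃-sym (joinF-emptyʳ B A _ ∄)))
  ... | yes a with any-V? B R
  ...   | no ∄ = ≃⇒⟶ (joinF-cong {B} {B} {A} {A} ≃-refl ≃-refl (λ v _ → sym (Boolₚ.¬-not (λ e → ∄ (v , e)))))
  ...   | yes (b , e) =
    ⟨ iso-step (enc-join B A _) ◅
    rule⇒derivation (gs-ss↓ (ss↓-inst (enc B) (enc A) (λ u → R (from (enum (fin B)) u))
      (to (enum (fin B)) b , trans (cong R (strictlyInverseʳ (enum (fin B)) b)) e) (enc-NonEmpty A a)))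
    ◅◅ iso-step (≅-sym (enc-join B A _)) ◅ ε ⟩ᵈ

  ⟶-⊔ : ∀ k {z z′} → z ⟶ z′ → k ⊔F z ⟶ k ⊔F z′
  ⟶-⊔ k d = plugF-mono k _ d

  ⟶-⊔⊢ : ∀ z {k} → ⊢ k → z ⟶ z ⊔F k
  ⟶-⊔⊢ z ⊢k = ≃⇒⟶ (≃-sym (joinF-emptyʳ z emptyF _ (λ ()))) ▸ plugF-mono z _ ⊢k

opaque
  unfolding _⊔F_

  -- Seen from `Y` the context is `C` with `X` plugged in, and `Y` is attached to `R` inside `C` and
  -- to nothing in `X`. Switching removes this attachment.
  plugF-pull : ∀ C R X Y → plugF C R (X ⊔F Y) ⟶ plugF C R X ⊔F Y
  plugF-pull C R X Y =
    ≃⇒⟶ (≃-sym (≃-trans (joinF-assoc C X Y _ (λ v _ → [ R , (λ _ → false) ]′ v))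
                  (joinF-cong (≃-refl {C}) ≃-refl λ { v (inj₁ w) → refl ; v (inj₂ w) → refl })))
    ▸ plug⟶par (plugF C R X) [ R , (λ _ → false) ]′ Y

plugF-provable : ∀ C R {K} → ⊢ K → C ⟶ plugF C R K
plugF-provable C R {K} ⊢K = ≃⇒⟶ (≃-sym (joinF-emptyʳ C emptyF _ (λ ()))) ▸ plugF-mono C R ⊢K

⊢-plug : ∀ C R {K} → ⊢ C → ⊢ K → ⊢ plugF C R K
⊢-plug C R ⊢C ⊢K = ⊢C ▸ plugF-provable C R ⊢K

-- Bare derivations would not do: ⊢ G ⊔ a does not imply that G can be derived from
-- the dual atom of a, only that this holds up to a provable graph around the atom.
infix 4 _⇒_
record _⇒_ (z z′ : FG) : Set₁ where
  no-eta-equality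
  pattern
  constructor via
  field
    around   : FG
    attach   : V around → Bool
    provable : ⊢ around
    run      : plugF around attach z ⟶ z′

⟶⇒⇒ : ∀ {z z′} → z ⟶ z′ → z ⇒ z′
⟶⇒⇒ {z} d = via emptyF (λ ()) (≃⇒⟶ ≃-refl) (≃⇒⟶ (joinF-emptyˡ emptyF z _ (λ ())) ▸ d)

≃⇒⇒ : ∀ {z z′} → z ≃ z′ → z ⇒ z′
≃⇒⇒ f = ⟶⇒⇒ (≃⇒⟶ f)

infixr 5 _▹_
-- The composite surrounding is the first one plugged into the second, which is provable because a
-- provable graph can be inserted anywhere.
_▹_ : ∀ {x y z} → x ⇒ y → y ⇒ z → x ⇒ z
_▹_ {x} (via W R w d) (via W′ R′ w′ d′) =
  via (plugF W′ R′ W) [ R′ , R ]′ (⊢-plug W′ R′ w′ w)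
    (≃⇒⟶ (≃-trans (joinF-assoc W′ W x _ _)
       (joinF-cong (≃-refl {W′}) ≃-refl λ { v (inj₁ w) → refl ; v (inj₂ w) → refl }))
     ▸ plugF-mono W′ R′ d ▸ d′)

-- The surrounding is put around `z ⊔F k` as a whole; `plugF-pull` then takes `k` out of it.
⇒-⊔ʳ : ∀ {z z′} k → z ⇒ z′ → z ⊔F k ⇒ z′ ⊔F k
⇒-⊔ʳ {z} {z′} k (via W R w d) = via W R w
  (plugF-pull W R z k ▸ ≃⇒⟶ (⊔-comm _ k) ▸ ⟶-⊔ k d ▸ ≃⇒⟶ (⊔-comm k z′))

⇒-⊔ˡ : ∀ {z z′} k → z ⇒ z′ → k ⊔F z ⇒ k ⊔F z′
⇒-⊔ˡ {z} {z′} k r = ≃⇒⇒ (⊔-comm k z) ▹ ⇒-⊔ʳ k r ▹ ≃⇒⇒ (⊔-comm z′ k)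

⊢-⇒ : ∀ {z z′} → z ⇒ z′ → ⊢ z → ⊢ z′
⊢-⇒ (via W R w d) ⊢z = ⊢-plug W R w ⊢z ▸ d

⇒-⊔⊢ : ∀ z {k} → ⊢ k → z ⇒ z ⊔F k
⇒-⊔⊢ z ⊢k = ⟶⇒⇒ (⟶-⊔⊢ z ⊢k)

⊢-⊔ : ∀ {y z} → ⊢ y → ⊢ z → ⊢ y ⊔F z
⊢-⊔ {y} ⊢y ⊢z = ⊢y ▸ ⟶-⊔⊢ y ⊢z

⊢-empty : ∀ {G} → ¬ V G → ⊢ G
⊢-empty ∄ = ≃⇒⟶ (empty≃empty (λ ()) ∄)

-- Composition along a graph

-- Boolean-valued, so that membership is decidable and its proofs are unique. Equality of sets is
-- mutual inclusion, whence transport lemmas such as `𝕌-resp`.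
Sub : ℕ → Set
Sub n = Fin n → Bool

infix 4 _∈_ _∉_
_∈_ _∉_ : ∀ {n} → Fin n → Sub n → Set
v ∈ S = S v ≡ true
v ∉ S = S v ≡ false

∈-irr : ∀ {b} (p q : b ≡ true) → p ≡ q
∈-irr refl refl = refl

clash : ∀ {ℓ} {A : Set ℓ} {b} → b ≡ true → b ≡ false → A
clash refl ()

¬∈⇒∉ : ∀ {b} → ¬ (b ≡ true) → b ≡ false
¬∈⇒∉ = Boolₚ.¬-not

_∈?_ : ∀ {n} (v : Fin n) (S : Sub n) → v ∈ S ⊎ v ∉ S
v ∈? S with S v
... | true  = inj₁ refl
... | false = inj₂ refl

infixl 7 _∩_
infixl 6 _∖_
_∩_ _∖_ : ∀ {n} → Sub n → Sub n → Sub n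
(S ∩ T) v = S v ∧ T v
(S ∖ T) v = S v ∧ not (T v)

fib : ∀ {m n} → (Fin m → Fin n) → Fin n → Sub m
fib q t v = does (q v Fin.≟ t)

_-_ : ∀ {n} → Sub n → Fin n → Sub n
S - k = S ∖ fib id k

∩⁺ : ∀ {a b} → a ≡ true → b ≡ true → a ∧ b ≡ true
∩⁺ refl refl = refl

∩₁ : ∀ {a b} → a ∧ b ≡ true → a ≡ true
∩₁ {true} _ = refl

∩₂ : ∀ {a b} → a ∧ b ≡ true → b ≡ true
∩₂ {true} e = e

∖⁺ : ∀ {a b} → a ≡ true → b ≡ false → a ∧ not b ≡ true
∖⁺ refl refl = refl

∖₂ : ∀ {a b} → a ∧ not b ≡ true → b ≡ false
∖₂ {true} {false} _ = refl

fib⁺ : ∀ {m n} (q : Fin m → Fin n) {t v} → q v ≡ t → v ∈ fib q t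
fib⁺ q e = dec-true (_ Fin.≟ _) e

fib⁻ : ∀ {m n} (q : Fin m → Fin n) {t v} → v ∈ fib q t → q v ≡ t
fib⁻ q {t} {v} e with q v Fin.≟ t
... | yes p = p
fib⁻ q {t} {v} () | no _

∉fib⁺ : ∀ {m n} (q : Fin m → Fin n) {t v} → q v ≢ t → v ∉ fib q t
∉fib⁺ q e = dec-false (_ Fin.≟ _) e

∉fib⁻ : ∀ {m n} (q : Fin m → Fin n) {t v} → v ∉ fib q t → q v ≢ t
∉fib⁻ q e p = clash (fib⁺ q p) e

-- G ⁺⁻ false stands for the dual of G.
record PG : Set where
  constructor _⁺⁻_
  field
    gr  : Graph
    pol : Bool
open PG

N : PG → ℕ
N Γ = size (gr Γ)

sgn : Bool → Bool → Bool
sgn true  b = b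
sgn false b = not b

-- On the diagonal of a negative graph the value is `true`. For this reason `compAdj`, `Quot` and
-- `Hom` consult it only at distinct vertices.
edge : (Γ : PG) → Fin (N Γ) → Fin (N Γ) → Bool
edge Γ v w = sgn (pol Γ) (adj (gr Γ) v w)

edge-sym : ∀ Γ v w → edge Γ v w ≡ edge Γ w v
edge-sym Γ v w = cong (sgn (pol Γ)) (adj-sym (gr Γ) v w)

plab : (Γ : PG) → Fin (N Γ) → Atom
plab Γ v = if pol Γ then lab (gr Γ) v else dualAtom (lab (gr Γ) v)

neg : PG → PG
neg (G ⁺⁻ b) = G ⁺⁻ not b

dual-dual : ∀ a → dualAtom (dualAtom a) ≡ a
dual-dual (x , true)  = refl
dual-dual (x , false) = refl

plab-neg : ∀ Γ v → plab (neg Γ) v ≡ dualAtom (plab Γ v)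
plab-neg (G ⁺⁻ true)  v = refl
plab-neg (G ⁺⁻ false) v = sym (dual-dual _)

edge-neg : ∀ Γ v w → edge (neg Γ) v w ≡ not (edge Γ v w)
edge-neg (G ⁺⁻ true)  v w = refl
edge-neg (G ⁺⁻ false) v w = sym (Boolₚ.not-involutive _)

module _ (Γ : PG) (u : Fin (N Γ) → FG) where

  -- The decision is an argument, so that lemmas can match on it while `s` and `t` are still
  -- variables.
  compAdj : ∀ {s t} → Dec (s ≡ t) → V (u s) → V (u t) → Bool
  compAdj {s} {t} (yes refl) a b = adjF (u s) a b
  compAdj {s} {t} (no _)     a b = edge Γ s t

  compAdj-sym : ∀ {s t} (d : Dec (s ≡ t)) (d′ : Dec (t ≡ s)) a b → compAdj d a b ≡ compAdj d′ b a
  compAdj-sym {s} (yes refl) (yes refl) a b = symF (u s) a b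
  compAdj-sym (yes refl) (no ¬p) a b = ⊥-elim (¬p refl)
  compAdj-sym (no ¬p) (yes refl) a b = ⊥-elim (¬p refl)
  compAdj-sym {s} {t} (no _) (no _) a b = edge-sym Γ s t

  compAdj-irr : ∀ {s} (d : Dec (s ≡ s)) a → compAdj d a a ≡ false
  compAdj-irr {s} (yes refl) a = irrF (u s) a
  compAdj-irr (no ¬p) a = ⊥-elim (¬p refl)

  compAdj-no : ∀ {s t} (d : Dec (s ≡ t)) → s ≢ t → ∀ a b → compAdj d a b ≡ edge Γ s t
  compAdj-no (yes p) s≢t a b = ⊥-elim (s≢t p)
  compAdj-no (no _)  s≢t a b = refl

  compAdj-yes : ∀ {s} (d : Dec (s ≡ s)) → ∀ a b → compAdj d a b ≡ adjF (u s) a b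
  compAdj-yes (yes refl) a b = refl
  compAdj-yes (no ¬p) a b = ⊥-elim (¬p refl)

  Comp : Sub (N Γ) → FG
  Comp T = mkFG (Σ (Fin (N Γ)) λ t → t ∈ T × V (u t))
    (finite-Σ (finite-Fin _) (λ t → finite-Σ (finite-≡ _) (λ _ → fin (u t))))
    (λ (t , _ , a) → labF (u t) a)
    (λ (s , _ , a) (t , _ , b) → compAdj (s Fin.≟ t) a b)
    (λ (s , _ , a) (t , _ , b) → compAdj-sym (s Fin.≟ t) (t Fin.≟ s) a b)
    (λ (s , _ , a) → compAdj-irr (s Fin.≟ s) a)

,-irr : ∀ {n} {T : Sub n} {A : Fin n → Set} {t} {p p′ : t ∈ T} {a a′ : A t} →
  a ≡ a′ → _≡_ {A = Σ (Fin n) λ t → t ∈ T × A t} (t , p , a) (t , p′ , a′)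
,-irr {p = p} {p′} refl with ∈-irr p p′
... | refl = refl

Comp-cong : ∀ Γ T u u′ → (∀ t → t ∈ T → u t ≃ u′ t) → Comp Γ u T ≃ Comp Γ u′ T
Comp-cong Γ T u u′ f = mk≃
  (mk↔ₛ′ (λ (t , p , a) → t , p , to (bij (f t p)) a) (λ (t , p , a) → t , p , from (bij (f t p)) a)
     (λ (t , p , a) → ,-irr (strictlyInverseˡ (bij (f t p)) a)) (λ (t , p , a) → ,-irr (strictlyInverseʳ (bij (f t p)) a)))
  (λ (t , p , a) → lab-eq (f t p) a)
  (λ (s , p , a) (t , q , b) → aux (s Fin.≟ t) p q a b)
  where
  aux : ∀ {s t} (d : Dec (s ≡ t)) (p : s ∈ T) (q : t ∈ T) a b →
    compAdj Γ u′ d (to (bij (f s p)) a) (to (bij (f t q)) b) ≡ compAdj Γ u d a b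
  aux (yes refl) p q a b with ∈-irr p q
  ... | refl = adj-eq (f _ p) a b
  aux (no _) p q a b = refl

-- The link between compositions and contexts: the component at `k` becomes the content of a hole,
-- where it can be rewritten, inserted or dropped.
Comp-peel : ∀ Γ u {T k} → k ∈ T → Comp Γ u T ≃ plugF (Comp Γ u (T - k)) (λ (s , _) → edge Γ s k) (u k)
Comp-peel Γ u {T} {k} k∈T = mk≃
  (mk↔ₛ′ (λ (t , p , a) → f (t Fin.≟ k) p a) g
     (λ { (inj₁ (t , p , a)) → fg₁ (t Fin.≟ k) p a ; (inj₂ a) → fg₂ (k Fin.≟ k) a })
     (λ (t , p , a) → gf (t Fin.≟ k) p a))
  (λ (t , p , a) → l (t Fin.≟ k) p a)
  (λ (s , p , a) (t , q , b) → e (s Fin.≟ k) (t Fin.≟ k) p q a b)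
  where
  K = plugF (Comp Γ u (T - k)) (λ (s , _) → edge Γ s k) (u k)
  f : ∀ {t} → Dec (t ≡ k) → t ∈ T → V (u t) → V K
  f (yes refl) p a = inj₂ a
  f (no ¬e)    p a = inj₁ (_ , ∖⁺ p (∉fib⁺ id ¬e) , a)
  g : V K → V (Comp Γ u T)
  g (inj₁ (t , p , a)) = t , ∩₁ p , a
  g (inj₂ a)           = k , k∈T , a
  fg₁ : ∀ {t} (d : Dec (t ≡ k)) p (a : V (u t)) → f d (∩₁ p) a ≡ inj₁ (t , p , a)
  fg₁ (yes refl) p a = ⊥-elim (∉fib⁻ id {k} {k} (∖₂ {T k} p) refl)
  fg₁ (no ¬e)    p a = cong inj₁ (,-irr refl)
  fg₂ : (d : Dec (k ≡ k)) (a : V (u k)) → f d k∈T a ≡ inj₂ a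
  fg₂ (yes refl) a = refl
  fg₂ (no ¬e)    a = ⊥-elim (¬e refl)
  gf : ∀ {t} (d : Dec (t ≡ k)) p (a : V (u t)) → g (f d p a) ≡ (t , p , a)
  gf (yes refl) p a = ,-irr refl
  gf (no ¬e)    p a = ,-irr refl
  l : ∀ {t} (d : Dec (t ≡ k)) p (a : V (u t)) → labF K (f d p a) ≡ labF (u t) a
  l (yes refl) p a = refl
  l (no ¬e)    p a = refl
  e : ∀ {s t} (c : Dec (s ≡ k)) (d : Dec (t ≡ k)) p q (a : V (u s)) (b : V (u t)) →
    adjF K (f c p a) (f d q b) ≡ compAdj Γ u (s Fin.≟ t) a b
  e (yes refl) (yes refl) p q a b = sym (compAdj-yes Γ u (k Fin.≟ k) a b)
  e (yes refl) (no ¬e) p q a b = trans (edge-sym Γ _ k) (sym (compAdj-no Γ u (k Fin.≟ _) (¬e ∘ sym) a b))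
  e (no ¬e) (yes refl) p q a b = sym (compAdj-no Γ u (_ Fin.≟ k) ¬e a b)
  e (no ¬e) (no ¬e′) p q a b = refl

Comp-single : ∀ Γ u {T k} → k ∈ T → (∀ t → t ∈ T → t ≡ k) → Comp Γ u T ≃ u k
Comp-single Γ u {T} {k} k∈T only = ≃-trans (Comp-peel Γ u k∈T)
  (joinF-emptyˡ _ (u k) _ (λ (t , p , _) → ∉fib⁻ id {k} {t} (∖₂ {T t} p) (only t (∩₁ p))))

-- The fibres of `q` are modules of the subgraph on `S`, and edges between different fibres are read
-- off in `Δ`. The map may miss vertices of `T`, so fibres can be empty; surjectivity is the
-- separate condition `Onto`.
record Quot (Γ : PG) (S : Sub (N Γ)) (Δ : PG) (T : Sub (N Δ)) (q : Fin (N Γ) → Fin (N Δ)) : Set where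
  constructor quot
  field
    into : ∀ v → v ∈ S → q v ∈ T
    resp : ∀ v w → v ∈ S → w ∈ S → q v ≢ q w → edge Γ v w ≡ edge Δ (q v) (q w)
open Quot

Quot-neg : ∀ {Γ S Δ T q} → Quot Γ S Δ T q → Quot (neg Γ) S (neg Δ) T q
Quot-neg {Γ} {Δ = Δ} Q = quot (into Q) λ v w p r ne →
  trans (edge-neg Γ v w) (trans (cong not (resp Q v w p r ne)) (sym (edge-neg Δ _ _)))

Comp-assoc : ∀ {Γ S Δ T q} u → Quot Γ S Δ T q → Comp Γ u S ≃ Comp Δ (λ t → Comp Γ u (S ∩ fib q t)) T
Comp-assoc {Γ} {S} {Δ} {T} {q} u Q = mk≃
  (mk↔ₛ′ f g fg (λ (v , p , a) → ,-irr refl)) (λ _ → refl) e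
  where
  u′ : Fin (N Δ) → FG
  u′ t = Comp Γ u (S ∩ fib q t)
  f : V (Comp Γ u S) → V (Comp Δ u′ T)
  f (v , p , a) = q v , into Q v p , v , ∩⁺ p (fib⁺ q refl) , a
  g : V (Comp Δ u′ T) → V (Comp Γ u S)
  g (t , _ , v , p , a) = v , ∩₁ p , a
  fg : ∀ y → f (g y) ≡ y
  fg (t , r , v , p , a) with fib⁻ q {t} {v} (∩₂ {S v} p)
  ... | refl = trans (,-irr (,-irr refl)) refl
  same : ∀ {t t′} (d : Dec (t ≡ t′)) → t ≡ t′ → (x : V (u′ t)) (y : V (u′ t′)) →
    compAdj Δ u′ d x y ≡ compAdj Γ u (proj₁ x Fin.≟ proj₁ y) (proj₂ (proj₂ x)) (proj₂ (proj₂ y))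
  same (yes refl) _ x y = refl
  same (no ¬p) p x y = ⊥-elim (¬p p)
  e : ∀ x y → adjF (Comp Δ u′ T) (f x) (f y) ≡ adjF (Comp Γ u S) x y
  e (v , p , a) (w , r , b) with q v Fin.≟ q w
  ... | yes eq = same (yes eq) eq _ _
  ... | no ne  = sym (trans (compAdj-no Γ u (v Fin.≟ w) (ne ∘ cong q) a b) (resp Q v w p r ne))

Comp-drop : ∀ Γ u {T k} → k ∈ T → ⊢ u k → Comp Γ u (T - k) ⟶ Comp Γ u T
Comp-drop Γ u k∈T ⊢k = plugF-provable _ _ ⊢k ▸ ≃⇒⟶ (≃-sym (Comp-peel Γ u k∈T))

Comp-hole : ∀ Γ u u′ {T k X} → k ∈ T → (∀ t → t ∈ T → t ≢ k → u t ≃ u′ t) → u k ≃ X →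
  Comp Γ u T ≃ plugF (Comp Γ u′ (T - k)) (λ (s , _) → edge Γ s k) X
Comp-hole Γ u u′ {T} {k} k∈T h hk = ≃-trans (Comp-peel Γ u k∈T)
  (joinF-cong (Comp-cong Γ _ u u′ (λ t p → h t (∩₁ p) (∉fib⁻ id {k} {t} (∖₂ {T t} p)))) hk (λ _ _ → refl))

Comp-pull : ∀ Γ u u′ {T k x} → k ∈ T → (∀ t → t ∈ T → t ≢ k → u′ t ≃ u t) → u′ k ≃ u k ⊔F x →
  Comp Γ u′ T ⟶ Comp Γ u T ⊔F x
Comp-pull Γ u u′ {T} {k} {x} k∈T h hk =
  ≃⇒⟶ (Comp-hole Γ u′ u k∈T h hk) ▸ plugF-pull _ _ (u k) x
  ▸ ≃⇒⟶ (⊔F-cong (≃-sym (Comp-peel Γ u k∈T)) ≃-refl)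

-- The other components together with `x` form the provable surrounding, and `u k` is attached to
-- them as `k` prescribes. This is the typical use of `⇒`.
Comp-around : ∀ Γ u {T k x} → k ∈ T → ⊢ Comp Γ u (T - k) ⊔F x → u k ⇒ Comp Γ u T ⊔F x
Comp-around Γ u {T} {k} {x} k∈T ⊢W = via (joinF C x (λ _ _ → false)) att (⊢W ▸ ≃⇒⟶ (⊔F-join C x)) (≃⇒⟶ shuffle)
  where
  C = Comp Γ u (T - k)
  E : V C → Bool
  E (s , _) = edge Γ s k
  att : V C ⊎ V x → Bool
  att = [ E , (λ _ → false) ]′
  shuffle : plugF (joinF C x (λ _ _ → false)) att (u k) ≃ Comp Γ u T ⊔F x
  shuffle = ≃-trans (joinF-assoc C x (u k) (λ _ _ → false) (λ v _ → att v))
    (≃-trans (joinF-cong {c′ = λ v → [ (λ _ → E v) , (λ _ → false) ]′} (≃-refl {C}) (joinF-comm x (u k) (λ _ _ → false))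
                (λ { v (inj₁ w) → refl ; v (inj₂ w) → refl }))
    (≃-trans (≃-sym (joinF-assoc C (u k) x (λ v _ → E v) (λ _ _ → false)))
    (≃-trans (≃-sym (⊔F-join (plugF C (λ v → E v) (u k)) x))
             (⊔F-cong (≃-sym (Comp-peel Γ u k∈T)) ≃-refl))))

upd : ∀ {n} {A : Set₁} → (Fin n → A) → Fin n → A → Fin n → A
upd u k X t with t Fin.≟ k
... | yes _ = X
... | no  _ = u t

upd-≡ : ∀ {n} {A : Set₁} (u : Fin n → A) k X → upd u k X k ≡ X
upd-≡ u k X with k Fin.≟ k
... | yes _ = refl
... | no ne = ⊥-elim (ne refl)

upd-≢ : ∀ {n} {A : Set₁} (u : Fin n → A) k X {t} → t ≢ k → upd u k X t ≡ u t
upd-≢ u k X {t} ne with t Fin.≟ k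
... | yes e = ⊥-elim (ne e)
... | no _  = refl

≡⇒≃ : ∀ {G H} → G ≡ H → G ≃ H
≡⇒≃ refl = ≃-refl

Comp-upd : ∀ Γ u {T} k x → k ∈ T → Comp Γ (upd u k (u k ⊔F x)) T ⟶ Comp Γ u T ⊔F x
Comp-upd Γ u k x k∈T = Comp-pull Γ u _ k∈T (λ t _ ne → ≡⇒≃ (upd-≢ u k _ ne)) (≡⇒≃ (upd-≡ u k _))

-- Prime quotients

bit : Bool → ℕ
bit true  = 1
bit false = 0

count : ∀ {n} → Sub n → ℕ
count {zero}  S = 0
count {suc n} S = bit (S zero) + count (S ∘ suc)

bit-≤ : ∀ {a b} → (a ≡ true → b ≡ true) → bit a ≤ bit b
bit-≤ {false}        f = z≤n
bit-≤ {true} {true}  f = s≤s z≤n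
bit-≤ {true} {false} f with f refl
... | ()

count-≤ : ∀ {n} {S T : Sub n} → (∀ v → v ∈ S → v ∈ T) → count S ≤ count T
count-≤ {zero}  f = z≤n
count-≤ {suc n} f = ℕₚ.+-mono-≤ (bit-≤ (f zero)) (count-≤ (f ∘ suc))

count-< : ∀ {n} {S T : Sub n} → (∀ v → v ∈ S → v ∈ T) → ∀ k → k ∈ T → k ∉ S → count S < count T
count-< {suc n} {S} {T} f zero k∈T k∉S with S zero | T zero
count-< {suc n} {S} {T} f zero refl refl | false | true = s≤s (count-≤ (f ∘ suc))
count-< {suc n} {S} {T} f (suc k) k∈T k∉S =
  ℕₚ.+-mono-≤-< (bit-≤ (f zero)) (count-< (f ∘ suc) k k∈T k∉S)

-- This is the notion of a module of the subgraph on `T`; equality of two edges replaces the choice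
-- between all and none.
Hom : (Γ : PG) (T M : Sub (N Γ)) → Set
Hom Γ T M = ∀ v x y → v ∈ T → v ∉ M → x ∈ T → x ∈ M → y ∈ T → y ∈ M → edge Γ v x ≡ edge Γ v y

-- Every set with at most two elements has this property. Two-element quotients are treated as par
-- or tensor, the others carry the bound `Big`.
PrimeS : (Γ : PG) (T : Sub (N Γ)) → Set
PrimeS Γ T = ∀ M → Hom Γ T M →
  (∀ x → x ∈ T → x ∉ M) ⊎ (∃ λ v → ∀ x → x ∈ T → x ∈ M → x ≡ v) ⊎ (∀ x → x ∈ T → x ∈ M)

-- Three elements are the right bound to decide: for a prime set `fourth` then supplies the fourth
-- vertex demanded by `p↓`.
record Big {n} (T : Sub n) : Set where
  constructor big
  field
    {a b c} : Fin n
    a∈ : a ∈ T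
    b∈ : b ∈ T
    c∈ : c ∈ T
    ab : a ≢ b
    ac : a ≢ c
    bc : b ≢ c

Onto : ∀ {m n} → Sub m → Sub n → (Fin m → Fin n) → Set
Onto S T q = ∀ t → t ∈ T → ∃ λ v → v ∈ S × q v ≡ t

Quot-id : ∀ Γ T → Quot Γ T Γ T id
Quot-id Γ T = quot (λ _ p → p) (λ _ _ _ _ _ → refl)

Quot-∘ : ∀ {Γ S Δ T Ε U q r} → Quot Γ S Δ T q → Quot Δ T Ε U r → Quot Γ S Ε U (r ∘ q)
Quot-∘ {q = q} {r} P Q = quot (λ v p → into Q _ (into P v p))
  λ v w p p′ ne → trans (resp P v w p p′ (ne ∘ cong r)) (resp Q _ _ (into P v p) (into P w p′) ne)

Quot-⊆ : ∀ {Γ S S′ Δ T q} → (∀ v → v ∈ S′ → v ∈ S) → Quot Γ S Δ T q → Quot Γ S′ Δ T q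
Quot-⊆ h Q = quot (λ v p → into Q v (h v p)) (λ v w p p′ → resp Q v w (h v p) (h w p′))

module _ (Γ : PG) (T : Sub (N Γ)) where

  Nontrivial : Sub (N Γ) → Set
  Nontrivial M = Hom Γ T M × (∃ λ z → z ∈ T × z ∉ M) × (∃ λ x → ∃ λ y → x ∈ T × x ∈ M × y ∈ T × y ∈ M × x ≢ y)

  Nontrivial? : ∀ M → Dec (Nontrivial M)
  Nontrivial? M =
    Finₚ.all? (λ v → Finₚ.all? λ x → Finₚ.all? λ y →
      (T v Boolₚ.≟ true) →-dec (M v Boolₚ.≟ false) →-dec (T x Boolₚ.≟ true) →-dec (M x Boolₚ.≟ true) →-dec
      (T y Boolₚ.≟ true) →-dec (M y Boolₚ.≟ true) →-dec (edge Γ v x Boolₚ.≟ edge Γ v y))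
    ×-dec Finₚ.any? (λ z → (T z Boolₚ.≟ true) ×-dec (M z Boolₚ.≟ false))
    ×-dec Finₚ.any? (λ x → Finₚ.any? λ y → (T x Boolₚ.≟ true) ×-dec (M x Boolₚ.≟ true) ×-dec
      (T y Boolₚ.≟ true) ×-dec (M y Boolₚ.≟ true) ×-dec ¬? (x Fin.≟ y))

  Nontrivial-resp : ∀ {M M′} → (∀ v → M′ v ≡ M v) → Nontrivial M → Nontrivial M′
  Nontrivial-resp h (hom , (z , z∈ , z∉) , x , y , x∈ , xM , y∈ , yM , ne) =
    (λ v x y v∈ v∉ x∈ xM y∈ yM → hom v x y v∈ (trans (sym (h v)) v∉) x∈ (trans (sym (h x)) xM) y∈ (trans (sym (h y)) yM)) ,
    (z , z∈ , trans (h z) z∉) , x , y , x∈ , trans (h x) xM , y∈ , trans (h y) yM , ne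

  -- Decided by searching all subsets, coded as bit vectors; `tabulate` and `Nontrivial-resp`
  -- translate a Boolean function into such a vector.
  prime⊎nontrivial : PrimeS Γ T ⊎ ∃ Nontrivial
  prime⊎nontrivial with Subsetₚ.anySubset? (λ s → Nontrivial? (lookup s))
  ... | yes (s , nt) = inj₂ (lookup s , nt)
  ... | no ∄ = inj₁ prime
    where
    prime : PrimeS Γ T
    prime M hom with Finₚ.any? (λ x → (T x Boolₚ.≟ true) ×-dec (M x Boolₚ.≟ true))
    ... | no none = inj₁ (λ x x∈ → ¬∈⇒∉ (λ xM → none (x , x∈ , xM)))
    ... | yes (x , x∈ , xM) with Finₚ.any? (λ y → (T y Boolₚ.≟ true) ×-dec (M y Boolₚ.≟ true) ×-dec ¬? (x Fin.≟ y))
    ...   | no none = inj₂ (inj₁ (x , single))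
      where
      single : ∀ y → y ∈ T → y ∈ M → y ≡ x
      single y y∈ yM with x Fin.≟ y
      ... | yes e = sym e
      ... | no ne = ⊥-elim (none (y , y∈ , yM , ne))
    ...   | yes (y , y∈ , yM , ne) with Finₚ.any? (λ z → (T z Boolₚ.≟ true) ×-dec (M z Boolₚ.≟ false))
    ...     | no none = inj₂ (inj₂ (λ z z∈ → [ id , (λ z∉ → ⊥-elim (none (z , z∈ , z∉))) ]′ (z ∈? M)))
    ...     | yes (z , z∈ , z∉) = ⊥-elim (∄ (tabulate M ,
                Nontrivial-resp (Vecₚ.lookup∘tabulate M) (hom , (z , z∈ , z∉) , x , y , x∈ , xM , y∈ , yM , ne)))

record PrimeQuotient (Γ : PG) (T : Sub (N Γ)) : Set where
  constructor pq
  field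
    T₁    : Sub (N Γ)
    r     : Fin (N Γ) → Fin (N Γ)
    quo   : Quot Γ T Γ T₁ r
    onto  : Onto T T₁ r
    prime : PrimeS Γ T₁
    two   : ∃ λ s → ∃ λ t → s ∈ T₁ × t ∈ T₁ × s ≢ t

-- Contracting a nontrivial module to one of its vertices keeps the quotient an induced subgraph.
primeQuotient : ∀ n Γ T → count T ≤ n → (∃ λ s → ∃ λ t → s ∈ T × t ∈ T × s ≢ t) → PrimeQuotient Γ T
primeQuotient zero Γ T le (s , _ , s∈ , _) = ⊥-elim (ℕₚ.n≮0 (ℕₚ.≤-trans (count-< {S = λ _ → false} (λ _ ()) s s∈ refl) le))
primeQuotient (suc n) Γ T le tw with prime⊎nontrivial Γ T
... | inj₁ prime = pq T id (Quot-id Γ T) (λ t p → t , p , refl) prime tw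
... | inj₂ (M , hom , (z , z∈ , z∉) , m , y , m∈ , mM , y∈ , yM , ne) = compose
  where
  ρ′ : ∀ {v} → v ∈ M ⊎ v ∉ M → Fin (N Γ)
  ρ′ (inj₁ _) = m
  ρ′ {v} (inj₂ _) = v
  ρ : Fin (N Γ) → Fin (N Γ)
  ρ v = ρ′ (v ∈? M)
  T′ : Sub (N Γ)
  T′ = T ∖ (M - m)
  m∈T′ : m ∈ T′
  m∈T′ = ∖⁺ m∈ (trans (cong (λ b → M m ∧ not b) (fib⁺ id {m} refl)) (Boolₚ.∧-zeroʳ (M m)))
  out∈T′ : ∀ {v} → v ∈ T → v ∉ M → v ∈ T′
  out∈T′ {v} v∈ v∉ = ∖⁺ v∈ (cong (λ b → b ∧ not (fib id m v)) v∉)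
  Q : Quot Γ T Γ T′ ρ
  Q = quot (λ v p → ins (v ∈? M) p) (λ v w p p′ → res (v ∈? M) (w ∈? M) p p′)
    where
    ins : ∀ {v} (d : v ∈ M ⊎ v ∉ M) → v ∈ T → ρ′ d ∈ T′
    ins (inj₁ _) p = m∈T′
    ins (inj₂ v∉) p = out∈T′ p v∉
    res : ∀ {v w} (c : v ∈ M ⊎ v ∉ M) (d : w ∈ M ⊎ w ∉ M) → v ∈ T → w ∈ T → ρ′ c ≢ ρ′ d → edge Γ v w ≡ edge Γ (ρ′ c) (ρ′ d)
    res (inj₁ _) (inj₁ _) p p′ neq = ⊥-elim (neq refl)
    res {v} {w} (inj₁ vM) (inj₂ w∉) p p′ neq =
      trans (edge-sym Γ v w) (trans (hom w v m p′ w∉ p vM m∈ mM) (edge-sym Γ w m))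
    res {v} {w} (inj₂ v∉) (inj₁ wM) p p′ neq = hom v w m p v∉ p′ wM m∈ mM
    res (inj₂ _) (inj₂ _) p p′ neq = refl
  onto′ : Onto T T′ ρ
  onto′ t t∈ = t , ∩₁ t∈ , fix (t ∈? M)
    where
    fix : (d : t ∈ M ⊎ t ∉ M) → ρ′ d ≡ t
    fix (inj₂ _) = refl
    fix (inj₁ tM) with m Fin.≟ t
    ... | yes e = e
    ... | no ne′ = clash (∖⁺ tM (∉fib⁺ id (ne′ ∘ sym))) (∖₂ {T t} t∈)
  rec : PrimeQuotient Γ T′
  rec = primeQuotient n Γ T′
    (ℕₚ.≤-pred (ℕₚ.≤-trans (count-< (λ v → ∩₁) y y∈
       (trans (cong (λ b → T y ∧ not b) (∖⁺ yM (∉fib⁺ id (ne ∘ sym)))) (Boolₚ.∧-zeroʳ (T y)))) le))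
    (m , z , m∈T′ , out∈T′ z∈ z∉ , λ { refl → clash mM z∉ })
  compose : PrimeQuotient Γ T
  compose with rec
  ... | pq T₁ r quo onto prime two = pq T₁ (r ∘ ρ) (Quot-∘ Q quo) onto″ prime two
    where
    onto″ : Onto T T₁ (r ∘ ρ)
    onto″ t t∈ with onto t t∈
    ... | v , v∈ , e with onto′ v v∈
    ...   | w , w∈ , e′ = w , w∈ , trans (cong r e′) e

other : ∀ {n} {T : Sub n} → Big T → ∀ i j → ∃ λ k → k ∈ T × k ≢ i × k ≢ j
other (big {a} {b} {c} a∈ b∈ c∈ ab ac bc) i j with a Fin.≟ i | a Fin.≟ j | b Fin.≟ i | b Fin.≟ j | c Fin.≟ i | c Fin.≟ j
... | no p | no q | _ | _ | _ | _ = a , a∈ , p , q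
... | _ | _ | no p | no q | _ | _ = b , b∈ , p , q
... | _ | _ | _ | _ | no p | no q = c , c∈ , p , q
... | yes refl | _ | yes refl | _ | _ | _ = ⊥-elim (ab refl)
... | yes refl | _ | _ | _ | yes refl | _ = ⊥-elim (ac refl)
... | _ | _ | yes refl | _ | yes refl | _ = ⊥-elim (bc refl)
... | _ | yes refl | _ | yes refl | _ | _ = ⊥-elim (ab refl)
... | _ | yes refl | _ | _ | _ | yes refl = ⊥-elim (ac refl)
... | _ | _ | _ | yes refl | _ | yes refl = ⊥-elim (bc refl)

third? : ∀ {n} (T : Sub n) {a b} → a ∈ T → b ∈ T → a ≢ b → Big T ⊎ (∀ c → c ∈ T → c ≡ a ⊎ c ≡ b)
third? T {a} {b} a∈ b∈ ab with Finₚ.any? (λ c → (T c Boolₚ.≟ true) ×-dec ¬? (a Fin.≟ c) ×-dec ¬? (b Fin.≟ c))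
... | yes (c , c∈ , ac , bc) = inj₁ (big a∈ b∈ c∈ ab ac bc)
... | no ∄ = inj₂ only
  where
  only : ∀ c → c ∈ T → c ≡ a ⊎ c ≡ b
  only c c∈ with a Fin.≟ c | b Fin.≟ c
  ... | yes e | _ = inj₁ (sym e)
  ... | _ | yes e = inj₂ (sym e)
  ... | no p | no q = ⊥-elim (∄ (c , c∈ , p , q))

pair : ∀ {n} → Fin n → Fin n → Sub n
pair a b v = does (v Fin.≟ a) ∨ does (v Fin.≟ b)

pair⁻ : ∀ {n} {a b v : Fin n} → v ∈ pair a b → v ≡ a ⊎ v ≡ b
pair⁻ {a = a} {b} {v} p with v Fin.≟ a | v Fin.≟ b
... | yes e | _ = inj₁ e
... | no _ | yes e = inj₂ e
pair⁻ () | no _ | no _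

pairˡ : ∀ {n} (a b : Fin n) → a ∈ pair a b
pairˡ a b with a Fin.≟ a
... | yes _ = refl
... | no ne = ⊥-elim (ne refl)

pairʳ : ∀ {n} (a b : Fin n) → b ∈ pair a b
pairʳ a b with b Fin.≟ a | b Fin.≟ b
... | yes _ | _ = refl
... | no _ | yes _ = refl
... | no _ | no ne = ⊥-elim (ne refl)

∉pair : ∀ {n} {a b v : Fin n} → v ≢ a → v ≢ b → v ∉ pair a b
∉pair p q = ¬∈⇒∉ (λ m → [ p , q ]′ (pair⁻ m))

-- Among the three edges of a three-element graph two agree; the vertices other than their common endpoint form a module.
fourth : ∀ Γ T {a b c} → PrimeS Γ T → a ∈ T → b ∈ T → c ∈ T → a ≢ b → a ≢ c → b ≢ c →
  ∃ λ d → d ∈ T × d ≢ a × d ≢ b × d ≢ c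
fourth Γ T {a} {b} {c} prime a∈ b∈ c∈ ab ac bc
  with Finₚ.any? (λ d → (T d Boolₚ.≟ true) ×-dec ¬? (d Fin.≟ a) ×-dec ¬? (d Fin.≟ b) ×-dec ¬? (d Fin.≟ c))
... | yes found = found
... | no ∄ = ⊥-elim (three (edge Γ a b) (edge Γ a c) (edge Γ b c) refl refl refl)
  where
  only : ∀ d → d ∈ T → d ≡ a ⊎ d ≡ b ⊎ d ≡ c
  only d d∈ with d Fin.≟ a | d Fin.≟ b | d Fin.≟ c
  ... | yes e | _ | _ = inj₁ e
  ... | _ | yes e | _ = inj₂ (inj₁ e)
  ... | _ | _ | yes e = inj₂ (inj₂ e)
  ... | no p | no q | no s = ⊥-elim (∄ (d , d∈ , p , q , s))
  twins : ∀ x y z → x ∈ T → y ∈ T → z ∈ T → x ≢ y → x ≢ z → y ≢ z → (∀ d → d ∈ T → d ≡ x ⊎ d ≡ y ⊎ d ≡ z) →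
    edge Γ x y ≡ edge Γ x z → ⊥
  twins x y z x∈ y∈ z∈ xy xz yz all e with prime (pair y z) hom
    where
    same : ∀ {v w w′} → v ≡ x → w ≡ y ⊎ w ≡ z → w′ ≡ y ⊎ w′ ≡ z → edge Γ v w ≡ edge Γ v w′
    same refl (inj₁ refl) (inj₁ refl) = refl
    same refl (inj₁ refl) (inj₂ refl) = e
    same refl (inj₂ refl) (inj₁ refl) = sym e
    same refl (inj₂ refl) (inj₂ refl) = refl
    hom : Hom Γ T (pair y z)
    hom v w w′ v∈ v∉ w∈ wM w′∈ w′M with all v v∈
    ... | inj₁ v≡x = same v≡x (pair⁻ wM) (pair⁻ w′M)
    ... | inj₂ (inj₁ refl) = clash (pairˡ y z) v∉
    ... | inj₂ (inj₂ refl) = clash (pairʳ y z) v∉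
  ... | inj₁ none = clash (pairˡ y z) (none y y∈)
  ... | inj₂ (inj₁ (v , s)) = yz (trans (s y y∈ (pairˡ y z)) (sym (s z z∈ (pairʳ y z))))
  ... | inj₂ (inj₂ full) = clash (full x x∈) (∉pair xy xz)
  perm₁ : ∀ d → d ∈ T → d ≡ b ⊎ d ≡ a ⊎ d ≡ c
  perm₁ d d∈ = [ inj₂ ∘ inj₁ , [ inj₁ , inj₂ ∘ inj₂ ]′ ]′ (only d d∈)
  perm₂ : ∀ d → d ∈ T → d ≡ c ⊎ d ≡ a ⊎ d ≡ b
  perm₂ d d∈ = [ inj₂ ∘ inj₁ , [ inj₂ ∘ inj₂ , inj₁ ]′ ]′ (only d d∈)
  T-abc : edge Γ a b ≡ edge Γ a c → ⊥
  T-abc = twins a b c a∈ b∈ c∈ ab ac bc only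
  T-bac : edge Γ b a ≡ edge Γ b c → ⊥
  T-bac = twins b a c b∈ a∈ c∈ (ab ∘ sym) bc ac perm₁
  T-cab : edge Γ c a ≡ edge Γ c b → ⊥
  T-cab = twins c a b c∈ a∈ b∈ (ac ∘ sym) (bc ∘ sym) ab perm₂
  three : ∀ x y z → edge Γ a b ≡ x → edge Γ a c ≡ y → edge Γ b c ≡ z → ⊥
  three true  true  _ p q s = T-abc (trans p (sym q))
  three false false _ p q s = T-abc (trans p (sym q))
  three true  false true  p q s = T-bac (trans (edge-sym Γ b a) (trans p (sym s)))
  three false true  false p q s = T-bac (trans (edge-sym Γ b a) (trans p (sym s)))
  three true  false false p q s = T-cab (trans (edge-sym Γ c a) (trans q (trans (sym s) (edge-sym Γ b c))))
  three false true  true  p q s = T-cab (trans (edge-sym Γ c a) (trans q (trans (sym s) (edge-sym Γ b c))))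

-- Compositions as instances of `p↓`

tensor-provable : ∀ n Gs → (∀ i → ⊢ ⌜ Gs i ⌝) → ⊢ ⌜ bigTensor n Gs ⌝
tensor-provable zero Gs h = ≃⇒⟶ ≃-refl
tensor-provable (suc n) Gs h = ⊢-plug _ _ (h zero) (tensor-provable n (Gs ∘ suc) (h ∘ suc)) ▸ ≃⇒⟶ (≃-sym (joinG≃joinF (Gs zero) _ _))

-- Tensoring with a provable graph is a derivation, so a single unproved factor can serve as the
-- premise of the whole tensor.
tensor-factor : ∀ n Gs k → (∀ i → i ≢ k → ⊢ ⌜ Gs i ⌝) → ⌜ Gs k ⌝ ⟶ ⌜ bigTensor n Gs ⌝
tensor-factor (suc n) Gs zero h =
  plugF-provable _ _ (tensor-provable n (Gs ∘ suc) (λ i → h (suc i) (λ ()))) ▸ ≃⇒⟶ (≃-sym (joinG≃joinF (Gs zero) _ _))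
tensor-factor (suc n) Gs (suc k) h =
  tensor-factor n (Gs ∘ suc) k (λ i ne → h (suc i) (ne ∘ Finₚ.suc-injective))
  ▸ plugF-provable _ _ (h zero (λ ())) ▸ ≃⇒⟶ (≃-trans (joinF-comm _ ⌜ Gs zero ⌝ _) (≃-sym (joinG≃joinF (Gs zero) _ _)))

-- The condition on `block` strengthens the induction: the edges from the first component to the
-- rest are defined through `block`, and the isomorphism has to respect it.
RawIso : ∀ n l g s i → Bool → (Fin n → Fin n → Bool) → (Fin n → Graph) → Set
RawIso n l g s i b a Hs = Σ (⌜ composeRaw n a Hs ⌝ ≃ Comp (mkGraph n l g s i ⁺⁻ b) (λ t → ⌜ Hs t ⌝) (λ _ → true))
  λ f → ∀ v → proj₁ (to (bij f) v) ≡ block n a Hs v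

rawIso-suc : ∀ n l g s i b a Hs → (∀ x y → x ≢ y → a x y ≡ sgn b (g x y)) →
  RawIso n (l ∘ suc) (λ x y → g (suc x) (suc y)) (λ x y → s (suc x) (suc y)) (λ x → i (suc x)) b (λ x y → a (suc x) (suc y)) (λ t → Hs (suc t)) →
  RawIso (suc n) l g s i b a Hs
rawIso-suc n l g s i b a Hs h (f , f-block) = whole , blocks
  where
  Δ : PG
  Δ = mkGraph (suc n) l g s i ⁺⁻ b
  C : FG
  C = Comp Δ (λ t → ⌜ Hs t ⌝) (λ _ → true)
  a′ : Fin n → Fin n → Bool
  a′ x y = a (suc x) (suc y)
  Δ′ : PG
  Δ′ = mkGraph n (l ∘ suc) (λ x y → g (suc x) (suc y)) (λ x y → s (suc x) (suc y)) (λ x → i (suc x)) ⁺⁻ b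
  C′ : FG
  C′ = Comp Δ′ (λ t → ⌜ Hs (suc t) ⌝) (λ _ → true)
  J : FG
  J = joinF ⌜ Hs zero ⌝ C′ (λ _ (j , _) → a zero (suc j))
  split : ⌜ composeRaw (suc n) a Hs ⌝ ≃ J
  split = ≃-trans (joinG≃joinF (Hs zero) (composeRaw n a′ (λ t → Hs (suc t))) _)
    (joinF-cong ≃-refl f (λ _ w → cong (a zero ∘ suc) (f-block w)))
  glue : V J → V C
  glue (inj₁ v) = zero , refl , v
  glue (inj₂ (j , p , v)) = suc j , p , v
  unglue : V C → V J
  unglue (zero , p , v) = inj₁ v
  unglue (suc j , p , v) = inj₂ (j , p , v)
  suc-adj : ∀ {x y} (d : Dec (x ≡ y)) v w → compAdj Δ (λ t → ⌜ Hs t ⌝) (suc x Fin.≟ suc y) v w ≡ compAdj Δ′ (λ t → ⌜ Hs (suc t) ⌝) d v w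
  suc-adj (yes refl) v w = compAdj-yes Δ (λ t → ⌜ Hs t ⌝) (_ Fin.≟ _) v w
  suc-adj (no ne) v w = compAdj-no Δ (λ t → ⌜ Hs t ⌝) (_ Fin.≟ _) (ne ∘ Finₚ.suc-injective) v w
  merge : J ≃ Comp (mkGraph (suc n) l g s i ⁺⁻ b) (λ t → ⌜ Hs t ⌝) (λ _ → true)
  merge = mk≃ (mk↔ₛ′ glue unglue (λ { (zero , refl , v) → refl ; (suc j , p , v) → refl }) (λ { (inj₁ v) → refl ; (inj₂ v) → refl }))
    (λ { (inj₁ v) → refl ; (inj₂ v) → refl })
    (λ { (inj₁ v) (inj₁ w) → refl ; (inj₁ v) (inj₂ (j , p , w)) → sym (h zero (suc j) (λ ()))
       ; (inj₂ (j , p , v)) (inj₁ w) → trans (cong (sgn b) (s (suc j) zero)) (sym (h zero (suc j) (λ ())))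
       ; (inj₂ (x , p , v)) (inj₂ (y , q , w)) → suc-adj (x Fin.≟ y) v w })
  whole : ⌜ composeRaw (suc n) a Hs ⌝ ≃ Comp (mkGraph (suc n) l g s i ⁺⁻ b) (λ t → ⌜ Hs t ⌝) (λ _ → true)
  whole = ≃-trans split merge
  code : Fin (size (Hs zero)) ⊎ Fin (size (composeRaw n a′ (λ t → Hs (suc t)))) → V J
  code (inj₁ x) = inj₁ x
  code (inj₂ w) = inj₂ (to (bij f) w)
  code-ok : ∀ x → proj₁ (to (bij whole) x) ≡ proj₁ (glue (code (splitAt (size (Hs zero)) x)))
  code-ok x with splitAt (size (Hs zero)) x
  ... | inj₁ _ = refl
  ... | inj₂ _ = refl
  tag-ok : ∀ x → proj₁ (glue (code (splitAt (size (Hs zero)) x))) ≡ block (suc n) a Hs x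
  tag-ok x with splitAt (size (Hs zero)) x
  ... | inj₁ _ = refl
  ... | inj₂ w = cong suc (f-block w)
  blocks : ∀ x → proj₁ (to (bij whole) x) ≡ block (suc n) a Hs x
  blocks x = trans (code-ok x) (tag-ok x)

rawIso : ∀ n l g s i b a Hs → (∀ x y → x ≢ y → a x y ≡ sgn b (g x y)) → RawIso n l g s i b a Hs
rawIso zero l g s i b a Hs h = empty≃empty (λ ()) (λ ()) , λ ()
rawIso (suc n) l g s i b a Hs h = rawIso-suc n l g s i b a Hs h
  (rawIso n _ _ _ _ b (λ x y → a (suc x) (suc y)) (λ t → Hs (suc t)) (λ x y ne → h (suc x) (suc y) (ne ∘ Finₚ.suc-injective)))

-- Agreement is asked off the diagonal only, because there `dual` has `false` where `edge` of a
-- negative graph has `true`.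
composeRaw≃Comp : ∀ P b a Hs → (∀ x y → x ≢ y → a x y ≡ edge (P ⁺⁻ b) x y) →
  ⌜ composeRaw (size P) a Hs ⌝ ≃ Comp (P ⁺⁻ b) (λ t → ⌜ Hs t ⌝) (λ _ → true)
composeRaw≃Comp (mkGraph n l g s i) b a Hs h = proj₁ (rawIso n l g s i b a Hs h)

adj-dual : ∀ G i j → i ≢ j → adj (dual G) i j ≡ not (adj G i j)
adj-dual G i j ne with i Fin.≟ j
... | yes e = ⊥-elim (ne e)
... | no _  = refl

four≤ : ∀ {n} (a b c d : Fin n) → a ≢ b → a ≢ c → b ≢ c → d ≢ a → d ≢ b → d ≢ c → 4 ≤ n
four≤ {n} a b c d ab ac bc da db dc with 4 ℕ.≤? n
... | yes le = le
... | no nle with Finₚ.pigeonhole (ℕₚ.≰⇒> nle) f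
  where
  f : Fin 4 → Fin n
  f zero = a
  f (suc zero) = b
  f (suc (suc zero)) = c
  f (suc (suc (suc _))) = d
... | zero , suc zero , _ , e = ⊥-elim (ab e)
... | zero , suc (suc zero) , _ , e = ⊥-elim (ac e)
... | zero , suc (suc (suc zero)) , _ , e = ⊥-elim (da (sym e))
... | suc zero , suc (suc zero) , _ , e = ⊥-elim (bc e)
... | suc zero , suc (suc (suc zero)) , _ , e = ⊥-elim (db (sym e))
... | suc (suc zero) , suc (suc (suc zero)) , _ , e = ⊥-elim (dc (sym e))
... | zero , zero , lt , _ = ⊥-elim (ℕₚ.n≮n _ lt)
... | suc zero , zero , () , _
... | suc zero , suc zero , lt , _ = ⊥-elim (ℕₚ.n≮n _ lt)
... | suc (suc zero) , zero , () , _
... | suc (suc zero) , suc zero , s≤s () , _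
... | suc (suc zero) , suc (suc zero) , lt , _ = ⊥-elim (ℕₚ.n≮n _ lt)
... | suc (suc (suc zero)) , zero , () , _
... | suc (suc (suc zero)) , suc zero , s≤s () , _
... | suc (suc (suc zero)) , suc (suc zero) , s≤s (s≤s ()) , _
... | suc (suc (suc zero)) , suc (suc (suc zero)) , lt , _ = ⊥-elim (ℕₚ.n≮n _ lt)

module _ (Γ : PG) (T : Sub (N Γ)) (prime : PrimeS Γ T) (bigT : Big T) where

  -- The rule `p↓` speaks of a `Graph` on an initial segment of the naturals. This is a copy of the
  -- subgraph on `T`, with a default label, that can be encoded as one.
  skeletonF : FG
  skeletonF = Comp Γ (λ _ → atomF (0 , true)) T

  skeleton : Graph
  skeleton = enc skeletonF

  ι : Fin (size skeleton) → Fin (N Γ)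
  ι i = proj₁ (from (enum (fin skeletonF)) i)

  ι∈ : ∀ i → ι i ∈ T
  ι∈ i = proj₁ (proj₂ (from (enum (fin skeletonF)) i))

  κ : ∀ t → t ∈ T → Fin (size skeleton)
  κ t p = to (enum (fin skeletonF)) (t , p , zero)

  ι-κ : ∀ t p → ι (κ t p) ≡ t
  ι-κ t p = cong proj₁ (strictlyInverseʳ (enum (fin skeletonF)) (t , p , zero))

  ι-injective : ∀ {i j} → ι i ≡ ι j → i ≡ j
  ι-injective {i} {j} e = trans (sym (strictlyInverseˡ E i)) (trans (cong (to E) (vertex _ _ e)) (strictlyInverseˡ E j))
    where
    E = enum (fin skeletonF)
    vertex : ∀ (x y : V skeletonF) → proj₁ x ≡ proj₁ y → x ≡ y
    vertex (t , p , zero) (.t , p′ , zero) refl = ,-irr refl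

  skeleton-adj : ∀ i j → i ≢ j → adj skeleton i j ≡ edge Γ (ι i) (ι j)
  skeleton-adj i j ne = compAdj-no Γ _ (ι i Fin.≟ ι j) (ne ∘ ι-injective) _ _

  skeleton-size : 4 ≤ size skeleton
  skeleton-size with fourth Γ T prime (Big.a∈ bigT) (Big.b∈ bigT) (Big.c∈ bigT) (Big.ab bigT) (Big.ac bigT) (Big.bc bigT)
  ... | d , d∈ , da , db , dc =
    four≤ (κ _ (Big.a∈ bigT)) (κ _ (Big.b∈ bigT)) (κ _ (Big.c∈ bigT)) (κ d d∈)
      (lift-≢ (Big.ab bigT)) (lift-≢ (Big.ac bigT)) (lift-≢ (Big.bc bigT))
      (lift-≢ da) (lift-≢ db) (lift-≢ dc)
    where
    lift-≢ : ∀ {s t p q} → s ≢ t → κ s p ≢ κ t q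
    lift-≢ {s} {t} {p} {q} ne e = ne (trans (sym (ι-κ s p)) (trans (cong ι e) (ι-κ t q)))

  κ-ι : ∀ i → κ (ι i) (ι∈ i) ≡ i
  κ-ι i = ι-injective (ι-κ (ι i) (ι∈ i))

  image : (Fin (size skeleton) → Bool) → ∀ {t} → t ∈ T ⊎ t ∉ T → Bool
  image M {t} (inj₁ p) = M (κ t p)
  image M     (inj₂ _) = false

  image-κ : ∀ M t p → image M (t ∈? T) ≡ M (κ t p)
  image-κ M t p with t ∈? T
  ... | inj₁ p′ = cong (λ p → M (κ t p)) (∈-irr p′ p)
  ... | inj₂ n = clash p n

  image-ι : ∀ M i → image M (ι i ∈? T) ≡ M i
  image-ι M i = trans (image-κ M (ι i) (ι∈ i)) (cong M (κ-ι i))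

  image-Hom : ∀ M → IsModule skeleton M → Hom Γ T (λ t → image M (t ∈? T))
  image-Hom M mod v x y v∈ v∉ x∈ xM y∈ yM =
    trans (edge-κ v x v∈ x∈ (λ { refl → clash xM v∉ })) (trans (same (mod (κ v v∈) (trans (sym (image-κ M v v∈)) v∉)))
      (sym (edge-κ v y v∈ y∈ (λ { refl → clash yM v∉ }))))
    where
    edge-κ : ∀ s t p q → s ≢ t → edge Γ s t ≡ adj skeleton (κ s p) (κ t q)
    edge-κ s t p q ne = trans (cong₂ (edge Γ) (sym (ι-κ s p)) (sym (ι-κ t q)))
      (sym (skeleton-adj (κ s p) (κ t q) (λ e → ne (trans (sym (ι-κ s p)) (trans (cong ι e) (ι-κ t q))))))
    Const : Bool → Set
    Const b = ∀ z → M z ≡ true → adj skeleton (κ v v∈) z ≡ b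
    same : Const true ⊎ Const false → adj skeleton (κ v v∈) (κ x x∈) ≡ adj skeleton (κ v v∈) (κ y y∈)
    same (inj₁ f) = trans (f _ (trans (sym (image-κ M x x∈)) xM)) (sym (f _ (trans (sym (image-κ M y y∈)) yM)))
    same (inj₂ f) = trans (f _ (trans (sym (image-κ M x x∈)) xM)) (sym (f _ (trans (sym (image-κ M y y∈)) yM)))

  skeleton-prime : Prime skeleton
  skeleton-prime = ℕₚ.≤-trans (s≤s (s≤s z≤n)) skeleton-size , trivial
    where
    trivial : ∀ M → IsModule skeleton M → IsTrivialModule skeleton M
    trivial M mod with prime (λ t → image M (t ∈? T)) (image-Hom M mod)
    ... | inj₁ none = inj₁ (λ i → trans (sym (image-ι M i)) (none (ι i) (ι∈ i)))
    ... | inj₂ (inj₂ full) = inj₂ (inj₂ (λ i → trans (sym (image-ι M i)) (full (ι i) (ι∈ i))))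
    ... | inj₂ (inj₁ (v , only)) with Finₚ.any? (λ i → M i Boolₚ.≟ true)
    ...   | no ∄ = inj₁ (λ i → ¬∈⇒∉ (λ e → ∄ (i , e)))
    ...   | yes (i , e) = inj₂ (inj₁ (i , e , λ j e′ → ι-injective (trans (at j e′) (sym (at i e)))))
      where
      at : ∀ j → M j ≡ true → ι j ≡ v
      at j e = only (ι j) (ι∈ j) (trans (image-ι M j) e)

  -- Each fibre of `q` over `T` is a single vertex, so associativity of composition amounts to
  -- renaming positions. The flag `b` serves both the skeleton and its dual.
  spread : ∀ (G : Graph) b (q : Fin (size G) → Fin (N Γ)) (k : ∀ t → t ∈ T → Fin (size G)) →
    (∀ t p → q (k t p) ≡ t) → (∀ {i j} → q i ≡ q j → i ≡ j) → Quot (G ⁺⁻ true) (λ _ → true) (gr Γ ⁺⁻ b) T q →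
    ∀ y → ⌜ G ⟨ enc ∘ y ∘ q ⟩ ⌝ ≃ Comp (gr Γ ⁺⁻ b) y T
  spread G b q k qk inj Q y = ≃-trans (composeRaw≃Comp G true _ _ (λ _ _ _ → refl)) (≃-trans (Comp-assoc _ Q)
    (Comp-cong (gr Γ ⁺⁻ b) T _ y λ t p →
      ≃-trans (Comp-single (G ⁺⁻ true) _ (fib⁺ q (qk t p)) (λ i i∈ → inj (trans (fib⁻ q {t} {i} i∈) (sym (qk t p)))))
        (≃-trans (⌜enc⌝ _) (≡⇒≃ (cong y (qk t p))))))

  -- This is `p↓` with all factors of its premise but the one at `k` already proved. The `w t` take
  -- the place of the `Mᵢ` in the rule and hence must be inhabited.
  prime-step : ∀ w y k → k ∈ T → (∀ t → t ∈ T → V (w t)) → (∀ t → t ∈ T → t ≢ k → ⊢ w t ⊔F y t) →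
    w k ⊔F y k ⟶ Comp (neg Γ) w T ⊔F Comp Γ y T
  prime-step w y k k∈ nonempty h =
    ≃⇒⟶ (≃-trans (≡⇒≃ (cong (λ t → w t ⊔F y t) (sym (ι-κ k k∈)))) (≃-sym (pairs (κ k k∈))))
    ▸ tensor-factor _ MN (κ k k∈) (λ i ne → h (ι i) (ι∈ i) (λ e → ne (ι-injective (trans e (sym (ι-κ k k∈))))) ▸ ≃⇒⟶ (≃-sym (pairs i)))
    ▸ ⟨ rule⇒derivation (gs-p↓ (p↓-inst skeleton skeleton-prime skeleton-size (enc ∘ w ∘ ι) (enc ∘ y ∘ ι)
          (λ i → enc-NonEmpty (w (ι i)) (nonempty (ι i) (ι∈ i))))) ⟩ᵈ
    ▸ ≃⇒⟶ (≃-trans (⌜⊔⌝ (dual skeleton ⟨ enc ∘ w ∘ ι ⟩) (skeleton ⟨ enc ∘ y ∘ ι ⟩)) (⊔F-cong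
        (spread (dual skeleton) (not (pol Γ)) ι κ ι-κ ι-injective (quot (λ i _ → ι∈ i) dual-resp) w)
        (spread skeleton (pol Γ) ι κ ι-κ ι-injective (quot (λ i _ → ι∈ i) (λ i j _ _ ne → skeleton-adj i j (ne ∘ cong ι))) y)))
    where
    MN : Fin (size skeleton) → Graph
    MN i = enc (w (ι i)) ⊔ enc (y (ι i))
    pairs : ∀ i → ⌜ MN i ⌝ ≃ w (ι i) ⊔F y (ι i)
    pairs i = ≃-trans (⌜⊔⌝ (enc (w (ι i))) (enc (y (ι i)))) (⊔F-cong (⌜enc⌝ _) (⌜enc⌝ _))
    dual-resp : ∀ i j → _ → _ → ι i ≢ ι j → adj (dual skeleton) i j ≡ edge (neg Γ) (ι i) (ι j)
    dual-resp i j _ _ ne = trans (adj-dual skeleton i j (ne ∘ cong ι))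
      (trans (cong not (skeleton-adj i j (ne ∘ cong ι))) (sym (edge-neg Γ _ _)))

-- Cutting along an arbitrary composition

⊢-cong : ∀ {G H} → G ≃ H → ⊢ G → ⊢ H
⊢-cong f d = d ▸ ≃⇒⟶ f

∈-⇒ : ∀ {n} {S : Sub n} {v w} → v ≡ w → v ∈ S → w ∈ S
∈-⇒ refl p = p

Comp-drop-empty : ∀ Γ u {T k} → k ∈ T → ¬ V (u k) → Comp Γ u T ≃ Comp Γ u (T - k)
Comp-drop-empty Γ u k∈ ∄ = ≃-trans (Comp-peel Γ u k∈) (joinF-emptyʳ _ _ _ ∄)

Comp-two : ∀ Γ u {T k l} → k ∈ T → l ∈ T → k ≢ l → (∀ t → t ∈ T → t ≡ k ⊎ t ≡ l) →
  Comp Γ u T ≃ plugF (u k) (λ _ → edge Γ k l) (u l)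
Comp-two Γ u {T} {k} {l} k∈ l∈ k≢l only = ≃-trans (Comp-peel Γ u l∈)
  (joinF-cong (Comp-single Γ u (∖⁺ k∈ (∉fib⁺ id k≢l)) left) ≃-refl (λ (t , p , _) _ → cong (λ t → edge Γ t l) (sym (left t p))))
  where
  left : ∀ t → t ∈ (T - l) → t ≡ k
  left t p with only t (∩₁ p)
  ... | inj₁ e = e
  ... | inj₂ e = ⊥-elim (∉fib⁻ id {l} {t} (∖₂ {T t} p) e)

-- The two-vertex counterpart of `prime-step`, by switching alone: `w l ⊔F y l` is inserted into
-- `w k`, then `y l` is pulled out. Only the composition of the `y` has to be a par, so `b` and `c`
-- are separate and the two sides can be exchanged.
pair-cut : ∀ g b c w y {T k l} → k ∈ T → l ∈ T → k ≢ l → (∀ t → t ∈ T → t ≡ k ⊎ t ≡ l) → edge (g ⁺⁻ c) k l ≡ false →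
  ⊢ w l ⊔F y l → w k ⊔F y k ⟶ Comp (g ⁺⁻ b) w T ⊔F Comp (g ⁺⁻ c) y T
pair-cut g b c w y {T} {k} {l} k∈ l∈ k≢l only e ⊢l =
  ≃⇒⟶ (⊔-comm (w k) (y k)) ▸ ⟶-⊔ (y k) (plugF-provable (w k) _ ⊢l ▸ plugF-pull (w k) _ (w l) (y l))
  ▸ ≃⇒⟶ (≃-trans (solve 3 (λ a b c → a ⊕ (b ⊕ c) ⊜ b ⊕ (a ⊕ c)) ≃-refl (y k) (plugF (w k) (λ _ → edge (g ⁺⁻ b) k l) (w l)) (y l))
      (⊔F-cong (≃-sym (Comp-two (g ⁺⁻ b) w k∈ l∈ k≢l only))
        (≃-sym (≃-trans (Comp-two (g ⁺⁻ c) y k∈ l∈ k≢l only)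
          (≃-trans (joinF-cong ≃-refl ≃-refl (λ _ _ → sym e)) (≃-sym (⊔F-join (y k) (y l))))))))
  where open ⊔-Solver using (solve; _⊕_; _⊜_)

-- If u j is empty, then x j is provable and index j can be dropped. If u k is empty,
-- then x k is plugged into the provable rest. Otherwise p↓ applies to a prime quotient.
mutual
  comp-cut : ∀ n Γ T u x k → count T ≤ n → k ∈ T → (∀ t → t ∈ T → t ≢ k → ⊢ u t ⊔F x t) →
    u k ⊔F x k ⇒ Comp (neg Γ) u T ⊔F Comp Γ x T
  comp-cut zero Γ T u x k le k∈ h = ⊥-elim (ℕₚ.n≮0 (ℕₚ.≤-trans (count-< {S = λ _ → false} (λ _ ()) k k∈ refl) le))
  comp-cut (suc n) Γ T u x k le k∈ h with Finₚ.any? (λ j → (T j Boolₚ.≟ true) ×-dec ¬? (j Fin.≟ k) ×-dec ¬? (inhabited? (u j)))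
  ... | yes (j , j∈ , j≢k , ∄) =
    comp-cut n Γ (T - j) u x k (smaller j j∈) (∖⁺ k∈ (∉fib⁺ id (j≢k ∘ sym))) (λ t p → h t (∩₁ p))
    ▹ ⟶⇒⇒ (⟶-⊔ _ (Comp-drop Γ x j∈ (⊢-cong (⊔-emptyˡ ∄) (h j j∈ j≢k))))
    ▹ ≃⇒⇒ (⊔F-cong (≃-sym (Comp-drop-empty (neg Γ) u j∈ ∄)) ≃-refl)
    where
    smaller : ∀ j → j ∈ T → count (T - j) ≤ n
    smaller j j∈ = ℕₚ.≤-pred (ℕₚ.≤-trans (count-< (λ v → ∩₁) j j∈ (trans (cong (λ b → T j ∧ not b) (fib⁺ id {j} refl)) (Boolₚ.∧-zeroʳ (T j)))) le)
  ... | no all with inhabited? (u k)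
  ...   | no ∄ = ≃⇒⇒ (⊔-emptyˡ ∄)
    ▹ Comp-around Γ x k∈ (⊢-cong (⊔-comm (Comp (neg Γ) u (T - k)) (Comp Γ x (T - k))) (comp-cut-all n Γ (T - k) u x smaller λ t p → h t (∩₁ p) (∉fib⁻ id {k} {t} (∖₂ {T t} p))))
    ▹ ≃⇒⇒ (≃-trans (⊔-comm (Comp Γ x T) (Comp (neg Γ) u (T - k))) (⊔F-cong (≃-sym (Comp-drop-empty (neg Γ) u k∈ ∄)) ≃-refl))
    where
    smaller : count (T - k) ≤ n
    smaller = ℕₚ.≤-pred (ℕₚ.≤-trans (count-< (λ v → ∩₁) k k∈ (trans (cong (λ b → T k ∧ not b) (fib⁺ id {k} refl)) (Boolₚ.∧-zeroʳ (T k)))) le)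
  ...   | yes a₀ with Finₚ.any? (λ j → (T j Boolₚ.≟ true) ×-dec ¬? (j Fin.≟ k))
  ...     | no lone = ≃⇒⇒ (⊔F-cong (≃-sym (Comp-single (neg Γ) u k∈ only)) (≃-sym (Comp-single Γ x k∈ only)))
    where
    only : ∀ t → t ∈ T → t ≡ k
    only t t∈ with t Fin.≟ k
    ... | yes e = e
    ... | no ne = ⊥-elim (lone (t , t∈ , ne))
  ...     | yes (j , j∈ , j≢k) = prime-case (primeQuotient _ Γ T ℕₚ.≤-refl (j , k , j∈ , k∈ , j≢k))
    where
    nonempty : ∀ t → t ∈ T → V (u t)
    nonempty t t∈ with t Fin.≟ k
    ... | yes refl = a₀
    ... | no ne with inhabited? (u t)
    ...   | yes a = a
    ...   | no ∄ = ⊥-elim (all (t , t∈ , ne , ∄))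
    prime-case : PrimeQuotient Γ T → u k ⊔F x k ⇒ Comp (neg Γ) u T ⊔F Comp Γ x T
    prime-case (pq T₁ r quo onto prime (s₁ , s₂ , s₁∈ , s₂∈ , s₁≢s₂)) =
      inside ▹ ⟶⇒⇒ outside ▹ ≃⇒⇒ (⊔F-cong (≃-sym (Comp-assoc u (Quot-neg quo))) (≃-sym (Comp-assoc x quo)))
      where
      F : Fin (N Γ) → Sub (N Γ)
      F t = T ∩ fib r t
      w y : Fin (N Γ) → FG
      w t = Comp (neg Γ) u (F t)
      y t = Comp Γ x (F t)
      k₁ : Fin (N Γ)
      k₁ = r k
      k₁∈ : k₁ ∈ T₁
      k₁∈ = into quo k k∈
      partner : ∃ λ l → l ∈ T₁ × k₁ ≢ l
      partner with s₁ Fin.≟ k₁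
      ... | yes e = s₂ , s₂∈ , λ e′ → s₁≢s₂ (trans e e′)
      ... | no ne = s₁ , s₁∈ , ne ∘ sym
      l : Fin (N Γ)
      l = proj₁ partner
      fibre-small : ∀ t → (∃ λ v → v ∈ T × r v ≢ t) → count (F t) ≤ n
      fibre-small t (v , v∈ , ne) = ℕₚ.≤-pred (ℕₚ.≤-trans
        (count-< (λ _ → ∩₁) v v∈ (trans (cong (T v ∧_) (∉fib⁺ r ne)) (Boolₚ.∧-zeroʳ (T v)))) le)
      inside : u k ⊔F x k ⇒ w k₁ ⊔F y k₁
      inside = comp-cut n Γ (F k₁) u x k (fibre-small k₁ out) (∩⁺ k∈ (fib⁺ r refl)) (λ t p → h t (∩₁ p))
        where
        out : ∃ λ v → v ∈ T × r v ≢ k₁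
        out with onto l (proj₁ (proj₂ partner))
        ... | v , v∈ , e = v , v∈ , λ e′ → proj₂ (proj₂ partner) (trans (sym e′) e)
      others : ∀ t → t ∈ T₁ → t ≢ k₁ → ⊢ w t ⊔F y t
      others t t∈ ne = comp-cut-all n Γ (F t) u x (fibre-small t (k , k∈ , ne ∘ sym))
        λ v p → h v (∩₁ p) (λ { refl → ne (sym (fib⁻ r {t} {v} (∩₂ {T v} p))) })
      w-nonempty : ∀ t → t ∈ T₁ → V (w t)
      w-nonempty t t∈ with onto t t∈
      ... | v , v∈ , e = v , ∩⁺ v∈ (fib⁺ r e) , nonempty v v∈
      outside : w k₁ ⊔F y k₁ ⟶ Comp (neg Γ) w T₁ ⊔F Comp Γ y T₁
      outside = [ (λ bigT → prime-step Γ T₁ prime bigT w y k₁ k₁∈ w-nonempty others) , (λ only → two only _ refl) ]′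
                  (third? T₁ k₁∈ l∈ k₁≢l)
        where
        l∈ : l ∈ T₁
        l∈ = proj₁ (proj₂ partner)
        k₁≢l : k₁ ≢ l
        k₁≢l = proj₂ (proj₂ partner)
        -- Of a two-vertex graph and its dual exactly one is a par; that one is passed to `pair-cut`
        -- as the second side.
        two : (∀ t → t ∈ T₁ → t ≡ k₁ ⊎ t ≡ l) → ∀ b → edge Γ k₁ l ≡ b → w k₁ ⊔F y k₁ ⟶ Comp (neg Γ) w T₁ ⊔F Comp Γ y T₁
        two only false e = pair-cut (gr Γ) (not (pol Γ)) (pol Γ) w y k₁∈ l∈ k₁≢l only e (others l l∈ (k₁≢l ∘ sym))
        two only true e = ≃⇒⟶ (⊔-comm (w k₁) (y k₁))
          ▸ pair-cut (gr Γ) (pol Γ) (not (pol Γ)) y w k₁∈ l∈ k₁≢l only (trans (edge-neg Γ k₁ l) (cong not e))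
              (⊢-cong (⊔-comm (w l) (y l)) (others l l∈ (k₁≢l ∘ sym)))
          ▸ ≃⇒⟶ (⊔-comm (Comp Γ y T₁) (Comp (neg Γ) w T₁))

  comp-cut-all : ∀ n Γ T u x → count T ≤ n → (∀ t → t ∈ T → ⊢ u t ⊔F x t) → ⊢ Comp (neg Γ) u T ⊔F Comp Γ x T
  comp-cut-all n Γ T u x le h with Finₚ.any? (λ t → T t Boolₚ.≟ true)
  ... | yes (k , k∈) = ⊢-⇒ (comp-cut n Γ T u x k le k∈ (λ t p _ → h t p)) (h k k∈)
  ... | no none = ⊢-⊔ (⊢-empty (λ (t , p , _) → none (t , p))) (⊢-empty (λ (t , p , _) → none (t , p)))

-- Realizers

record Part {n} (S D E : Sub n) : Set where
  constructor part
  field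
    split : ∀ v → v ∈ S → v ∈ D ⊎ v ∈ E
    inˡ   : ∀ v → v ∈ D → v ∈ S
    inʳ   : ∀ v → v ∈ E → v ∈ S
    disj  : ∀ v → v ∈ D → v ∈ E → ⊥

Ne Em : ∀ {n} → Sub n → Set
Ne S = ∃ λ v → v ∈ S
Em S = ∀ v → v ∉ S

infix 4 _⊆_
_⊆_ : ∀ {n} → Sub n → Sub n → Set
S ⊆ T = ∀ v → v ∈ S → v ∈ T

ne? : ∀ {n} (S : Sub n) → Ne S ⊎ Em S
ne? S with Finₚ.any? (λ v → S v Boolₚ.≟ true)
... | yes p = inj₁ p
... | no ∄ = inj₂ (λ v → ¬∈⇒∉ (λ e → ∄ (v , e)))

NoEdge : (Γ : PG) (D E : Sub (N Γ)) → Set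
NoEdge Γ D E = ∀ v w → v ∈ D → w ∈ E → edge Γ v w ≡ false

module _ (rec : (Γ : PG) → Sub (N Γ) → FG → Set₁) where

  -- The second alternative is needed because emptying a component of a prime graph
  -- leaves an arbitrary graph, whose realizers need not be of the first form.
  Canon : (Γ : PG) (S : Sub (N Γ)) (P : PG) (T : Sub (N P)) (q : Fin (N Γ) → Fin (N P)) → FG → Set₁
  Canon Γ S P T q z =
    (Σ (Fin (N P) → FG) λ u → (∀ t → t ∈ T → rec Γ (S ∩ fib q t) (u t)) × (Comp (neg P) u T ⇒ z))
    ⊎ (Σ (Fin (N P)) λ i → i ∈ T × Σ FG λ y → Σ FG λ u → rec Γ (S ∖ fib q i) y × rec Γ (S ∩ fib q i) u × (y ⊔F u ⇒ z))

  -- Each clause ranges over all decompositions of its kind rather than a chosen one. Elimination is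
  -- then immediate, while introduction has to prove independence of the decomposition; clauses for
  -- the other shapes are vacuous by `tensor≢par` and `prime-indivisible`. As `D` and `E` may be
  -- exchanged, `parᵇ` covers both directions.
  record Body (Γ : PG) (S : Sub (N Γ)) (z : FG) : Set₁ where
    no-eta-equality
    constructor body
    field
      emptyᵇ  : Em S → ⊢ z
      atomᵇ   : ∀ v → v ∈ S → (∀ w → w ∈ S → w ≡ v) → atomF (dualAtom (plab Γ v)) ⇒ z
      parᵇ    : ∀ {D E} → Part S D E → Ne D → Ne E → NoEdge Γ D E → ∀ x → rec (neg Γ) D x → rec Γ E (z ⊔F x)
      tensorᵇ : ∀ {D E} → Part S D E → Ne D → Ne E → NoEdge (neg Γ) D E →
                Σ FG λ x → Σ FG λ y → rec Γ D x × rec Γ E y × (x ⊔F y ⇒ z)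
      primeᵇ  : ∀ {P T q} → Quot Γ S P T q → Onto S T q → PrimeS P T → Big T → Canon Γ S P T q z
open Body

-- U n Γ S is meant for sets S with fewer than n vertices.
U : ℕ → (Γ : PG) → Sub (N Γ) → FG → Set₁
U zero    Γ S z = Lift _ ⊤
U (suc n) Γ S z = Body (U n) Γ S z

part-swap : ∀ {n} {S D E : Sub n} → Part S D E → Part S E D
part-swap (part s l r d) = part (λ v p → [ inj₂ , inj₁ ]′ (s v p)) r l (λ v p q → d v q p)

part-<ˡ : ∀ {k n} {S D E : Sub n} → count S ≤ k → Part S D E → Ne E → count D < k
part-<ˡ le (part s l r d) (v , v∈) = ℕₚ.<-≤-trans (count-< l v (r v v∈) (¬∈⇒∉ (λ p → d v p v∈))) le

part-<ʳ : ∀ {k n} {S D E : Sub n} → count S ≤ k → Part S D E → Ne D → count E < k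
part-<ʳ le p = part-<ˡ le (part-swap p)

∩∖-part : ∀ {n} (S M : Sub n) → Part S (S ∖ M) (S ∩ M)
∩∖-part S M = part (λ v p → [ (λ m → inj₂ (∩⁺ p m)) , (λ m → inj₁ (∖⁺ p m)) ]′ (v ∈? M))
  (λ v → ∩₁) (λ v → ∩₁) (λ v p r → clash (∩₂ {S v} r) (∖₂ {S v} p))

fibre-ne : ∀ {m n} {S : Sub m} {T : Sub n} {q} → Onto S T q → ∀ t → t ∈ T → Ne (S ∩ fib q t)
fibre-ne {q = q} onto t t∈ with onto t t∈
... | v , v∈ , e = v , ∩⁺ v∈ (fib⁺ q e)

cofibre-ne : ∀ {m n} {S : Sub m} {T : Sub n} {q} → Onto S T q → Big T → ∀ t → Ne (S ∖ fib q t)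
cofibre-ne {q = q} onto bigT t with other bigT t t
... | k , k∈ , ne , _ with onto k k∈
...   | v , v∈ , refl = v , ∖⁺ v∈ (∉fib⁺ q ne)

cofibre-< : ∀ {k m n} {S : Sub m} {T : Sub n} {q} → count S ≤ k → Onto S T q → ∀ t → t ∈ T → count (S ∖ fib q t) < k
cofibre-< {S = S} {q = q} le onto t t∈ = part-<ˡ le (∩∖-part S (fib q t)) (fibre-ne onto t t∈)

fibre-< : ∀ {k m n} {S : Sub m} {T : Sub n} {q} → count S ≤ k → Onto S T q → Big T → ∀ t → count (S ∩ fib q t) < k
fibre-< {S = S} {q = q} le onto bigT t = part-<ʳ le (∩∖-part S (fib q t)) (cofibre-ne onto bigT t)

remove-< : ∀ {k n} {T : Sub n} {t} → count T ≤ k → t ∈ T → count (T - t) < k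
remove-< {T = T} {t} le t∈ = part-<ˡ le (∩∖-part T (fib id t)) (t , ∩⁺ t∈ (fib⁺ id {t} {t} refl))

only-member : ∀ {n} {T : Sub n} {k} → Em (T - k) → ∀ t → t ∈ T → t ≡ k
only-member {k = k} em t t∈ = [ fib⁻ id {k} {t} , (λ t∉ → clash (∖⁺ t∈ t∉) (em t)) ]′ (t ∈? fib id k)

elsewhere : ∀ {m n} {S : Sub m} {T : Sub n} {q s t} → Onto S T q → s ∈ T → t ∈ T → s ≢ t → ∀ i → Ne (S ∖ fib q i)
elsewhere {S = S} {T} {q} {s} {t} onto s∈ t∈ s≢t i = at (s Fin.≟ i)
  where
  at : Dec (s ≡ i) → Ne (S ∖ fib q i)
  at (yes refl) = let (v , v∈ , e) = onto t t∈ in v , ∖⁺ v∈ (∉fib⁺ q (λ e′ → s≢t (trans (sym e′) e)))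
  at (no ne)    = let (v , v∈ , e) = onto s s∈ in v , ∖⁺ v∈ (∉fib⁺ q (λ e′ → ne (trans (sym e) e′)))

-- Both implications are assumed because `rec` occurs on both sides of the arrow in `parᵇ`.
Body-map : ∀ rec rec′ Γ S z → (∀ Γ′ (D : Sub (N Γ′)) x → count D < count S → (rec Γ′ D x → rec′ Γ′ D x) × (rec′ Γ′ D x → rec Γ′ D x)) →
  Body rec Γ S z → Body rec′ Γ S z
Body-map rec rec′ Γ S z h b = body (emptyᵇ b) (atomᵇ b)
  (λ {D} {E} p d e sep x r → proj₁ (h Γ E _ (part-<ʳ ℕₚ.≤-refl p d)) (parᵇ b p d e sep x (proj₂ (h (neg Γ) D x (part-<ˡ ℕₚ.≤-refl p e)) r)))
  (λ {D} {E} p d e sep → tens p d e (tensorᵇ b p d e sep))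
  (λ {P} {T} {q} Q o pr bg → can {P} {T} {q} Q o bg (primeᵇ b Q o pr bg))
  where
  tens : ∀ {D E} → Part S D E → Ne D → Ne E → _ → _
  tens {D} {E} p d e (x , y , r , s , f) = x , y , proj₁ (h Γ D x (part-<ˡ ℕₚ.≤-refl p e)) r , proj₁ (h Γ E y (part-<ʳ ℕₚ.≤-refl p d)) s , f
  can : ∀ {P T q} → Quot Γ S P T q → Onto S T q → Big T → Canon rec Γ S P T q z → Canon rec′ Γ S P T q z
  can {q = q} Q o bg (inj₁ (u , r , f)) =
    inj₁ (u , (λ t p → proj₁ (h Γ _ _ (fibre-< ℕₚ.≤-refl o bg t)) (r t p)) , f)
  can {q = q} Q o bg (inj₂ (i , i∈ , y , u , r , s , f)) = inj₂ (i , i∈ , y , u ,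
    proj₁ (h Γ _ _ (cofibre-< ℕₚ.≤-refl o i i∈)) r ,
    proj₁ (h Γ _ _ (fibre-< ℕₚ.≤-refl o bg i)) s , f)

U-lift : ∀ n m Γ (S : Sub (N Γ)) z → count S < n → count S < m → U n Γ S z → U m Γ S z
U-lift (suc n) (suc m) Γ S z (s≤s p) (s≤s q) = Body-map (U n) (U m) Γ S z
  λ Γ′ D x lt → U-lift n m Γ′ D x (ℕₚ.<-≤-trans lt p) (ℕₚ.<-≤-trans lt q) , U-lift m n Γ′ D x (ℕₚ.<-≤-trans lt q) (ℕₚ.<-≤-trans lt p)

U-resp : ∀ n Γ {S S′ : Sub (N Γ)} {z} → S ⊆ S′ → S′ ⊆ S → U n Γ S z → U n Γ S′ z
U-resp zero Γ f g b = lift tt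
U-resp (suc n) Γ {S} {S′} {z} f g b = body
  (λ em → emptyᵇ b (λ v → ¬∈⇒∉ (λ p → clash (f v p) (em v))))
  (λ v p o → atomᵇ b v (g v p) (λ w p′ → o w (f w p′)))
  (λ p d e sep x r → parᵇ b (mv p) d e sep x r)
  (λ p d e sep → tensorᵇ b (mv p) d e sep)
  (λ {P} {T} {q} Q o pr bg → can {P} {T} {q} (primeᵇ b (Quot-⊆ f Q) (λ t t∈ → let (v , p , e) = o t t∈ in v , g v p , e) pr bg))
  where
  mv : ∀ {D E} → Part S′ D E → Part S D E
  mv (part s l r d) = part (λ v p → s v (f v p)) (λ v p → g v (l v p)) (λ v p → g v (r v p)) d
  can : ∀ {P T q} → Canon (U n) Γ S P T q z → Canon (U n) Γ S′ P T q z
  can {q = q} (inj₁ (u , r , h)) = inj₁ (u , (λ t p → U-resp n Γ (λ v m → ∩⁺ (f v (∩₁ m)) (∩₂ {S v} m)) (λ v m → ∩⁺ (g v (∩₁ m)) (∩₂ {S′ v} m)) (r t p)) , h)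
  can {q = q} (inj₂ (i , i∈ , y , u , r , s , h)) = inj₂ (i , i∈ , y , u ,
    U-resp n Γ (λ v m → ∩⁺ (f v (∩₁ m)) (∩₂ {S v} m)) (λ v m → ∩⁺ (g v (∩₁ m)) (∩₂ {S′ v} m)) r ,
    U-resp n Γ (λ v m → ∩⁺ (f v (∩₁ m)) (∩₂ {S v} m)) (λ v m → ∩⁺ (g v (∩₁ m)) (∩₂ {S′ v} m)) s , h)

U-closed : ∀ n Γ {S : Sub (N Γ)} {z z′} → z ⇒ z′ → U n Γ S z → U n Γ S z′
U-closed zero Γ f b = lift tt
U-closed (suc n) Γ {S} {z} {z′} f b = body
  (λ em → ⊢-⇒ f (emptyᵇ b em))
  (λ v p o → atomᵇ b v p o ▹ f)
  (λ p d e sep x r → U-closed n Γ (⇒-⊔ʳ x f) (parᵇ b p d e sep x r))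
  (λ p d e sep → let (x , y , r , s , g) = tensorᵇ b p d e sep in x , y , r , s , (g ▹ f))
  (λ {P} {T} {q} Q o pr bg → can {P} {T} {q} (primeᵇ b Q o pr bg))
  where
  can : ∀ {P T q} → Canon (U n) Γ S P T q z → Canon (U n) Γ S P T q z′
  can (inj₁ (u , r , h)) = inj₁ (u , r , h ▹ f)
  can (inj₂ (i , i∈ , y , u , r , s , h)) = inj₂ (i , i∈ , y , u , r , s , h ▹ f)

record 𝕌 (Γ : PG) (S : Sub (N Γ)) (z : FG) : Set₁ where
  no-eta-equality
  pattern
  constructor mk𝕌
  field un𝕌 : U (suc (count S)) Γ S z
open 𝕌

𝕌-swap : ∀ {n} Γ {S : Sub (N Γ)} {z} → count S < n → (U n Γ S z → 𝕌 Γ S z) × (𝕌 Γ S z → U n Γ S z)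
𝕌-swap {n} Γ {S} {z} lt = (λ b → mk𝕌 (U-lift n _ Γ S z lt ℕₚ.≤-refl b)) , (λ b → U-lift _ n Γ S z ℕₚ.≤-refl lt (un𝕌 b))

unfold : ∀ {Γ S z} → 𝕌 Γ S z → Body 𝕌 Γ S z
unfold {Γ} {S} {z} (mk𝕌 b) = Body-map (U (count S)) 𝕌 Γ S z (λ Γ′ D x lt → 𝕌-swap Γ′ lt) b

fold : ∀ {Γ S z} → Body 𝕌 Γ S z → 𝕌 Γ S z
fold {Γ} {S} {z} b = mk𝕌 (Body-map 𝕌 (U (count S)) Γ S z (λ Γ′ D x lt → let (f , g) = 𝕌-swap Γ′ lt in g , f) b)

𝕌-resp : ∀ {Γ} {S S′ : Sub (N Γ)} {z} → S ⊆ S′ → S′ ⊆ S → 𝕌 Γ S z → 𝕌 Γ S′ z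
𝕌-resp {Γ} {S} {S′} {z} f g (mk𝕌 b) = mk𝕌 (U-lift _ _ Γ S′ z (s≤s (count-≤ g)) ℕₚ.≤-refl (U-resp _ Γ f g b))

closed : ∀ {Γ S z z′} → z ⇒ z′ → 𝕌 Γ S z → 𝕌 Γ S z′
closed f (mk𝕌 b) = mk𝕌 (U-closed _ _ f b)

-- Modules and the uniqueness of par, tensor and prime shapes

noEdge-true : ∀ {Γ D E} → NoEdge (neg Γ) D E → ∀ v w → v ∈ D → w ∈ E → edge Γ v w ≡ true
noEdge-true {Γ} sep v w p q = Boolₚ.not-injective (trans (sym (edge-neg Γ v w)) (sep v w p q))

noEdge-neg : ∀ {Γ D E} → NoEdge Γ D E → NoEdge (neg (neg Γ)) D E
noEdge-neg {Γ} sep v w p q = trans (edge-neg (neg Γ) v w)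
  (trans (cong not (edge-neg Γ v w)) (trans (Boolₚ.not-involutive _) (sep v w p q)))

noEdge-sym : ∀ {Γ D E} → NoEdge Γ D E → NoEdge Γ E D
noEdge-sym {Γ} sep v w p q = trans (edge-sym Γ v w) (sep w v q p)

noEdge-⊆ : ∀ {Γ} {D D′ E E′ : Sub (N Γ)} → D′ ⊆ D → E′ ⊆ E → NoEdge Γ D E → NoEdge Γ D′ E′
noEdge-⊆ f g sep v w p q = sep v w (f v p) (g w q)

neg²-elim : ∀ {Γ S z} → 𝕌 (neg (neg Γ)) S z → 𝕌 Γ S z
neg²-elim {_ ⁺⁻ true}  b = b
neg²-elim {_ ⁺⁻ false} b = b

neg²-intro : ∀ {Γ S z} → 𝕌 Γ S z → 𝕌 (neg (neg Γ)) S z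
neg²-intro {_ ⁺⁻ true}  b = b
neg²-intro {_ ⁺⁻ false} b = b

hom-neg : ∀ {Γ S M} → Hom Γ S M → Hom (neg Γ) S M
hom-neg {Γ} h v x y a b c d e f = trans (edge-neg Γ v x) (trans (cong not (h v x y a b c d e f)) (sym (edge-neg Γ v y)))

hom-neg⁻ : ∀ {Γ S M} → Hom (neg Γ) S M → Hom Γ S M
hom-neg⁻ {Γ} h v x y a b c d e f =
  Boolₚ.not-injective (trans (sym (edge-neg Γ v x)) (trans (h v x y a b c d e f) (edge-neg Γ v y)))

part-∉ˡ : ∀ {n} {S D E : Sub n} → Part S D E → ∀ {v} → v ∈ S → v ∉ D → v ∈ E
part-∉ˡ p {v} v∈ v∉ = [ (λ d → clash d v∉) , id ]′ (Part.split p v v∈)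

part-∉ : ∀ {n} {S D E : Sub n} → Part S D E → ∀ {v} → v ∈ E → v ∉ D
part-∉ p {v} v∈ = ¬∈⇒∉ (λ d → Part.disj p v d v∈)

noEdge-hom : ∀ {Γ S D E} → Part S D E → NoEdge Γ D E → Hom Γ S D
noEdge-hom {Γ} p sep v x y v∈ v∉ _ x∈ _ y∈ =
  trans (edge-sym Γ v x) (trans (sep x v x∈ (part-∉ˡ p v∈ v∉)) (sym (trans (edge-sym Γ v y) (sep y v y∈ (part-∉ˡ p v∈ v∉)))))

hit? : ∀ {m n} (q : Fin m → Fin n) (M : Sub m) t → Dec (∃ λ v → v ∈ M × q v ≡ t)
hit? q M t = Finₚ.any? (λ v → (M v Boolₚ.≟ true) ×-dec (q v Fin.≟ t))

hits : ∀ {m n} → (Fin m → Fin n) → Sub m → Sub n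
hits q M t = does (hit? q M t)

hits⁺ : ∀ {m n} (q : Fin m → Fin n) {M t v} → v ∈ M → q v ≡ t → t ∈ hits q M
hits⁺ q {M} {t} p e = dec-true (hit? q M t) (_ , p , e)

hits⁻ : ∀ {m n} (q : Fin m → Fin n) {M t} → t ∈ hits q M → ∃ λ v → v ∈ M × q v ≡ t
hits⁻ q {M} {t} e with hit? q M t
... | yes p = p
hits⁻ q () | no _

∈-⇒⊥ : ∀ {n} {T : Sub n} {i} → i ∈ (T - i) → ⊥
∈-⇒⊥ {T = T} {i} p = ∉fib⁻ id {i} {i} (∖₂ {T i} p) refl

-- The fibres met by `M` form a module of the prime quotient. As `M` is inhabited, they are a single
-- fibre or all of them, and the latter is impossible for a proper module.
module-in-fibre : ∀ {Γ S P T q M} → Quot Γ S P T q → Onto S T q → PrimeS P T → Big T →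
  Hom Γ S M → M ⊆ S → Ne M → (∃ λ s → s ∈ S × s ∉ M) → ∃ λ i → i ∈ T × (∀ v → v ∈ M → q v ≡ i)
module-in-fibre {Γ} {S} {P} {T} {q} {M} Q onto prime bigT hom M⊆S (v₀ , v₀∈) (s , s∈ , s∉) =
  q v₀ , into Q v₀ (M⊆S v₀ v₀∈) , conclude (prime (hits q M) hom-J)
  where
  hom-J : Hom P T (hits q M)
  hom-J t x y t∈ t∉ x∈ xJ y∈ yJ with onto t t∈ | hits⁻ q {M} xJ | hits⁻ q {M} yJ
  ... | v , v∈ , refl | a , a∈ , refl | b , b∈ , refl =
    trans (sym (resp Q v a v∈ (M⊆S a a∈) (λ e → clash (hits⁺ q a∈ (sym e)) t∉)))
      (trans (hom v a b v∈ (¬∈⇒∉ (λ p → clash (hits⁺ q p refl) t∉)) (M⊆S a a∈) a∈ (M⊆S b b∈) b∈)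
        (resp Q v b v∈ (M⊆S b b∈) (λ e → clash (hits⁺ q b∈ (sym e)) t∉)))
  conclude : _ ⊎ _ ⊎ _ → ∀ v → v ∈ M → q v ≡ q v₀
  conclude (inj₁ none) v v∈ = clash (hits⁺ q v∈ refl) (none (q v) (into Q v (M⊆S v v∈)))
  conclude (inj₂ (inj₁ (i , only))) v v∈ =
    trans (only (q v) (into Q v (M⊆S v v∈)) (hits⁺ q v∈ refl)) (sym (only (q v₀) (into Q v₀ (M⊆S v₀ v₀∈)) (hits⁺ q v₀∈ refl)))
  -- If every fibre is met, then `s` outside `M` is related in the same way to a point of `M` in
  -- each other fibre. So `T - q s` would be a module of `P` that is neither a singleton nor
  -- everything.
  conclude (inj₂ (inj₂ full)) v v∈ = ⊥-elim (absurd (prime (T - i) hom-i))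
    where
    i : Fin (N P)
    i = q s
    is-i : ∀ {t} → t ∈ T → t ∉ (T - i) → t ≡ i
    is-i {t} t∈ t∉ = [ fib⁻ id {i} {t} , (λ n → clash (∖⁺ t∈ n) t∉) ]′ (t ∈? fib id i)
    hom-i : Hom P T (T - i)
    hom-i t x y t∈ t∉ x∈ xi y∈ yi with is-i t∈ t∉ | hits⁻ q {M} (full x x∈) | hits⁻ q {M} (full y y∈)
    ... | refl | a , a∈ , refl | b , b∈ , refl =
      trans (sym (resp Q s a s∈ (M⊆S a a∈) (λ e → ∈-⇒⊥ {T = T} (∈-⇒ {S = T - i} (sym e) xi))))
        (trans (hom s a b s∈ s∉ (M⊆S a a∈) a∈ (M⊆S b b∈) b∈)
          (resp Q s b s∈ (M⊆S b b∈) (λ e → ∈-⇒⊥ {T = T} (∈-⇒ {S = T - i} (sym e) yi))))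
    absurd : (∀ x → x ∈ T → x ∉ (T - i)) ⊎ (∃ λ v → ∀ x → x ∈ T → x ∈ (T - i) → x ≡ v) ⊎ (∀ x → x ∈ T → x ∈ (T - i)) → ⊥
    absurd (inj₁ none) with other bigT i i
    ... | k , k∈ , ne , _ = ne (is-i k∈ (none k k∈))
    absurd (inj₂ (inj₁ (v , only))) with other bigT i v
    ... | k , k∈ , ne , ne′ = ne′ (only k k∈ (∖⁺ k∈ (∉fib⁺ id ne)))
    absurd (inj₂ (inj₂ all)) = ∈-⇒⊥ {T = T} (all i (into Q s s∈))

-- Each half would lie in a single fibre, but there are at least three fibres.
prime-indivisible : ∀ {Γ S P T q D E} → Quot Γ S P T q → Onto S T q → PrimeS P T → Big T →
  Part S D E → Ne D → Ne E → Hom Γ S D → Hom Γ S E → ⊥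
prime-indivisible Q onto prime bigT p (d , d∈) (e , e∈) hD hE
  with module-in-fibre Q onto prime bigT hD (Part.inˡ p) (d , d∈) (e , Part.inʳ p e e∈ , part-∉ p e∈)
     | module-in-fibre Q onto prime bigT hE (Part.inʳ p) (e , e∈) (d , Part.inˡ p d d∈ , part-∉ (part-swap p) d∈)
... | i , _ , fi | j , _ , fj with other bigT i j
...   | k , k∈ , ki , kj with onto k k∈
...     | v , v∈ , refl = [ (λ m → ki (fi v m)) , (λ m → kj (fj v m)) ]′ (Part.split p v v∈)

prime≢split : ∀ {Γ S P T q D E} → Quot Γ S P T q → Onto S T q → PrimeS P T → Big T →
  Part S D E → Ne D → Ne E → NoEdge Γ D E → ⊥
prime≢split {Γ} Q onto prime bigT p d e sep = prime-indivisible Q onto prime bigT p d e (noEdge-hom {Γ} p sep) (noEdge-hom {Γ} (part-swap p) (noEdge-sym {Γ} sep))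

prime≢tensor : ∀ {Γ S P T q D E} → Quot Γ S P T q → Onto S T q → PrimeS P T → Big T →
  Part S D E → Ne D → Ne E → NoEdge (neg Γ) D E → ⊥
prime≢tensor {Γ} {P = P} Q onto prime bigT p d e sep =
  prime-indivisible Q onto prime bigT p d e (hom-neg⁻ {Γ} (noEdge-hom {neg Γ} p sep)) (hom-neg⁻ {Γ} (noEdge-hom {neg Γ} (part-swap p) (noEdge-sym {neg Γ} sep)))

-- A graph and its complement are not both disconnected: the adjacent `d` and `e` lie in the same
-- half of the par split, and any vertex of the other half is adjacent to one of them.
tensor≢par : ∀ {Γ S D E D′ E′} → Part S D E → Ne D → Ne E → NoEdge (neg Γ) D E →
  Part S D′ E′ → Ne D′ → Ne E′ → NoEdge Γ D′ E′ → ⊥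
tensor≢par {Γ} {S} {D} {E} {D′} {E′} p (d , d∈) (e , e∈) full p′ d′ e′ sep = go (Part.split p′ d (Part.inˡ p d d∈)) (Part.split p′ e (Part.inʳ p e e∈))
  where
  edge⁺ : ∀ v w → v ∈ D → w ∈ E → edge Γ v w ≡ true
  edge⁺ = noEdge-true {Γ} full
  no′ : ∀ v w → v ∈ E′ → w ∈ D′ → edge Γ v w ≡ false
  no′ = noEdge-sym {Γ} sep
  go : d ∈ D′ ⊎ d ∈ E′ → e ∈ D′ ⊎ e ∈ E′ → ⊥
  go (inj₁ a) (inj₂ b) = clash (edge⁺ d e d∈ e∈) (sep d e a b)
  go (inj₂ a) (inj₁ b) = clash (edge⁺ d e d∈ e∈) (no′ d e a b)
  go (inj₁ a) (inj₁ b) = let (f , f∈) = e′ in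
    [ (λ g → clash (edge⁺ f e g e∈) (no′ f e f∈ b)) , (λ g → clash (edge⁺ d f d∈ g) (sep d f a f∈)) ]′ (Part.split p f (Part.inʳ p′ f f∈))
  go (inj₂ a) (inj₂ b) = let (f , f∈) = d′ in
    [ (λ g → clash (edge⁺ f e g e∈) (sep f e f∈ b)) , (λ g → clash (edge⁺ d f d∈ g) (no′ d f a f∈)) ]′ (Part.split p f (Part.inˡ p′ f f∈))

part≢single : ∀ {n} {S D E : Sub n} → Part S D E → Ne D → Ne E → ∀ v → (∀ w → w ∈ S → w ≡ v) → ⊥
part≢single p (d , d∈) (e , e∈) v only with only d (Part.inˡ p d d∈) | only e (Part.inʳ p e e∈)
... | refl | refl = Part.disj p _ d∈ e∈

part-∩ : ∀ {n} {S D E X : Sub n} → X ⊆ S → Part S D E → Part X (X ∩ D) (X ∩ E)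
part-∩ {X = X} X⊆S (part s l r d) = part (λ v p → [ (λ m → inj₁ (∩⁺ p m)) , (λ m → inj₂ (∩⁺ p m)) ]′ (s v (X⊆S v p)))
  (λ v → ∩₁) (λ v → ∩₁) (λ v p q → d v (∩₂ {X v} p) (∩₂ {X v} q))

part-∩ˡ : ∀ {n} {S D E X : Sub n} → X ⊆ S → Part S D E → Part X (D ∩ X) (E ∩ X)
part-∩ˡ {D = D} {E} {X} X⊆S (part s l r d) = part (λ v p → [ (λ m → inj₁ (∩⁺ m p)) , (λ m → inj₂ (∩⁺ m p)) ]′ (s v (X⊆S v p)))
  (λ v → ∩₂ {D v}) (λ v → ∩₂ {E v}) (λ v p q → d v (∩₁ p) (∩₁ q))

∩-⊆ˡ : ∀ {n} {S T : Sub n} → S ∩ T ⊆ S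
∩-⊆ˡ v = ∩₁

∩-⊆ʳ : ∀ {n} {S T : Sub n} → S ∩ T ⊆ T
∩-⊆ʳ {S = S} v = ∩₂ {S v}

part-Emˡ : ∀ {n} {S D E : Sub n} → Part S D E → Em D → S ⊆ E
part-Emˡ p em v v∈ = part-∉ˡ p v∈ (em v)

part-Emʳ : ∀ {n} {S D E : Sub n} → Part S D E → Em E → S ⊆ D
part-Emʳ p = part-Emˡ (part-swap p)

no-Ne : ∀ {n} {S : Sub n} → Em S → Ne S → ⊥
no-Ne em (v , v∈) = clash v∈ (em v)

-- Introduction and elimination of realizers by shape

empty-intro : ∀ {Γ S z} → Em S → ⊢ z → 𝕌 Γ S z
empty-intro {Γ} {S} {z} em ⊢z = fold (body (λ _ → ⊢z) (λ v v∈ → clash v∈ (em v))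
  (λ p (d , d∈) → clash (Part.inˡ p d d∈) (em d)) (λ p (d , d∈) → clash (Part.inˡ p d d∈) (em d))
  (λ Q onto _ bigT → clash (proj₁ (proj₂ (onto _ (Big.a∈ bigT)))) (em _)))

empty-elim : ∀ {Γ S z} → Em S → 𝕌 Γ S z → ⊢ z
empty-elim em b = emptyᵇ (unfold b) em

⊔F-identityˡ : ∀ z → emptyF ⊔F z ≃ z
⊔F-identityˡ z = ⊔-emptyˡ (λ ())

⊔F-identityʳ : ∀ z → z ⊔F emptyF ≃ z
⊔F-identityʳ z = ⊔-emptyʳ (λ ())

Tensor : (Γ : PG) (D E : Sub (N Γ)) → FG → Set₁
Tensor Γ D E z = Σ FG λ x → Σ FG λ y → 𝕌 Γ D x × 𝕌 Γ E y × (x ⊔F y ⇒ z)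

tensor-elim : ∀ {Γ S D E z} → Part S D E → NoEdge (neg Γ) D E → 𝕌 Γ S z → Tensor Γ D E z
tensor-elim {Γ} {S} {D} {E} {z} p sep b = go (ne? D) (ne? E)
  where
  go : Ne D ⊎ Em D → Ne E ⊎ Em E → Tensor Γ D E z
  go (inj₂ em) _ = emptyF , z , empty-intro em (≃⇒⟶ ≃-refl) , 𝕌-resp (part-Emˡ p em) (Part.inʳ p) b , ≃⇒⇒ (⊔F-identityˡ z)
  go _ (inj₂ em) = z , emptyF , 𝕌-resp (part-Emʳ p em) (Part.inˡ p) b , empty-intro em (≃⇒⟶ ≃-refl) , ≃⇒⇒ (⊔F-identityʳ z)
  go (inj₁ d) (inj₁ e) = tensorᵇ (unfold b) p d e sep

-- A second tensor split cuts `D` and `E` into four pieces. Both realizers split accordingly and are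
-- regrouped along the second split, whose halves are smaller sets.
tensor-intro′ : ∀ n {Γ S D E x y} → count S < n → Part S D E → NoEdge (neg Γ) D E → 𝕌 Γ D x → 𝕌 Γ E y → 𝕌 Γ S (x ⊔F y)
tensor-intro′ (suc n) {Γ} {S} {D} {E} {x} {y} (s≤s lt) p full bx by = go (ne? D) (ne? E)
  where
  go : Ne D ⊎ Em D → Ne E ⊎ Em E → 𝕌 Γ S (x ⊔F y)
  go (inj₂ em) _ = closed (⇒-⊔⊢ y (empty-elim em bx) ▹ ≃⇒⇒ (⊔-comm y x)) (𝕌-resp (Part.inʳ p) (part-Emˡ p em) by)
  go _ (inj₂ em) = closed (⇒-⊔⊢ x (empty-elim em by)) (𝕌-resp (Part.inˡ p) (part-Emʳ p em) bx)
  go (inj₁ d) (inj₁ e) = fold (body (λ em → clash (Part.inˡ p _ (proj₂ d)) (em _))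
    (λ v v∈ only → ⊥-elim (part≢single p d e v only))
    (λ p′ d′ e′ sep → ⊥-elim (tensor≢par {Γ} p d e full p′ d′ e′ sep))
    tens
    (λ Q onto prime bigT → ⊥-elim (prime≢tensor Q onto prime bigT p d e full)))
    where
    tens : ∀ {D′ E′} → Part S D′ E′ → Ne D′ → Ne E′ → NoEdge (neg Γ) D′ E′ → Tensor Γ D′ E′ (x ⊔F y)
    tens {D′} {E′} p′ d′ e′ full′ = combine
      (tensor-elim (part-∩ (Part.inˡ p) p′) (noEdge-⊆ {neg Γ} ∩-⊆ʳ ∩-⊆ʳ full′) bx)
      (tensor-elim (part-∩ (Part.inʳ p) p′) (noEdge-⊆ {neg Γ} ∩-⊆ʳ ∩-⊆ʳ full′) by)
      where
      open ⊔-Solver using (solve; _⊕_; _⊜_)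
      combine : Tensor Γ (D ∩ D′) (D ∩ E′) x → Tensor Γ (E ∩ D′) (E ∩ E′) y → Tensor Γ D′ E′ (x ⊔F y)
      combine (x₁ , x₂ , bx₁ , bx₂ , fx) (y₁ , y₂ , by₁ , by₂ , fy) = x₁ ⊔F y₁ , x₂ ⊔F y₂ ,
        tensor-intro′ n (part-<ˡ lt p′ e′) (part-∩ˡ (Part.inˡ p′) p) (noEdge-⊆ {neg Γ} ∩-⊆ˡ ∩-⊆ˡ full) bx₁ by₁ ,
        tensor-intro′ n (part-<ʳ lt p′ d′) (part-∩ˡ (Part.inʳ p′) p) (noEdge-⊆ {neg Γ} ∩-⊆ˡ ∩-⊆ˡ full) bx₂ by₂ ,
        ≃⇒⇒ (solve 4 (λ a b c d → (a ⊕ c) ⊕ (b ⊕ d) ⊜ (a ⊕ b) ⊕ (c ⊕ d)) ≃-refl x₁ x₂ y₁ y₂)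
          ▹ ⇒-⊔ʳ (y₁ ⊔F y₂) fx ▹ ⇒-⊔ˡ x fy

tensor-intro : ∀ {Γ S D E x y} → Part S D E → NoEdge (neg Γ) D E → 𝕌 Γ D x → 𝕌 Γ E y → 𝕌 Γ S (x ⊔F y)
tensor-intro = tensor-intro′ _ ℕₚ.≤-refl

data Shape (Γ : PG) (S : Sub (N Γ)) : Set where
  par-shape    : ∀ {D E} → Part S D E → Ne D → Ne E → NoEdge Γ D E → Shape Γ S
  tensor-shape : ∀ {D E} → Part S D E → Ne D → Ne E → NoEdge (neg Γ) D E → Shape Γ S
  prime-shape  : ∀ {P T q} → Quot Γ S P T q → Onto S T q → PrimeS P T → Big T → Shape Γ S

-- The prime quotient decides: with two vertices it is a par or a tensor according to its only
-- possible edge, otherwise it is big.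
shape : ∀ Γ S {D E} → Part S D E → Ne D → Ne E → Shape Γ S
shape Γ S p (d , d∈) (e , e∈)
  with primeQuotient _ Γ S ℕₚ.≤-refl (d , e , Part.inˡ p d d∈ , Part.inʳ p e e∈ , (λ { refl → Part.disj p d d∈ e∈ }))
... | pq T r Q onto prime (s , t , s∈ , t∈ , s≢t) with third? T s∈ t∈ s≢t
...   | inj₁ bigT = prime-shape Q onto prime bigT
...   | inj₂ only = two (edge Γ t s) refl
  where
  p′ : Part S (S ∖ fib r s) (S ∩ fib r s)
  p′ = ∩∖-part S (fib r s)
  is-t : ∀ v → v ∈ S → v ∉ fib r s → r v ≡ t
  is-t v v∈ v∉ = [ (λ eq → ⊥-elim (∉fib⁻ r {s} {v} v∉ eq)) , id ]′ (only (r v) (into Q v v∈))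
  edges : ∀ v w → v ∈ (S ∖ fib r s) → w ∈ (S ∩ fib r s) → edge Γ v w ≡ edge Γ t s
  edges v w v∈ w∈ = trans (resp Q v w (∩₁ v∈) (∩₁ w∈) (λ eq → s≢t (trans (sym w≡) (trans (sym eq) v≡)))) (cong₂ (edge Γ) v≡ w≡)
    where
    v≡ = is-t v (∩₁ v∈) (∖₂ {S v} v∈)
    w≡ = fib⁻ r {s} {w} (∩₂ {S w} w∈)
  ne₁ : Ne (S ∖ fib r s)
  ne₁ with onto t t∈
  ... | v , v∈ , refl = v , ∖⁺ v∈ (∉fib⁺ r (s≢t ∘ sym))
  two : ∀ b → edge Γ t s ≡ b → Shape Γ S
  two false eq = par-shape p′ ne₁ (fibre-ne onto s s∈) (λ v w a b → trans (edges v w a b) eq)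
  two true eq = tensor-shape p′ ne₁ (fibre-ne onto s s∈) (λ v w a b → trans (edge-neg Γ v w) (cong not (trans (edges v w a b) eq)))

⊔-swapʳ : ∀ x y z → (x ⊔F y) ⊔F z ≃ (x ⊔F z) ⊔F y
⊔-swapʳ = solve 3 (λ x y z → (x ⊕ y) ⊕ z ⊜ (x ⊕ z) ⊕ y) ≃-refl
  where open ⊔-Solver using (solve; _⊕_; _⊜_)

⊔-rot : ∀ x y z → x ⊔F (y ⊔F z) ≃ (x ⊔F z) ⊔F y
⊔-rot = solve 3 (λ x y z → x ⊕ (y ⊕ z) ⊜ (x ⊕ z) ⊕ y) ≃-refl
  where open ⊔-Solver using (solve; _⊕_; _⊜_)

⊔-assoc⁻ : ∀ x y z → x ⊔F (y ⊔F z) ≃ (x ⊔F y) ⊔F z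
⊔-assoc⁻ x y z = ≃-sym (⊔F-assoc x y z)

∩-≐ : ∀ {n} {S S′ M : Sub n} → (∀ v → v ∈ M → v ∈ S → v ∈ S′) → S ∩ M ⊆ S′ ∩ M
∩-≐ {S = S} f v p = ∩⁺ (f v (∩₂ {S v} p) (∩₁ p)) (∩₂ {S v} p)

∖-≐ : ∀ {n} {S S′ M : Sub n} → (∀ v → v ∉ M → v ∈ S → v ∈ S′) → S ∖ M ⊆ S′ ∖ M
∖-≐ {S = S} f v p = ∖⁺ (f v (∖₂ {S v} p) (∩₁ p)) (∖₂ {S v} p)

hom-⊆ : ∀ {Γ} {S S′ M : Sub (N Γ)} → S′ ⊆ S → Hom Γ S M → Hom Γ S′ M
hom-⊆ f h v x y a b c d e g = h v x y (f v a) b (f x c) d (f y e) g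

fibre-hom : ∀ {Γ S P T q} → Quot Γ S P T q → ∀ t → Hom Γ S (S ∩ fib q t)
fibre-hom {Γ} {S} {P} {q = q} Q t v x y v∈ v∉ x∈ x∈F y∈ y∈F =
  trans (edges x x∈ (fib⁻ q {t} {x} (∩₂ {S x} x∈F))) (sym (edges y y∈ (fib⁻ q {t} {y} (∩₂ {S y} y∈F))))
  where
  edges : ∀ w → w ∈ S → q w ≡ t → edge Γ v w ≡ edge P (q v) t
  edges w w∈ refl = resp Q v w v∈ w∈ (λ e → clash (∩⁺ v∈ (fib⁺ q e)) v∉)

primeS-neg : ∀ {P T} → PrimeS P T → PrimeS (neg P) T
primeS-neg {P} prime M hom = prime M (hom-neg⁻ {P} hom)

Comp-neg² : ∀ P u T → Comp (neg (neg P)) u T ≃ Comp P u T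
Comp-neg² (_ ⁺⁻ true)  u T = ≃-refl
Comp-neg² (_ ⁺⁻ false) u T = ≃-refl

ai-provable : ∀ a → ⊢ atomF (dualAtom a) ⊔F atomF a
ai-provable a = ⟨ rule⇒derivation (gs-ai↓ (ai↓-inst a)) ⟩ᵈ ▸ ≃⇒⟶ (⌜⊔⌝ (atomG (dualAtom a)) (atomG a))

-- A fibre of one quotient is a proper module, so it lies within a fibre of the other. Used in both
-- directions this shows that prime quotients of a set have the same fibres.
fibres-agree : ∀ {Γ S P T q P′ T′ q′} → Quot Γ S P T q → Onto S T q → Big T →
  Quot Γ S P′ T′ q′ → Onto S T′ q′ → PrimeS P′ T′ → Big T′ → ∀ v w → v ∈ S → w ∈ S → q v ≡ q w → q′ v ≡ q′ w
fibres-agree {Γ} {S} {q = q} Q onto bigT Q′ onto′ prime′ bigT′ v w v∈ w∈ e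
  with module-in-fibre Q′ onto′ prime′ bigT′ (fibre-hom Q (q w)) ∩-⊆ˡ (w , ∩⁺ w∈ (fib⁺ q refl))
         (let (s , s∈) = cofibre-ne onto bigT (q w) in s , ∩₁ s∈ , ¬∈⇒∉ (λ m → clash (∩₂ {S s} m) (∖₂ {S s} s∈)))
... | i , _ , f = trans (f v (∩⁺ v∈ (fib⁺ q e))) (sym (f w (∩⁺ w∈ (fib⁺ q refl))))

-- The clause `primeᵇ` has to be shown for every prime quotient of `S`; by `fibres-agree` another
-- one merely reindexes the components, along the map `r` that goes through representatives.
prime-intro : ∀ {Γ S P T q u} → Quot Γ S P T q → Onto S T q → PrimeS P T → Big T →
  (∀ t → t ∈ T → 𝕌 Γ (S ∩ fib q t) (u t)) → 𝕌 Γ S (Comp (neg P) u T)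
prime-intro {Γ} {S} {P} {T} {q} {u} Q onto prime bigT bu = fold (body
  (λ em → clash (∩₁ (proj₂ F)) (em _))
  (λ v _ only → ⊥-elim (part≢single P₀ C F v only))
  (λ p d e sep → ⊥-elim (prime≢split Q onto prime bigT p d e sep))
  (λ p d e sep → ⊥-elim (prime≢tensor Q onto prime bigT p d e sep))
  canon)
  where
  t₀ : Fin (N P)
  t₀ = Big.a bigT
  P₀ : Part S (S ∖ fib q t₀) (S ∩ fib q t₀)
  P₀ = ∩∖-part S (fib q t₀)
  F : Ne (S ∩ fib q t₀)
  F = fibre-ne onto t₀ (Big.a∈ bigT)
  C : Ne (S ∖ fib q t₀)
  C = cofibre-ne onto bigT t₀
  rep′ : ∀ {t} → t ∈ T ⊎ t ∉ T → Fin (N Γ)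
  rep′ (inj₁ t∈) = proj₁ (onto _ t∈)
  -- A default value: outside `T` any vertex will do.
  rep′ (inj₂ _)  = proj₁ F
  rep : Fin (N P) → Fin (N Γ)
  rep t = rep′ (t ∈? T)
  rep-ok : ∀ {t} → t ∈ T → rep t ∈ S × q (rep t) ≡ t
  rep-ok {t} t∈ = go (t ∈? T)
    where
    go : (d : t ∈ T ⊎ t ∉ T) → rep′ d ∈ S × q (rep′ d) ≡ t
    go (inj₁ t∈′) = proj₂ (onto t t∈′)
    go (inj₂ t∉) = clash t∈ t∉
  canon : ∀ {P′ T′ q′} → Quot Γ S P′ T′ q′ → Onto S T′ q′ → PrimeS P′ T′ → Big T′ → Canon 𝕌 Γ S P′ T′ q′ (Comp (neg P) u T)
  canon {P′} {T′} {q′} Q′ onto′ prime′ bigT′ =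
    inj₁ ((λ t′ → Comp (neg P) u (T ∩ fib r t′)) , fibres , ≃⇒⇒ (≃-sym (Comp-assoc u (Quot-neg QR))))
    where
    r : Fin (N P) → Fin (N P′)
    r t = q′ (rep t)
    fwd : ∀ v w → v ∈ S → w ∈ S → q v ≡ q w → q′ v ≡ q′ w
    fwd = fibres-agree Q onto bigT Q′ onto′ prime′ bigT′
    bwd : ∀ v w → v ∈ S → w ∈ S → q′ v ≡ q′ w → q v ≡ q w
    bwd = fibres-agree Q′ onto′ bigT′ Q onto prime bigT
    QR : Quot P T P′ T′ r
    QR = quot (λ t t∈ → into Q′ _ (proj₁ (rep-ok t∈))) λ s t s∈ t∈ ne →
      trans (cong₂ (edge P) (sym (proj₂ (rep-ok s∈))) (sym (proj₂ (rep-ok t∈))))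
        (trans (sym (resp Q _ _ (proj₁ (rep-ok s∈)) (proj₁ (rep-ok t∈)) (λ e → ne (fwd _ _ (proj₁ (rep-ok s∈)) (proj₁ (rep-ok t∈)) e))))
          (resp Q′ _ _ (proj₁ (rep-ok s∈)) (proj₁ (rep-ok t∈)) ne))
    fibres : ∀ t′ → t′ ∈ T′ → 𝕌 Γ (S ∩ fib q′ t′) (Comp (neg P) u (T ∩ fib r t′))
    fibres t′ t′∈ = at (onto′ t′ t′∈)
      where
      at : (∃ λ v → v ∈ S × q′ v ≡ t′) → 𝕌 Γ (S ∩ fib q′ t′) (Comp (neg P) u (T ∩ fib r t′))
      at (v , v∈ , refl) = closed (≃⇒⇒ (≃-sym (Comp-single (neg P) u {T ∩ fib r (q′ v)} {q v} (∩⁺ qv∈ (fib⁺ r (fwd _ v (proj₁ (rep-ok qv∈)) v∈ (proj₂ (rep-ok qv∈))))) only)))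
        (𝕌-resp (∩-map (λ w w∈ e → fwd w v w∈ v∈ e)) (∩-map′ (λ w w∈ e → bwd w v w∈ v∈ e)) (bu (q v) qv∈))
        where
        qv∈ : q v ∈ T
        qv∈ = into Q v v∈
        only : ∀ s → s ∈ (T ∩ fib r (q′ v)) → s ≡ q v
        only s s∈ = trans (sym (proj₂ (rep-ok (∩₁ s∈)))) (bwd _ v (proj₁ (rep-ok (∩₁ s∈))) v∈ (fib⁻ r {q′ v} {s} (∩₂ {T s} s∈)))
        ∩-map : (∀ w → w ∈ S → q w ≡ q v → q′ w ≡ q′ v) → S ∩ fib q (q v) ⊆ S ∩ fib q′ (q′ v)
        ∩-map f w p = ∩⁺ (∩₁ p) (fib⁺ q′ (f w (∩₁ p) (fib⁻ q {q v} {w} (∩₂ {S w} p))))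
        ∩-map′ : (∀ w → w ∈ S → q′ w ≡ q′ v → q w ≡ q v) → S ∩ fib q′ (q′ v) ⊆ S ∩ fib q (q v)
        ∩-map′ f w p = ∩⁺ (∩₁ p) (fib⁺ q (f w (∩₁ p) (fib⁻ q′ {q′ v} {w} (∩₂ {S w} p))))

onto-shrink : ∀ {m n} {S C : Sub m} {T : Sub n} {q i} → Onto S T q → (∀ {t} → t ≢ i → ∀ v → v ∈ fib q t → v ∈ S → v ∈ C) →
  Ne (C ∩ fib q i) → Onto C T q
onto-shrink {S = S} {C} {q = q} {i} onto keep (w , w∈) t t∈ = at (t Fin.≟ i) (onto t t∈)
  where
  at : Dec (t ≡ i) → (∃ λ v → v ∈ S × q v ≡ t) → ∃ λ v → v ∈ C × q v ≡ t
  at (yes e) _            = w , ∩₁ w∈ , trans (fib⁻ q {i} {w} (∩₂ {C w} w∈)) (sym e)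
  at (no ne) (v , v∈ , e) = v , keep ne v (fib⁺ q e) v∈ , e

part-fibres : ∀ {m n} {S : Sub m} {T : Sub n} {q : Fin m → Fin n} {s t} → (∀ v → v ∈ S → q v ∈ T) →
  (∀ i → i ∈ T → i ≡ s ⊎ i ≡ t) → s ≢ t → Part S (S ∩ fib q s) (S ∩ fib q t)
part-fibres {S = S} {T} {q} {s} {t} into only s≢t =
  part (λ v v∈ → [ (λ e → inj₁ (∩⁺ v∈ (fib⁺ q e))) , (λ e → inj₂ (∩⁺ v∈ (fib⁺ q e))) ]′ (only (q v) (into v v∈)))
    (λ v → ∩₁) (λ v → ∩₁) (λ v a b → s≢t (trans (sym (fib⁻ q {s} {v} (∩₂ {S v} a))) (fib⁻ q {t} {v} (∩₂ {S v} b))))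

fibre-edge : ∀ {Γ S P T q s t} → Quot Γ S P T q → s ≢ t → ∀ v w → v ∈ (S ∩ fib q s) → w ∈ (S ∩ fib q t) → edge Γ v w ≡ edge P s t
fibre-edge {Γ} {S} {P} {T} {q} {s} {t} Q s≢t v w v∈ w∈ = at (fib⁻ q {s} {v} (∩₂ {S v} v∈)) (fib⁻ q {t} {w} (∩₂ {S w} w∈))
  where
  at : q v ≡ s → q w ≡ t → edge Γ v w ≡ edge P s t
  at refl refl = resp Q v w (∩₁ v∈) (∩₁ w∈) s≢t

fibre-full : ∀ {Γ S P T q s t} → Quot Γ S P T q → s ≢ t → edge P s t ≡ true → NoEdge (neg Γ) (S ∩ fib q s) (S ∩ fib q t)
fibre-full {Γ} Q s≢t e v w v∈ w∈ = trans (edge-neg Γ v w) (cong not (trans (fibre-edge Q s≢t v w v∈ w∈) e))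

-- Orthogonality and modules

-- In the first two cases `C` and `M` themselves form a par or a tensor split. In the mixed case the
-- two witnesses let `module-side` be applied in the graph and in its dual.
data Attachment (Γ : PG) (C M : Sub (N Γ)) : Set where
  none  : NoEdge Γ C M → Attachment Γ C M
  all   : NoEdge (neg Γ) C M → Attachment Γ C M
  mixed : ∀ {c m c′ m′} → c ∈ C → m ∈ M → edge Γ c m ≡ true → c′ ∈ C → m′ ∈ M → edge (neg Γ) c′ m′ ≡ true → Attachment Γ C M

attachment : ∀ Γ C M → Attachment Γ C M
attachment Γ C M
  with Finₚ.any? (λ c → Finₚ.any? λ m → (C c Boolₚ.≟ true) ×-dec (M m Boolₚ.≟ true) ×-dec (edge Γ c m Boolₚ.≟ true))
     | Finₚ.any? (λ c → Finₚ.any? λ m → (C c Boolₚ.≟ true) ×-dec (M m Boolₚ.≟ true) ×-dec (edge (neg Γ) c m Boolₚ.≟ true))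
... | no ∄ | _ = none (λ c m c∈ m∈ → ¬∈⇒∉ (λ e → ∄ (c , m , c∈ , m∈ , e)))
... | yes _ | no ∄ = all (λ c m c∈ m∈ → ¬∈⇒∉ (λ e → ∄ (c , m , c∈ , m∈ , e)))
... | yes (c , m , c∈ , m∈ , e) | yes (c′ , m′ , c′∈ , m′∈ , e′) = mixed c∈ m∈ e c′∈ m′∈ e′

-- Since `c` is joined to one vertex of the module, it is joined to all, and a split without
-- crossing edges cannot separate them.
module-side : ∀ {Γ S C M D E c m} → Part S C M → Hom Γ S M → c ∈ C → m ∈ M → edge Γ c m ≡ true →
  Part S D E → NoEdge Γ D E → M ⊆ D ⊎ M ⊆ E
module-side {Γ} {S} {C} {M} {D} {E} {c} {m} p hom c∈ m∈ e p′ sep = go (Part.split p′ c (Part.inˡ p c c∈))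
  where
  joined : ∀ w → w ∈ M → edge Γ c w ≡ true
  joined w w∈ = trans (hom c w m (Part.inˡ p c c∈) (part-∉ (part-swap p) c∈) (Part.inʳ p w w∈) w∈ (Part.inʳ p m m∈) m∈) e
  go : c ∈ D ⊎ c ∈ E → M ⊆ D ⊎ M ⊆ E
  go (inj₁ cD) = inj₁ (λ w w∈ → [ id , (λ wE → clash (joined w w∈) (sep c w cD wE)) ]′ (Part.split p′ w (Part.inʳ p w w∈)))
  go (inj₂ cE) = inj₂ (λ w w∈ → [ (λ wD → clash (joined w w∈) (noEdge-sym {Γ} sep c w cE wD)) , id ]′ (Part.split p′ w (Part.inʳ p w w∈)))

data Location (Γ : PG) (S M : Sub (N Γ)) : Set where
  in-par    : ∀ {D E} → Part S D E → Ne D → Ne E → NoEdge Γ D E → M ⊆ D → Location Γ S M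
  in-tensor : ∀ {D E} → Part S D E → Ne D → Ne E → NoEdge (neg Γ) D E → M ⊆ D → Location Γ S M
  in-fibre  : ∀ {P T q i} → Quot Γ S P T q → Onto S T q → PrimeS P T → Big T → i ∈ T → (∀ v → v ∈ M → q v ≡ i) → Location Γ S M

proper-in-fibre : ∀ {Γ S C M P T q} → Part S C M → Hom Γ S M → Ne C → Ne M → Quot Γ S P T q → Onto S T q → PrimeS P T → Big T →
  ∃ λ i → i ∈ T × (∀ v → v ∈ M → q v ≡ i)
proper-in-fibre p hom (c , c∈) m Q onto prime bigT =
  module-in-fibre Q onto prime bigT hom (Part.inʳ p) m (c , Part.inˡ p c c∈ , part-∉ (part-swap p) c∈)

locate : ∀ {Γ S C M c m c′ m′} → Part S C M → Hom Γ S M → c ∈ C → m ∈ M → edge Γ c m ≡ true →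
  c′ ∈ C → m′ ∈ M → edge (neg Γ) c′ m′ ≡ true → Location Γ S M
locate {Γ} {S} {C} {M} p hom c∈ m∈ e c′∈ m′∈ e′ = go (shape Γ S p (_ , c∈) (_ , m∈))
  where
  go : Shape Γ S → Location Γ S M
  go (par-shape p₁ d e₁ sep) = [ in-par p₁ d e₁ sep , in-par (part-swap p₁) e₁ d (noEdge-sym {Γ} sep) ]′
    (module-side {Γ} p hom c∈ m∈ e p₁ sep)
  go (tensor-shape p₁ d e₁ sep) = [ in-tensor p₁ d e₁ sep , in-tensor (part-swap p₁) e₁ d (noEdge-sym {neg Γ} sep) ]′
    (module-side {neg Γ} p (hom-neg {Γ} hom) c′∈ m′∈ e′ p₁ sep)
  go (prime-shape Q onto prime bigT) = let (i , i∈ , f) = proper-in-fibre p hom (_ , c∈) (_ , m∈) Q onto prime bigT in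
    in-fibre Q onto prime bigT i∈ f

part-inside : ∀ {n} {S C M D : Sub n} → Part S C M → D ⊆ S → M ⊆ D → Part D (D ∩ C) M
part-inside (part s l r d) D⊆S M⊆D = part (λ v p → [ (λ c → inj₁ (∩⁺ p c)) , inj₂ ]′ (s v (D⊆S v p)))
  (λ v → ∩₁) M⊆D (λ v p q → d v (∩₂ p) q)

part-rest : ∀ {n} {S C M D E : Sub n} → Part S C M → Part S D E → M ⊆ D → Part C (D ∩ C) E
part-rest {D = D} p (part s l r d) M⊆D = part (λ v c → [ (λ m → inj₁ (∩⁺ m c)) , inj₂ ]′ (s v (Part.inˡ p v c)))
  (λ v → ∩₂ {D v}) (λ v e → part-∉ˡ (part-swap p) (r v e) (¬∈⇒∉ (λ m → d v (M⊆D v m) e))) (λ v a b → d v (∩₁ a) b)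

part-fibre : ∀ {m n} {S C M : Sub m} {q : Fin m → Fin n} {i} → Part S C M → (∀ v → v ∈ M → q v ≡ i) →
  Part (S ∩ fib q i) (C ∩ fib q i) M
part-fibre {S = S} {q = q} {i} (part s l r d) f = part
  (λ v p → [ (λ c → inj₁ (∩⁺ c (∩₂ {S v} p))) , inj₂ ]′ (s v (∩₁ p)))
  (λ v p → ∩⁺ (l v (∩₁ p)) (∩₂ p)) (λ v m → ∩⁺ (r v m) (fib⁺ q (f v m))) (λ v a b → d v (∩₁ a) b)

part-cofibre : ∀ {m n} {S C M : Sub m} {q : Fin m → Fin n} {i j} → Part S C M → (∀ v → v ∈ M → q v ≡ i) → j ≢ i →
  Part (S ∖ fib q j) (C ∖ fib q j) M
part-cofibre {S = S} {C} {q = q} (part s l r d) f ne = part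
  (λ v p → [ (λ c → inj₁ (∖⁺ c (∖₂ {S v} p))) , inj₂ ]′ (s v (∩₁ p)))
  (λ v p → ∖⁺ (l v (∩₁ p)) (∖₂ {C v} p)) (λ v m → ∖⁺ (r v m) (∉fib⁺ q (λ e → ne (trans (sym e) (f v m))))) (λ v a b → d v (∩₁ a) b)

-- Read `𝕌 Γ S z` as provability of `z ⊔ S`. Then `plug-intro` inserts one proof into another,
-- `cut-module` is a cut on `M`, and `cut-context` is a cut on the context. In `comp-intro` fibres
-- may be empty, because cuts produce such quotients. The properties call each other on smaller sets
-- and share one induction.
record Core (n : ℕ) : Set₁ where
  no-eta-equality
  field
    orth : ∀ {Γ S z x} → count S < n → 𝕌 Γ S z → 𝕌 (neg Γ) S x → ⊢ z ⊔F x
    par-intro : ∀ {Γ S A B z} → count S < n → Part S A B → NoEdge Γ A B → (∀ x → 𝕌 (neg Γ) A x → 𝕌 Γ B (z ⊔F x)) →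
      (∀ x → 𝕌 (neg Γ) B x → 𝕌 Γ A (z ⊔F x)) → 𝕌 Γ S z
    plug-intro : ∀ {Γ S C M z u} → count S < n → Part S C M → Hom Γ S M → 𝕌 Γ C z → 𝕌 Γ M u → 𝕌 Γ S (z ⊔F u)
    cut-module : ∀ {Γ S C M z x} → count S < n → Part S C M → Hom Γ S M → 𝕌 Γ S z → 𝕌 (neg Γ) M x → 𝕌 Γ C (z ⊔F x)
    cut-context : ∀ {Γ S C M z x} → count S < n → Part S C M → Hom Γ S M → 𝕌 Γ S z → 𝕌 (neg Γ) C x → 𝕌 Γ M (z ⊔F x)
    comp-intro : ∀ {Γ S P T q u} → count S < n → Quot Γ S P T q → (∀ t → t ∈ T → 𝕌 Γ (S ∩ fib q t) (u t)) →
      𝕌 Γ S (Comp (neg P) u T)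

-- The sign `⁺` marks a property for sets of at most `n` vertices, derived from the properties for
-- fewer than `n`.
module Induction (n : ℕ) (IH : Core n) where
  open Core IH

  par-elim : ∀ {Γ S A B z x} → count S < n → Part S A B → NoEdge Γ A B → 𝕌 Γ S z → 𝕌 (neg Γ) A x → 𝕌 Γ B (z ⊔F x)
  par-elim {Γ} {S} {A} {B} {z} {x} lt p sep bz bx = go (ne? A) (ne? B)
    where
    go : Ne A ⊎ Em A → Ne B ⊎ Em B → 𝕌 Γ B (z ⊔F x)
    go (inj₂ em) _ = closed (⇒-⊔⊢ z (empty-elim em bx)) (𝕌-resp (part-Emˡ p em) (Part.inʳ p) bz)
    go _ (inj₂ em) = empty-intro em (orth lt bz (𝕌-resp (Part.inˡ p) (part-Emʳ p em) bx))
    go (inj₁ a) (inj₁ b) = parᵇ (unfold bz) p a b sep x bx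

  -- Let `D | E` be another par split. In the dual `A | B` is a tensor split, so a realizer of the
  -- dual of `D` decomposes along it, and what is left to show concerns the smaller set `E`.
  par-intro⁺ : ∀ {Γ S A B z} → count S ≤ n → Part S A B → NoEdge Γ A B → (∀ x → 𝕌 (neg Γ) A x → 𝕌 Γ B (z ⊔F x)) →
    (∀ x → 𝕌 (neg Γ) B x → 𝕌 Γ A (z ⊔F x)) → 𝕌 Γ S z
  par-intro⁺ {Γ} {S} {A} {B} {z} le p sep h h′ = go (ne? A) (ne? B)
    where
    go : Ne A ⊎ Em A → Ne B ⊎ Em B → 𝕌 Γ S z
    go (inj₂ em) _ = 𝕌-resp (Part.inʳ p) (part-Emˡ p em) (closed (≃⇒⇒ (⊔F-identityʳ z)) (h emptyF (empty-intro em (≃⇒⟶ ≃-refl))))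
    go _ (inj₂ em) = 𝕌-resp (Part.inˡ p) (part-Emʳ p em) (closed (≃⇒⇒ (⊔F-identityʳ z)) (h′ emptyF (empty-intro em (≃⇒⟶ ≃-refl))))
    go (inj₁ a) (inj₁ b) = fold (body (λ em → clash (Part.inˡ p _ (proj₂ a)) (em _))
      (λ v _ only → ⊥-elim (part≢single p a b v only))
      par′
      (λ p′ d e full → ⊥-elim (tensor≢par {Γ} p′ d e full p a b sep))
      (λ Q onto prime bigT → ⊥-elim (prime≢split Q onto prime bigT p a b sep)))
      where
      par′ : ∀ {D E} → Part S D E → Ne D → Ne E → NoEdge Γ D E → ∀ x → 𝕌 (neg Γ) D x → 𝕌 Γ E (z ⊔F x)
      par′ {D} {E} p′ d e sep′ x bx =
        combine (tensor-elim (part-∩ (Part.inˡ p′) p) (noEdge-⊆ {neg (neg Γ)} ∩-⊆ʳ ∩-⊆ʳ (noEdge-neg {Γ} sep)) bx)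
        where
        combine : Tensor (neg Γ) (D ∩ A) (D ∩ B) x → 𝕌 Γ E (z ⊔F x)
        combine (x₁ , x₂ , bx₁ , bx₂ , f) = par-intro (part-<ʳ le p′ d)
          (part-∩ (Part.inʳ p′) p) (noEdge-⊆ {Γ} ∩-⊆ʳ ∩-⊆ʳ sep) left right
          where
          -- Together `x₁` and `y` realize the dual of `A`, so `h` leaves a realizer of `B`; from
          -- that set `x₂` removes `D ∩ B`.
          left : ∀ y → 𝕌 (neg Γ) (E ∩ A) y → 𝕌 Γ (E ∩ B) ((z ⊔F x) ⊔F y)
          left y by = closed (≃⇒⇒ (solve 4 (λ z a y b → (z ⊕ (a ⊕ y)) ⊕ b ⊜ (z ⊕ (a ⊕ b)) ⊕ y) ≃-refl z x₁ y x₂)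
                       ▹ ⇒-⊔ʳ y (⇒-⊔ˡ z f))
            (par-elim (part-<ʳ le p a) (part-∩ˡ (Part.inʳ p) p′) (noEdge-⊆ {Γ} ∩-⊆ˡ ∩-⊆ˡ sep′)
              (h _ (tensor-intro (part-∩ˡ (Part.inˡ p) p′) (noEdge-⊆ {neg (neg Γ)} ∩-⊆ˡ ∩-⊆ˡ (noEdge-neg {Γ} sep′)) bx₁ by)) bx₂)
            where open ⊔-Solver using (solve; _⊕_; _⊜_)
          right : ∀ y → 𝕌 (neg Γ) (E ∩ B) y → 𝕌 Γ (E ∩ A) ((z ⊔F x) ⊔F y)
          right y by = closed (≃⇒⇒ (solve 4 (λ z a y b → (z ⊕ (b ⊕ y)) ⊕ a ⊜ (z ⊕ (a ⊕ b)) ⊕ y) ≃-refl z x₁ y x₂)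
                       ▹ ⇒-⊔ʳ y (⇒-⊔ˡ z f))
            (par-elim (part-<ˡ le p b) (part-∩ˡ (Part.inˡ p) p′) (noEdge-⊆ {Γ} ∩-⊆ˡ ∩-⊆ˡ sep′)
              (h′ _ (tensor-intro (part-∩ˡ (Part.inʳ p) p′) (noEdge-⊆ {neg (neg Γ)} ∩-⊆ˡ ∩-⊆ˡ (noEdge-neg {Γ} sep′)) bx₂ by)) bx₁)
            where open ⊔-Solver using (solve; _⊕_; _⊜_)

  plug-intro⁺ : ∀ {Γ S C M z u} → count S ≤ n → Part S C M → Hom Γ S M → 𝕌 Γ C z → 𝕌 Γ M u → 𝕌 Γ S (z ⊔F u)
  plug-intro⁺ {Γ} {S} {C} {M} {z} {u} le p hom bz bu = go (ne? C) (ne? M)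
    where
    go : Ne C ⊎ Em C → Ne M ⊎ Em M → 𝕌 Γ S (z ⊔F u)
    go (inj₂ em) _ = closed (⇒-⊔⊢ u (empty-elim em bz) ▹ ≃⇒⇒ (⊔-comm u z)) (𝕌-resp (Part.inʳ p) (part-Emˡ p em) bu)
    go _ (inj₂ em) = closed (⇒-⊔⊢ z (empty-elim em bu)) (𝕌-resp (Part.inˡ p) (part-Emʳ p em) bz)
    go (inj₁ c) (inj₁ m) = attach (attachment Γ C M)
      where
      C<n : count C < n
      C<n = part-<ˡ le p m
      M<n : count M < n
      M<n = part-<ʳ le p c
      attach : Attachment Γ C M → 𝕌 Γ S (z ⊔F u)
      attach (none sep) = par-intro⁺ le p sep
        (λ x bx → closed (⇒-⊔⊢ u (orth C<n bz bx) ▹ ≃⇒⇒ (solve 3 (λ u z x → u ⊕ (z ⊕ x) ⊜ (z ⊕ u) ⊕ x) ≃-refl u z x)) bu)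
        (λ x bx → closed (⇒-⊔⊢ z (orth M<n bu bx) ▹ ≃⇒⇒ (⊔-assoc⁻ z u x)) bz)
        where open ⊔-Solver using (solve; _⊕_; _⊜_)
      attach (all full) = tensor-intro p full bz bu
      -- Now `M` lies within one half of each par or tensor split of `S` and within one fibre of
      -- each prime quotient. The work is done there, or on `C`, always on fewer vertices.
      attach (mixed c₁∈ m₁∈ e₁ c₂∈ m₂∈ e₂) = fold (body (λ em → clash (Part.inˡ p _ (proj₂ c)) (em _))
        (λ v _ only → ⊥-elim (part≢single p c m v only)) par′ tensor′ prime′)
        where
        par′ : ∀ {D E} → Part S D E → Ne D → Ne E → NoEdge Γ D E → ∀ x → 𝕌 (neg Γ) D x → 𝕌 Γ E ((z ⊔F u) ⊔F x)
        par′ {D} {E} p′ d e sep x bx = [ inD , inE ]′ (module-side {Γ} p hom c₁∈ m₁∈ e₁ p′ sep)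
          where
          inD : M ⊆ D → 𝕌 Γ E ((z ⊔F u) ⊔F x)
          inD M⊆D = closed (≃⇒⇒ (⊔-rot z x u ))
            (par-elim C<n (part-rest p p′ M⊆D) (noEdge-⊆ {Γ} ∩-⊆ˡ (λ _ → id) sep) bz
              (cut-module (part-<ˡ le p′ e) (part-inside p (Part.inˡ p′) M⊆D)
                (hom-neg {Γ} (hom-⊆ {Γ} (Part.inˡ p′) hom)) bx (neg²-intro bu)))
          inE : M ⊆ E → 𝕌 Γ E ((z ⊔F u) ⊔F x)
          inE M⊆E = closed (≃⇒⇒ (⊔-swapʳ z x u))
            (plug-intro (part-<ʳ le p′ d) (part-inside p (Part.inʳ p′) M⊆E) (hom-⊆ {Γ} (Part.inʳ p′) hom)
              (par-elim C<n (part-swap (part-rest p (part-swap p′) M⊆E)) (noEdge-⊆ {Γ} (λ _ → id) ∩-⊆ˡ sep) bz bx) bu)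
        tensor′ : ∀ {D E} → Part S D E → Ne D → Ne E → NoEdge (neg Γ) D E → Tensor Γ D E (z ⊔F u)
        tensor′ {D} {E} p′ d e full = [ inD , inE ]′ (module-side {neg Γ} p (hom-neg {Γ} hom) c₂∈ m₂∈ e₂ p′ full)
          where
          inD : M ⊆ D → Tensor Γ D E (z ⊔F u)
          inD M⊆D = combine (tensor-elim (part-rest p p′ M⊆D) (noEdge-⊆ {neg Γ} ∩-⊆ˡ (λ _ → id) full) bz)
            where
            combine : Tensor Γ (D ∩ C) E z → Tensor Γ D E (z ⊔F u)
            combine (x , y , bx , by , f) = x ⊔F u , y ,
              plug-intro (part-<ˡ le p′ e) (part-inside p (Part.inˡ p′) M⊆D) (hom-⊆ {Γ} (Part.inˡ p′) hom) bx bu ,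
              by , ≃⇒⇒ (⊔-swapʳ x u y) ▹ ⇒-⊔ʳ u f
          inE : M ⊆ E → Tensor Γ D E (z ⊔F u)
          inE M⊆E = combine (tensor-elim (part-swap (part-rest p (part-swap p′) M⊆E)) (noEdge-⊆ {neg Γ} (λ _ → id) ∩-⊆ˡ full) bz)
            where
            combine : Tensor Γ D (E ∩ C) z → Tensor Γ D E (z ⊔F u)
            combine (x , y , bx , by , f) = x , y ⊔F u , bx ,
              plug-intro (part-<ʳ le p′ d) (part-inside p (Part.inʳ p′) M⊆E) (hom-⊆ {Γ} (Part.inʳ p′) hom) by bu ,
              ≃⇒⇒ (⊔-assoc⁻ x y u) ▹ ⇒-⊔ʳ u f
        prime′ : ∀ {P T q} → Quot Γ S P T q → Onto S T q → PrimeS P T → Big T → Canon 𝕌 Γ S P T q (z ⊔F u)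
        prime′ {P} {T} {q} Q onto prime bigT = inFibre (proper-in-fibre p hom c m Q onto prime bigT)
          where
          inFibre : (∃ λ i → i ∈ T × (∀ v → v ∈ M → q v ≡ i)) → Canon 𝕌 Γ S P T q (z ⊔F u)
          inFibre (i , i∈ , f) = dec (ne? (C ∩ fib q i))
            where
            not-M : ∀ {t} → t ≢ i → ∀ v → v ∈ fib q t → v ∈ S → v ∈ C
            not-M {t} ne v v∈ vS = part-∉ˡ (part-swap p) vS (¬∈⇒∉ (λ m → ne (trans (sym (fib⁻ q {t} {v} v∈)) (f v m))))
            fibre-≐ : ∀ {t x} → t ≢ i → 𝕌 Γ (C ∩ fib q t) x → 𝕌 Γ (S ∩ fib q t) x
            fibre-≐ ne = 𝕌-resp (∩-≐ (λ v _ → Part.inˡ p v)) (∩-≐ (not-M ne))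
            cofibre-≐ : ∀ {x} → 𝕌 Γ (C ∖ fib q i) x → 𝕌 Γ (S ∖ fib q i) x
            cofibre-≐ = 𝕌-resp (∖-≐ (λ v _ → Part.inˡ p v))
              (∖-≐ (λ v v∉ vS → part-∉ˡ (part-swap p) vS (¬∈⇒∉ (λ m → ∉fib⁻ q {i} {v} v∉ (f v m)))))
            plug-fibre : ∀ {x} → 𝕌 Γ (C ∩ fib q i) x → 𝕌 Γ (S ∩ fib q i) (x ⊔F u)
            plug-fibre bx = plug-intro (fibre-< le onto bigT i) (part-fibre p f) (hom-⊆ {Γ} (λ _ → ∩₁) hom) bx bu
            dec : Ne (C ∩ fib q i) ⊎ Em (C ∩ fib q i) → Canon 𝕌 Γ S P T q (z ⊔F u)
            -- `M` is the whole fibre, so `C` lacks a component and `z` need not be a composition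
            -- along `P`. This is the origin of the second alternative of `Canon`.
            dec (inj₂ em) = inj₂ (i , i∈ , z , u ,
              cofibre-≐ (𝕌-resp (λ v vC → ∖⁺ vC (¬∈⇒∉ (λ m → clash (∩⁺ vC m) (em v)))) (λ v → ∩₁) bz) ,
              𝕌-resp (Part.inʳ (part-fibre p f)) (part-Emˡ (part-fibre p f) em) bu , ≃⇒⇒ ≃-refl)
            dec (inj₁ w) = canon (primeᵇ (unfold bz) (Quot-⊆ (Part.inˡ p) Q) (onto-shrink onto not-M w) prime bigT)
              where
              canon : Canon 𝕌 Γ C P T q z → Canon 𝕌 Γ S P T q (z ⊔F u)
              canon (inj₁ (y , by , g)) = inj₁ (upd y i (y i ⊔F u) , fibres , ⟶⇒⇒ (Comp-upd (neg P) y i u i∈) ▹ ⇒-⊔ʳ u g)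
                where
                fibres : ∀ t → t ∈ T → 𝕌 Γ (S ∩ fib q t) (upd y i (y i ⊔F u) t)
                fibres t t∈ = at (t Fin.≟ i)
                  where
                  at : Dec (t ≡ i) → 𝕌 Γ (S ∩ fib q t) (upd y i (y i ⊔F u) t)
                  at (yes refl) = closed (≃⇒⇒ (≡⇒≃ (sym (upd-≡ y i _)))) (plug-fibre (by i t∈))
                  at (no ne) = closed (≃⇒⇒ (≡⇒≃ (sym (upd-≢ y i _ ne)))) (fibre-≐ ne (by t t∈))
              canon (inj₂ (j , j∈ , y , v , by , bv , g)) = at (j Fin.≟ i)
                where
                at : Dec (j ≡ i) → Canon 𝕌 Γ S P T q (z ⊔F u)
                at (yes refl) = inj₂ (j , j∈ , y , v ⊔F u , cofibre-≐ by , plug-fibre bv , ≃⇒⇒ (⊔-assoc⁻ y v u) ▹ ⇒-⊔ʳ u g)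
                at (no ne) = inj₂ (j , j∈ , y ⊔F u , v ,
                  plug-intro (cofibre-< le onto j j∈) (part-cofibre p f ne) (hom-⊆ {Γ} (λ _ → ∩₁) hom) by bu ,
                  fibre-≐ ne bv , ≃⇒⇒ (⊔-swapʳ y u v) ▹ ⇒-⊔ʳ u g)

  -- Both parts are inhabited here to avoid a circle at equal size: `orth⁺` calls `cut-module-ne` on
  -- `S` itself, and a cut whose context is empty is in turn an instance of `orth⁺`.
  module Cuts {Γ : PG} {S C M : Sub (N Γ)} (le : count S ≤ n) (p : Part S C M) (hom : Hom Γ S M) (c : Ne C) (m : Ne M) where

    C<n : count C < n
    C<n = part-<ˡ le p m

    M<n : count M < n
    M<n = part-<ʳ le p c

    -- `M` is a module of `D` in the dual as well, so a realizer of the dual of `D ∩ C` and `x` add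
    -- up to one of the dual of `D`, to which the par clause of `z` applies.
    cut-module-par : ∀ {D E z x} → Part S D E → Ne D → Ne E → NoEdge Γ D E → M ⊆ D → 𝕌 Γ S z → 𝕌 (neg Γ) M x → 𝕌 Γ C (z ⊔F x)
    cut-module-par {D} {E} {z} {x} p′ d e sep M⊆D bz bx =
      par-intro C<n (part-rest p p′ M⊆D) (noEdge-⊆ {Γ} ∩-⊆ˡ (λ _ → id) sep)
        (λ y by → closed (≃⇒⇒ (⊔-rot z y x))
          (parᵇ (unfold bz) p′ d e sep _ (plug-intro D<n pD (hom-neg {Γ} homD) by bx)))
        (λ y by → closed (≃⇒⇒ (⊔-swapʳ z y x))
          (cut-module D<n pD homD (parᵇ (unfold bz) (part-swap p′) e d (noEdge-sym {Γ} sep) y by) bx))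
      where
      D<n : count D < n
      D<n = part-<ˡ le p′ e
      pD : Part D (D ∩ C) M
      pD = part-inside p (Part.inˡ p′) M⊆D
      homD : Hom Γ D M
      homD = hom-⊆ {Γ} (Part.inˡ p′) hom

    cut-module-tensor : ∀ {D E z x} → Part S D E → Ne D → Ne E → NoEdge (neg Γ) D E → M ⊆ D → 𝕌 Γ S z → 𝕌 (neg Γ) M x → 𝕌 Γ C (z ⊔F x)
    cut-module-tensor {D} {E} {z} {x} p′ d e full M⊆D bz bx = combine (tensorᵇ (unfold bz) p′ d e full)
      where
      combine : Tensor Γ D E z → 𝕌 Γ C (z ⊔F x)
      combine (y , y′ , by , by′ , f) = closed (≃⇒⇒ (⊔-swapʳ y x y′) ▹ ⇒-⊔ʳ x f)
        (tensor-intro (part-rest p p′ M⊆D) (noEdge-⊆ {neg Γ} ∩-⊆ˡ (λ _ → id) full)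
          (cut-module (part-<ˡ le p′ e) (part-inside p (Part.inˡ p′) M⊆D) (hom-⊆ {Γ} (Part.inˡ p′) hom) by bx) by′)

    cut-context-par : ∀ {D E z x} → Part S D E → Ne D → Ne E → NoEdge Γ D E → M ⊆ D → 𝕌 Γ S z → 𝕌 (neg Γ) C x → 𝕌 Γ M (z ⊔F x)
    cut-context-par {D} {E} {z} {x} p′ d e sep M⊆D bz bx =
      combine (tensor-elim (part-rest p p′ M⊆D) (noEdge-⊆ {neg (neg Γ)} ∩-⊆ˡ (λ _ → id) (noEdge-neg {Γ} sep)) bx)
      where
      combine : Tensor (neg Γ) (D ∩ C) E x → 𝕌 Γ M (z ⊔F x)
      combine (y , y′ , by , by′ , f) = closed (≃⇒⇒ (≃-sym (⊔-rot z y y′)) ▹ ⇒-⊔ˡ z f)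
        (cut-context (part-<ˡ le p′ e) (part-inside p (Part.inˡ p′) M⊆D) (hom-⊆ {Γ} (Part.inˡ p′) hom)
          (parᵇ (unfold bz) (part-swap p′) e d (noEdge-sym {Γ} sep) y′ by′) by)

    cut-context-tensor : ∀ {D E z x} → Part S D E → Ne D → Ne E → NoEdge (neg Γ) D E → M ⊆ D → 𝕌 Γ S z → 𝕌 (neg Γ) C x → 𝕌 Γ M (z ⊔F x)
    cut-context-tensor {D} {E} {z} {x} p′ d e full M⊆D bz bx = combine (tensorᵇ (unfold bz) p′ d e full)
      where
      combine : Tensor Γ D E z → 𝕌 Γ M (z ⊔F x)
      combine (y , y′ , by , by′ , f) = closed (≃⇒⇒ (⊔-rot y x y′) ▹ ⇒-⊔ʳ x f)
        (cut-context (part-<ˡ le p′ e) (part-inside p (Part.inˡ p′) M⊆D) (hom-⊆ {Γ} (Part.inˡ p′) hom) by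
          (par-elim {neg Γ} C<n (part-swap (part-rest p p′ M⊆D)) (noEdge-sym {neg Γ} (noEdge-⊆ {neg Γ} ∩-⊆ˡ (λ _ → id) full)) bx (neg²-intro by′)))

    module Located {P : PG} {T : Sub (N P)} {q : Fin (N Γ) → Fin (N P)} (Q : Quot Γ S P T q) (onto : Onto S T q) (prime : PrimeS P T) (bigT : Big T)
             {i} (i∈ : i ∈ T) (f : ∀ v → v ∈ M → q v ≡ i) where

      outside-M : ∀ {t} → t ≢ i → ∀ v → v ∈ fib q t → v ∈ S → v ∈ C
      outside-M {t} ne v v∈ vS = part-∉ˡ (part-swap p) vS (¬∈⇒∉ (λ m → ne (trans (sym (fib⁻ q {t} {v} v∈)) (f v m))))

      restrict : ∀ {t x} → t ≢ i → 𝕌 Γ (S ∩ fib q t) x → 𝕌 Γ (C ∩ fib q t) x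
      restrict ne = 𝕌-resp (∩-≐ (outside-M ne)) (∩-≐ (λ v _ → Part.inˡ p v))

      extend : ∀ {t x} → t ≢ i → 𝕌 (neg Γ) (C ∩ fib q t) x → 𝕌 (neg Γ) (S ∩ fib q t) x
      extend ne = 𝕌-resp (∩-≐ (λ v _ → Part.inˡ p v)) (∩-≐ (outside-M ne))

      cofibre-⊆ : S ∖ fib q i ⊆ C ∖ fib q i
      cofibre-⊆ = ∖-≐ (λ v v∉ vS → part-∉ˡ (part-swap p) vS (¬∈⇒∉ (λ m → ∉fib⁻ q {i} {v} v∉ (f v m))))

      cofibre-⊇ : C ∖ fib q i ⊆ S ∖ fib q i
      cofibre-⊇ = ∖-≐ (λ v _ → Part.inˡ p v)

      cut-in-fibre : ∀ {z x} → 𝕌 Γ (S ∩ fib q i) z → 𝕌 (neg Γ) M x → 𝕌 Γ (C ∩ fib q i) (z ⊔F x)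
      cut-in-fibre = cut-module (fibre-< le onto bigT i) (part-fibre p f) (hom-⊆ {Γ} (λ _ → ∩₁) hom)

      cut-module-prime : ∀ {z x} → 𝕌 Γ S z → 𝕌 (neg Γ) M x → 𝕌 Γ C (z ⊔F x)
      cut-module-prime {z} {x} bz bx = canon (primeᵇ (unfold bz) Q onto prime bigT)
        where
        QC : Quot Γ C P T q
        QC = Quot-⊆ (Part.inˡ p) Q
        canon : Canon 𝕌 Γ S P T q z → 𝕌 Γ C (z ⊔F x)
        -- `x` joins component `i`. The fibre of `C` over `i` may be empty now, which calls for
        -- `comp-intro` instead of `prime-intro`.
        canon (inj₁ (y , by , g)) = closed (⟶⇒⇒ (Comp-upd (neg P) y i x i∈) ▹ ⇒-⊔ʳ x g) (comp-intro C<n QC fibres)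
          where
          fibres : ∀ t → t ∈ T → 𝕌 Γ (C ∩ fib q t) (upd y i (y i ⊔F x) t)
          fibres t t∈ = at (t Fin.≟ i)
            where
            at : Dec (t ≡ i) → 𝕌 Γ (C ∩ fib q t) (upd y i (y i ⊔F x) t)
            at (yes refl) = closed (≃⇒⇒ (≡⇒≃ (sym (upd-≡ y i _)))) (cut-in-fibre (by i t∈) bx)
            at (no ne) = closed (≃⇒⇒ (≡⇒≃ (sym (upd-≢ y i _ ne)))) (restrict ne (by t t∈))
        canon (inj₂ (j , j∈ , y , v , by , bv , g)) = at (j Fin.≟ i)
          where
          at : Dec (j ≡ i) → 𝕌 Γ C (z ⊔F x)
          at (yes refl) = closed (≃⇒⇒ (⊔-assoc⁻ y v x) ▹ ⇒-⊔ʳ x g)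
            (plug-intro C<n (∩∖-part C (fib q i)) (fibre-hom QC i) (𝕌-resp cofibre-⊆ cofibre-⊇ by) (cut-in-fibre bv bx))
          at (no ne) = closed (≃⇒⇒ (⊔-swapʳ y x v) ▹ ⇒-⊔ʳ x g)
            (plug-intro C<n (∩∖-part C (fib q j)) (fibre-hom QC j)
              (cut-module (cofibre-< le onto j j∈) (part-cofibre p f ne) (hom-⊆ {Γ} (λ _ → ∩₁) hom) by bx) (restrict ne bv))

    cut-module-ne : ∀ {z x} → 𝕌 Γ S z → 𝕌 (neg Γ) M x → 𝕌 Γ C (z ⊔F x)
    cut-module-ne {z} {x} bz bx = attach (attachment Γ C M)
      where
      attach : Attachment Γ C M → 𝕌 Γ C (z ⊔F x)
      attach (none sep) = parᵇ (unfold bz) (part-swap p) m c (noEdge-sym {Γ} sep) x bx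
      attach (all full) = combine (tensorᵇ (unfold bz) p c m full)
        where
        combine : Tensor Γ C M z → 𝕌 Γ C (z ⊔F x)
        combine (y , y′ , by , by′ , f) = closed (⇒-⊔⊢ y (orth M<n by′ bx) ▹ ≃⇒⇒ (⊔-assoc⁻ y y′ x) ▹ ⇒-⊔ʳ x f) by
      attach (mixed c₁∈ m₁∈ e₁ c₂∈ m₂∈ e₂) = located (locate p hom c₁∈ m₁∈ e₁ c₂∈ m₂∈ e₂)
        where
        located : Location Γ S M → 𝕌 Γ C (z ⊔F x)
        located (in-par p′ d e sep s) = cut-module-par p′ d e sep s bz bx
        located (in-tensor p′ d e sep s) = cut-module-tensor p′ d e sep s bz bx
        located (in-fibre Q onto prime bigT i∈ f) = Located.cut-module-prime Q onto prime bigT i∈ f bz bx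

  -- In the dual the split is a tensor, so `x` decomposes: one half feeds the par clause of `z`, the
  -- other is orthogonal to the result on `E`.
  orth-par : ∀ {Γ S D E z x} → count S ≤ n → Part S D E → Ne D → Ne E → NoEdge Γ D E → 𝕌 Γ S z → 𝕌 (neg Γ) S x → ⊢ z ⊔F x
  orth-par {Γ} {S} {D} {E} {z} {x} le p d e sep bz bx = combine (tensorᵇ (unfold bx) p d e (noEdge-neg {Γ} sep))
    where
    combine : Tensor (neg Γ) D E x → ⊢ z ⊔F x
    combine (y , y′ , by , by′ , f) = ⊢-⇒ (≃⇒⇒ (⊔F-assoc z y y′) ▹ ⇒-⊔ˡ z f)
      (orth (part-<ʳ le p d) (parᵇ (unfold bz) p d e sep y by) by′)

  -- Compositions along `P` and its dual are orthogonal by `comp-cut-all`. If one side has a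
  -- component split off, that component is cut from the opposite side, and the remaining cofibre is
  -- smaller.
  orth-prime : ∀ {Γ S P T q z x} → count S ≤ n → Quot Γ S P T q → Onto S T q → PrimeS P T → Big T →
    𝕌 Γ S z → 𝕌 (neg Γ) S x → ⊢ z ⊔F x
  orth-prime {Γ} {S} {P} {T} {q} {z} {x} le Q onto prime bigT bz bx =
    canon (primeᵇ (unfold bz) Q onto prime bigT) (primeᵇ (unfold bx) (Quot-neg Q) onto (primeS-neg {P} prime) bigT)
    where
    canon : Canon 𝕌 Γ S P T q z → Canon 𝕌 (neg Γ) S (neg P) T q x → ⊢ z ⊔F x
    canon (inj₁ (w , bw , f)) (inj₁ (y , by , g)) =
      ⊢-⇒ (⇒-⊔ʳ _ f ▹ ⇒-⊔ˡ z (≃⇒⇒ (≃-sym (Comp-neg² P y T)) ▹ g))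
        (comp-cut-all _ P T w y ℕₚ.≤-refl (λ t t∈ → orth (fibre-< le onto bigT t) (bw t t∈) (by t t∈)))
    canon (inj₂ (i , i∈ , y , v , by , bv , f)) _ =
      ⊢-⇒ (≃⇒⇒ (⊔-rot y x v) ▹ ⇒-⊔ʳ x f)
        (orth (cofibre-< le onto i i∈) by (Cuts.cut-module-ne {neg Γ} le (∩∖-part S (fib q i)) (hom-neg {Γ} (fibre-hom Q i))
          (cofibre-ne onto bigT i) (fibre-ne onto i i∈) bx (neg²-intro bv)))
    canon (inj₁ _) (inj₂ (i , i∈ , y , v , by , bv , f)) =
      ⊢-⇒ (≃⇒⇒ (≃-sym (⊔-rot z y v)) ▹ ⇒-⊔ˡ z f)
        (orth (cofibre-< le onto i i∈) (Cuts.cut-module-ne {Γ} le (∩∖-part S (fib q i)) (fibre-hom Q i)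
          (cofibre-ne onto bigT i) (fibre-ne onto i i∈) bz bv) by)

  orth⁺ : ∀ {Γ S z x} → count S ≤ n → 𝕌 Γ S z → 𝕌 (neg Γ) S x → ⊢ z ⊔F x
  orth⁺ {Γ} {S} {z} {x} le bz bx = inhabit (ne? S)
    where
    inhabit : Ne S ⊎ Em S → ⊢ z ⊔F x
    inhabit (inj₂ em) = ⊢-⊔ (empty-elim em bz) (empty-elim em bx)
    inhabit (inj₁ (v , v∈)) = more (ne? (S ∖ fib id v))
      where
      F : Ne (S ∩ fib id v)
      F = v , ∩⁺ v∈ (fib⁺ id {v} {v} refl)
      more : Ne (S ∖ fib id v) ⊎ Em (S ∖ fib id v) → ⊢ z ⊔F x
      more (inj₂ em) = ⊢-⇒ (⇒-⊔ʳ _ (atomᵇ (unfold bz) v v∈ only) ▹ ⇒-⊔ˡ z (≃⇒⇒ (≡⇒≃ (cong atomF (sym label))) ▹ atomᵇ (unfold bx) v v∈ only))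
                         (ai-provable (plab Γ v))
        where
        only : ∀ w → w ∈ S → w ≡ v
        only = only-member em
        label : dualAtom (plab (neg Γ) v) ≡ plab Γ v
        label = trans (cong dualAtom (plab-neg Γ v)) (dual-dual _)
      more (inj₁ d) = shaped (shape Γ S (∩∖-part S (fib id v)) d F)
        where
        shaped : Shape Γ S → ⊢ z ⊔F x
        shaped (par-shape p d e sep) = orth-par le p d e sep bz bx
        shaped (tensor-shape p d e full) = ⊢-⇒ (≃⇒⇒ (⊔-comm x z)) (orth-par {neg Γ} le p d e full bx (neg²-intro bz))
        shaped (prime-shape Q onto prime bigT) = orth-prime le Q onto prime bigT bz bx

  cut-module⁺ : ∀ {Γ S C M z x} → count S ≤ n → Part S C M → Hom Γ S M → 𝕌 Γ S z → 𝕌 (neg Γ) M x → 𝕌 Γ C (z ⊔F x)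
  cut-module⁺ {Γ} {S} {C} {M} {z} {x} le p hom bz bx = go (ne? C) (ne? M)
    where
    go : Ne C ⊎ Em C → Ne M ⊎ Em M → 𝕌 Γ C (z ⊔F x)
    go (inj₂ em) _ = empty-intro em (orth⁺ le bz (𝕌-resp (Part.inʳ p) (part-Emˡ p em) bx))
    go _ (inj₂ em) = closed (⇒-⊔⊢ z (empty-elim em bx)) (𝕌-resp (part-Emʳ p em) (Part.inˡ p) bz)
    go (inj₁ c) (inj₁ m) = Cuts.cut-module-ne le p hom c m bz bx

  -- The context consists of all fibres but one. Their components compose to a realizer orthogonal
  -- to `x`, which yields a provable surrounding for the component at `i`.
  cut-context-fibre : ∀ {Γ S P T q i z x} → count S ≤ n → Quot Γ S P T q → Onto S T q → PrimeS P T → Big T → i ∈ T →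
    𝕌 Γ S z → 𝕌 (neg Γ) (S ∖ fib q i) x → 𝕌 Γ (S ∩ fib q i) (z ⊔F x)
  cut-context-fibre {Γ} {S} {P} {T} {q} {i} {z} {x} le Q onto prime bigT i∈ bz bx = canon (primeᵇ (unfold bz) Q onto prime bigT)
    where
    C : Sub (N Γ)
    C = S ∖ fib q i
    apart : ∀ {j} → j ≢ i → ∀ v → v ∈ fib q j → v ∉ fib q i
    apart {j} ne v v∈ = ∉fib⁺ q (λ e → ne (trans (sym (fib⁻ q {j} {v} v∈)) e))
    Q′ : Quot Γ C P (T - i) q
    Q′ = quot (λ v v∈ → ∖⁺ (into Q v (∩₁ v∈)) (∉fib⁺ id {i} {q v} (∉fib⁻ q {i} {v} (∖₂ {S v} v∈))))
      (λ v w v∈ w∈ → resp Q v w (∩₁ v∈) (∩₁ w∈))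
    canon : Canon 𝕌 Γ S P T q z → 𝕌 Γ (S ∩ fib q i) (z ⊔F x)
    canon (inj₁ (w , bw , f)) =
      closed (Comp-around (neg P) w i∈ (orth (cofibre-< le onto i i∈) (comp-intro (cofibre-< le onto i i∈) Q′ fibres) bx) ▹ ⇒-⊔ʳ x f) (bw i i∈)
      where
      fibres : ∀ t → t ∈ (T - i) → 𝕌 Γ (C ∩ fib q t) (w t)
      fibres t t∈ = 𝕌-resp (∩-≐ (λ v v∈ vS → ∖⁺ vS (apart (∉fib⁻ id {i} {t} (∖₂ {T t} t∈)) v v∈))) (∩-≐ {S = C} {S′ = S} (λ v _ → ∩₁)) (bw t (∩₁ t∈))
    canon (inj₂ (j , j∈ , y , v , by , bv , f)) = at (j Fin.≟ i)
      where
      at : Dec (j ≡ i) → 𝕌 Γ (S ∩ fib q i) (z ⊔F x)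
      at (yes refl) = closed (⇒-⊔⊢ v (orth (cofibre-< le onto i i∈) by bx)
        ▹ ≃⇒⇒ (solve 3 (λ v y x → v ⊕ (y ⊕ x) ⊜ (y ⊕ v) ⊕ x) ≃-refl v y x) ▹ ⇒-⊔ʳ x f) bv
        where open ⊔-Solver using (solve; _⊕_; _⊜_)
      at (no ne) = closed (≃⇒⇒ (⊔-rot y x v) ▹ ⇒-⊔ʳ x f)
        (cut-context (cofibre-< le onto j j∈) pj (hom-⊆ {Γ} (λ _ → ∩₁) (fibre-hom Q i)) by
          (cut-module (cofibre-< le onto i i∈) (∩∖-part C (fib q j)) (hom-neg {Γ} (fibre-hom Q′ j)) bx
            (neg²-intro (𝕌-resp (∩-≐ (λ v v∈ vS → ∖⁺ vS (apart ne v v∈))) (∩-≐ {S = C} {S′ = S} (λ v _ → ∩₁)) bv))))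
        where
        pj : Part (S ∖ fib q j) (C ∖ fib q j) (S ∩ fib q i)
        pj = part-cofibre (∩∖-part S (fib q i)) (λ v v∈ → fib⁻ q {i} {v} (∩₂ {S v} v∈)) ne

  -- If `C` still meets fibre `i`, it has the same prime quotient, and both `z` and `x` can be put
  -- into canonical form. Two compositions merge by `comp-cut` with position `i` open, where the cut
  -- continues inside the fibre. Otherwise `M` is the fibre and `cut-context-fibre` applies.
  cut-context-prime : ∀ {Γ S C M P T q i z x} → count S ≤ n → Part S C M → Hom Γ S M → Ne C → Ne M →
    Quot Γ S P T q → Onto S T q → PrimeS P T → Big T → i ∈ T → (∀ v → v ∈ M → q v ≡ i) →
    𝕌 Γ S z → 𝕌 (neg Γ) C x → 𝕌 Γ M (z ⊔F x)
  cut-context-prime {Γ} {S} {C} {M} {P} {T} {q} {i} {z} {x} le p hom c m Q onto prime bigT i∈ f bz bx = dec (ne? (C ∩ fib q i))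
    where
    open Cuts {Γ} {S} {C} {M} le p hom c m using (C<n)
    open Cuts.Located {Γ} {S} {C} {M} le p hom c m Q onto prime bigT i∈ f
    QC : Quot Γ C P T q
    QC = Quot-⊆ (Part.inˡ p) Q
    pi : Part (S ∩ fib q i) (C ∩ fib q i) M
    pi = part-fibre p f
    homᵢ : Hom Γ (S ∩ fib q i) M
    homᵢ = hom-⊆ {Γ} (λ _ → ∩₁) hom
    dec : Ne (C ∩ fib q i) ⊎ Em (C ∩ fib q i) → 𝕌 Γ M (z ⊔F x)
    dec (inj₂ em) = 𝕌-resp (part-Emˡ pi em) (Part.inʳ pi)
      (cut-context-fibre le Q onto prime bigT i∈ bz
        (𝕌-resp (λ v vC → cofibre-⊇ v (∖⁺ vC (¬∈⇒∉ (λ v∈ → clash (∩⁺ vC v∈) (em v))))) (λ v v∈ → ∩₁ (cofibre-⊆ v v∈)) bx))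
    dec (inj₁ w) = canon (primeᵇ (unfold bz) Q onto prime bigT) (primeᵇ (unfold bx) (Quot-neg QC) (onto-shrink onto outside-M w) (primeS-neg {P} prime) bigT)
      where
      canon : Canon 𝕌 Γ S P T q z → Canon 𝕌 (neg Γ) C (neg P) T q x → 𝕌 Γ M (z ⊔F x)
      canon _ (inj₂ (j , j∈ , x′ , y , bx′ , by , g)) = at (j Fin.≟ i)
        where
        at : Dec (j ≡ i) → 𝕌 Γ M (z ⊔F x)
        at (yes refl) = closed (≃⇒⇒ (⊔F-assoc z x′ y) ▹ ⇒-⊔ˡ z g)
          (cut-context (fibre-< le onto bigT i) pi homᵢ (cut-context-fibre le Q onto prime bigT i∈ bz (𝕌-resp cofibre-⊇ cofibre-⊆ bx′)) by)
        at (no ne) = closed (≃⇒⇒ (≃-sym (⊔-rot z x′ y)) ▹ ⇒-⊔ˡ z g)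
          (cut-context (cofibre-< le onto j j∈) (part-cofibre p f ne) (hom-⊆ {Γ} (λ _ → ∩₁) hom)
            (cut-module⁺ le (∩∖-part S (fib q j)) (fibre-hom Q j) bz (extend ne by)) bx′)
      canon (inj₁ (u , bu , g)) (inj₁ (y , by , g′)) =
        closed (comp-cut _ P T u y i ℕₚ.≤-refl i∈ (λ t t∈ ne → orth (fibre-< le onto bigT t) (bu t t∈) (extend ne (by t t∈)))
                 ▹ ⇒-⊔ʳ _ g ▹ ⇒-⊔ˡ z (≃⇒⇒ (≃-sym (Comp-neg² P y T)) ▹ g′))
          (cut-context (fibre-< le onto bigT i) pi homᵢ (bu i i∈) (by i i∈))
      canon (inj₂ (j , j∈ , y , v , by , bv , g)) (inj₁ _) = at (j Fin.≟ i)
        where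
        at : Dec (j ≡ i) → 𝕌 Γ M (z ⊔F x)
        at (no ne) = closed (≃⇒⇒ (⊔-rot y x v) ▹ ⇒-⊔ʳ x g)
          (cut-context (cofibre-< le onto j j∈) (part-cofibre p f ne) (hom-⊆ {Γ} (λ _ → ∩₁) hom) by
            (cut-module C<n (∩∖-part C (fib q j)) (hom-neg {Γ} (fibre-hom QC j)) bx (neg²-intro (restrict ne bv))))
        -- First `y` is cut against `x` on the cofibre, which leaves a realizer of the dual of
        -- `C ∩ fib q i`; then this is cut against `v` inside the fibre.
        at (yes refl) = closed (≃⇒⇒ (solve 3 (λ v x y → v ⊕ (x ⊕ y) ⊜ (y ⊕ v) ⊕ x) ≃-refl v x y) ▹ ⇒-⊔ʳ x g)
          (cut-context (fibre-< le onto bigT i) pi homᵢ bv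
            (cut-context C<n (∩∖-part C (fib q i)) (hom-neg {Γ} (fibre-hom QC i)) bx
              (neg²-intro (𝕌-resp cofibre-⊆ cofibre-⊇ by))))
          where open ⊔-Solver using (solve; _⊕_; _⊜_)

  cut-context⁺ : ∀ {Γ S C M z x} → count S ≤ n → Part S C M → Hom Γ S M → 𝕌 Γ S z → 𝕌 (neg Γ) C x → 𝕌 Γ M (z ⊔F x)
  cut-context⁺ {Γ} {S} {C} {M} {z} {x} le p hom bz bx = go (ne? C) (ne? M)
    where
    go : Ne C ⊎ Em C → Ne M ⊎ Em M → 𝕌 Γ M (z ⊔F x)
    go (inj₂ em) _ = closed (⇒-⊔⊢ z (empty-elim em bx)) (𝕌-resp (part-Emˡ p em) (Part.inʳ p) bz)
    go _ (inj₂ em) = empty-intro em (orth⁺ le bz (𝕌-resp (Part.inˡ p) (part-Emʳ p em) bx))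
    go (inj₁ c) (inj₁ m) = attach (attachment Γ C M)
      where
      open Cuts {Γ} {S} {C} {M} le p hom c m
      attach : Attachment Γ C M → 𝕌 Γ M (z ⊔F x)
      attach (none sep) = parᵇ (unfold bz) p c m sep x bx
      attach (all full) = combine (tensorᵇ (unfold bz) p c m full)
        where
        combine : Tensor Γ C M z → 𝕌 Γ M (z ⊔F x)
        combine (y , y′ , by , by′ , f) = closed (⇒-⊔⊢ y′ (orth C<n by bx)
          ▹ ≃⇒⇒ (solve 3 (λ y′ y x → y′ ⊕ (y ⊕ x) ⊜ (y ⊕ y′) ⊕ x) ≃-refl y′ y x) ▹ ⇒-⊔ʳ x f) by′
          where open ⊔-Solver using (solve; _⊕_; _⊜_)
      attach (mixed c₁∈ m₁∈ e₁ c₂∈ m₂∈ e₂) = located (locate p hom c₁∈ m₁∈ e₁ c₂∈ m₂∈ e₂)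
        where
        located : Location Γ S M → 𝕌 Γ M (z ⊔F x)
        located (in-par p′ d e sep s) = cut-context-par p′ d e sep s bz bx
        located (in-tensor p′ d e sep s) = cut-context-tensor p′ d e sep s bz bx
        located (in-fibre Q onto prime bigT i∈ f) = cut-context-prime le p hom c m Q onto prime bigT i∈ f bz bx

  pair-intro : ∀ {Γ S P T q u k l} → count S ≤ n → Quot Γ S P T q → Onto S T q → k ∈ T → l ∈ T → k ≢ l →
    (∀ t → t ∈ T → t ≡ k ⊎ t ≡ l) → (∀ t → t ∈ T → 𝕌 Γ (S ∩ fib q t) (u t)) → 𝕌 Γ S (Comp (neg P) u T)
  pair-intro {Γ} {S} {P} {T} {q} {u} {k} {l} le Q onto k∈ l∈ k≢l only bu = connect _ refl
    where
    K L : Sub (N Γ)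
    K = S ∩ fib q k
    L = S ∩ fib q l
    pt : Part S K L
    pt = part-fibres (into Q) only k≢l
    K<n : count K < n
    K<n = part-<ˡ le pt (fibre-ne onto l l∈)
    L<n : count L < n
    L<n = part-<ʳ le pt (fibre-ne onto k k∈)
    only′ : ∀ t → t ∈ T → t ≡ l ⊎ t ≡ k
    only′ t t∈ = [ inj₂ , inj₁ ]′ (only t t∈)
    -- `u l ⊔F x` is provable, so it can be inserted into `u k` with the attachment of `l`, and `x`
    -- pulled out again.
    absorb : ∀ {k l x} → k ∈ T → l ∈ T → k ≢ l → (∀ t → t ∈ T → t ≡ k ⊎ t ≡ l) → ⊢ u l ⊔F x → u k ⟶ Comp (neg P) u T ⊔F x
    absorb {k} {l} {x} k∈ l∈ k≢l only ⊢l = plugF-provable (u k) (λ _ → edge (neg P) k l) ⊢l ▸ plugF-pull (u k) (λ _ → edge (neg P) k l) (u l) x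
      ▸ ≃⇒⟶ (⊔F-cong (≃-sym (Comp-two (neg P) u k∈ l∈ k≢l only)) ≃-refl)
    connect : ∀ b → edge P k l ≡ b → 𝕌 Γ S (Comp (neg P) u T)
    connect false e = par-intro⁺ le pt (λ v w v∈ w∈ → trans (fibre-edge Q k≢l v w v∈ w∈) e)
      (λ x bx → closed (⟶⇒⇒ (absorb l∈ k∈ (k≢l ∘ sym) only′ (orth K<n (bu k k∈) bx))) (bu l l∈))
      (λ x bx → closed (⟶⇒⇒ (absorb k∈ l∈ k≢l only (orth L<n (bu l l∈) bx))) (bu k k∈))
    connect true e = closed (≃⇒⇒ (≃-sym (≃-trans (Comp-two (neg P) u k∈ l∈ k≢l only)
        (≃-trans (joinF-cong ≃-refl ≃-refl (λ _ _ → sym (trans (edge-neg P k l) (cong not e)))) (≃-sym (⊔F-join (u k) (u l)))))))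
      (tensor-intro pt (fibre-full Q k≢l e) (bu k k∈) (bu l l∈))

  -- The inner induction is on `T`, since dropping a position over an empty fibre, whose component
  -- is provable, leaves `S` as large as before. When all fibres are inhabited, `P` is replaced by
  -- its prime quotient.
  comp-intro′ : ∀ m {Γ S P T q u} → count T < m → count S ≤ n → Quot Γ S P T q → (∀ t → t ∈ T → 𝕌 Γ (S ∩ fib q t) (u t)) →
    𝕌 Γ S (Comp (neg P) u T)
  comp-intro′ (suc m) {Γ} {S} {P} {T} {q} {u} (s≤s lt) le Q bu =
    vacant (Finₚ.any? (λ t → (T t Boolₚ.≟ true) ×-dec ¬? (Finₚ.any? (λ v → (S ∩ fib q t) v Boolₚ.≟ true))))
    where
    Goal : Set₁
    Goal = 𝕌 Γ S (Comp (neg P) u T)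
    vacant : Dec (∃ λ t → t ∈ T × ¬ Ne (S ∩ fib q t)) → Goal
    vacant (yes (t , t∈ , ∄)) =
      closed (⟶⇒⇒ (Comp-drop (neg P) u t∈ (empty-elim (λ v → ¬∈⇒∉ (λ v∈ → ∄ (v , v∈))) (bu t t∈))))
        (comp-intro′ m (remove-< {T = T} {t} lt t∈) le
          (quot (λ v v∈ → ∖⁺ (into Q v v∈) (∉fib⁺ id {t} {q v} (λ e → ∄ (v , ∩⁺ v∈ (fib⁺ q e))))) (resp Q)) (λ s s∈ → bu s (∩₁ s∈)))
    vacant (no occupied) = first (ne? T)
      where
      onto : Onto S T q
      onto t t∈ = inhabit (ne? (S ∩ fib q t))
        where
        inhabit : Ne (S ∩ fib q t) ⊎ Em (S ∩ fib q t) → ∃ λ v → v ∈ S × q v ≡ t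
        inhabit (inj₁ (v , v∈)) = v , ∩₁ v∈ , fib⁻ q {t} {v} (∩₂ {S v} v∈)
        inhabit (inj₂ em) = ⊥-elim (occupied (t , t∈ , no-Ne em))
      first : Ne T ⊎ Em T → Goal
      first (inj₂ em) = empty-intro (λ v → ¬∈⇒∉ (λ v∈ → clash (into Q v v∈) (em (q v)))) (⊢-empty (λ (t , t∈ , _) → clash t∈ (em t)))
      first (inj₁ (k , k∈)) = second (ne? (T - k))
        where
        second : Ne (T - k) ⊎ Em (T - k) → Goal
        second (inj₂ em) = closed (≃⇒⇒ (≃-sym (Comp-single (neg P) u k∈ only)))
          (𝕌-resp (λ _ → ∩₁) (λ v v∈ → ∩⁺ v∈ (fib⁺ q (only (q v) (into Q v v∈)))) (bu k k∈))
          where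
          only : ∀ t → t ∈ T → t ≡ k
          only = only-member em
        second (inj₁ (l , l∈)) = quotient (primeQuotient _ P T ℕₚ.≤-refl (k , l , k∈ , ∩₁ l∈ , (λ e → ∉fib⁻ id {k} {l} (∖₂ {T l} l∈) (sym e))))
          where
          quotient : PrimeQuotient P T → Goal
          quotient (pq T₁ r R₁ onto₁ prime (s , t , s∈ , t∈ , s≢t)) =
            closed (≃⇒⇒ (≃-sym (Comp-assoc u (Quot-neg R₁)))) ([ whole , two ]′ (third? T₁ s∈ t∈ s≢t))
            where
            w : Fin (N P) → FG
            w i = Comp (neg P) u (T ∩ fib r i)
            Q₁ : Quot Γ S P T₁ (r ∘ q)
            Q₁ = Quot-∘ Q R₁
            onto₂ : Onto S T₁ (r ∘ q)
            onto₂ i i∈ = let (j , j∈ , e) = onto₁ i i∈ ; (v , v∈ , e′) = onto j j∈ in v , v∈ , trans (cong r e′) e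
            bw : ∀ i → i ∈ T₁ → 𝕌 Γ (S ∩ fib (r ∘ q) i) (w i)
            bw i i∈ = comp-intro′ m
              (part-<ʳ lt (∩∖-part T (fib r i)) (elsewhere onto₁ s∈ t∈ s≢t i))
              (ℕₚ.≤-trans (count-≤ {S = S ∩ fib (r ∘ q) i} {T = S} (λ _ → ∩₁)) le)
              (quot (λ v v∈ → ∩⁺ (into Q v (∩₁ v∈)) (fib⁺ r (fib⁻ (r ∘ q) {i} {v} (∩₂ {S v} v∈)))) (λ v x v∈ x∈ → resp Q v x (∩₁ v∈) (∩₁ x∈)))
              (λ j j∈ → 𝕌-resp
                (∩-≐ (λ v v∈ vS → ∩⁺ vS (fib⁺ (r ∘ q) (trans (cong r (fib⁻ q {j} {v} v∈)) (fib⁻ r {i} {j} (∩₂ {T j} j∈))))))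
                (∩-≐ {S = S ∩ fib (r ∘ q) i} {S′ = S} (λ v _ → ∩₁)) (bu j (∩₁ j∈)))
            whole : Big T₁ → 𝕌 Γ S (Comp (neg P) w T₁)
            whole bigT = prime-intro Q₁ onto₂ prime bigT bw
            two : (∀ i → i ∈ T₁ → i ≡ s ⊎ i ≡ t) → 𝕌 Γ S (Comp (neg P) w T₁)
            two only = pair-intro le Q₁ onto₂ s∈ t∈ s≢t only bw

  next : Core (suc n)
  next = record
    { orth = λ lt → orth⁺ (ℕₚ.≤-pred lt) ; par-intro = λ lt → par-intro⁺ (ℕₚ.≤-pred lt) ; plug-intro = λ lt → plug-intro⁺ (ℕₚ.≤-pred lt)
    ; cut-module = λ lt → cut-module⁺ (ℕₚ.≤-pred lt) ; cut-context = λ lt → cut-context⁺ (ℕₚ.≤-pred lt)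
    ; comp-intro = λ lt → comp-intro′ _ ℕₚ.≤-refl (ℕₚ.≤-pred lt) }

core : ∀ n → Core n
core zero = record { orth = λ () ; par-intro = λ () ; plug-intro = λ () ; cut-module = λ () ; cut-context = λ () ; comp-intro = λ () }
core (suc n) = Induction.next n (core n)

-- Functoriality in the components of a quotient

orth : ∀ {Γ S z x} → 𝕌 Γ S z → 𝕌 (neg Γ) S x → ⊢ z ⊔F x
orth = Core.orth (core _) ℕₚ.≤-refl

par-intro : ∀ {Γ S A B z} → Part S A B → NoEdge Γ A B → (∀ x → 𝕌 (neg Γ) A x → 𝕌 Γ B (z ⊔F x)) →
  (∀ x → 𝕌 (neg Γ) B x → 𝕌 Γ A (z ⊔F x)) → 𝕌 Γ S z
par-intro = Core.par-intro (core _) ℕₚ.≤-refl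

par-elim : ∀ {Γ S A B z x} → Part S A B → NoEdge Γ A B → 𝕌 Γ S z → 𝕌 (neg Γ) A x → 𝕌 Γ B (z ⊔F x)
par-elim = Induction.par-elim _ (core _) ℕₚ.≤-refl

plug-intro : ∀ {Γ S C M z u} → Part S C M → Hom Γ S M → 𝕌 Γ C z → 𝕌 Γ M u → 𝕌 Γ S (z ⊔F u)
plug-intro = Core.plug-intro (core _) ℕₚ.≤-refl

cut-module : ∀ {Γ S C M z x} → Part S C M → Hom Γ S M → 𝕌 Γ S z → 𝕌 (neg Γ) M x → 𝕌 Γ C (z ⊔F x)
cut-module = Core.cut-module (core _) ℕₚ.≤-refl

cut-context : ∀ {Γ S C M z x} → Part S C M → Hom Γ S M → 𝕌 Γ S z → 𝕌 (neg Γ) C x → 𝕌 Γ M (z ⊔F x)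
cut-context = Core.cut-context (core _) ℕₚ.≤-refl

comp-intro : ∀ {Γ S P T q u} → Quot Γ S P T q → (∀ t → t ∈ T → 𝕌 Γ (S ∩ fib q t) (u t)) → 𝕌 Γ S (Comp (neg P) u T)
comp-intro = Core.comp-intro (core _) ℕₚ.≤-refl

infix 4 _∣_≤_∣_
-- The inclusions are paired because the par clause consumes realizers of the dual: to pass `up`
-- through a par of two components one needs `down` for one of them and `up` for the other.
record _∣_≤_∣_ (Γ : PG) (S : Sub (N Γ)) (Γ′ : PG) (S′ : Sub (N Γ′)) : Set₁ where
  no-eta-equality
  pattern
  constructor le
  field
    up   : ∀ z → 𝕌 Γ S z → 𝕌 Γ′ S′ z
    down : ∀ z → 𝕌 (neg Γ′) S′ z → 𝕌 (neg Γ) S z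
open _∣_≤_∣_

≤-trans : ∀ {Γ S Δ T Ε U} → Γ ∣ S ≤ Δ ∣ T → Δ ∣ T ≤ Ε ∣ U → Γ ∣ S ≤ Ε ∣ U
≤-trans f g = le (λ z b → up g z (up f z b)) (λ z b → down f z (down g z b))

≤-neg : ∀ {Γ S Δ T} → Γ ∣ S ≤ Δ ∣ T → neg Δ ∣ T ≤ neg Γ ∣ S
≤-neg f = le (down f) (λ z b → neg²-intro (up f z (neg²-elim b)))

≤-neg⁻ : ∀ {Γ S Δ T} → neg Δ ∣ T ≤ neg Γ ∣ S → Γ ∣ S ≤ Δ ∣ T
≤-neg⁻ f = le (λ z b → neg²-elim (down f z (neg²-intro b))) (up f)

≤-≐ : ∀ {Γ} {S S′ : Sub (N Γ)} → S ⊆ S′ → S′ ⊆ S → Γ ∣ S ≤ Γ ∣ S′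
≤-≐ f g = le (λ _ → 𝕌-resp f g) (λ _ → 𝕌-resp g f)

unit : ∀ {Γ} {S : Sub (N Γ)} → Em S → 𝕌 Γ S emptyF
unit em = empty-intro em (≃⇒⟶ ≃-refl)

-- Only the inclusion `up` is derived in this module; `down` is obtained from a second instance,
-- taken at the duals with source and target exchanged.
module Functor {Γ : PG} {S : Sub (N Γ)} {Γ′ : PG} {S′ : Sub (N Γ′)} {P : PG} {T : Sub (N P)}
               {q : Fin (N Γ) → Fin (N P)} {q′ : Fin (N Γ′) → Fin (N P)} (Q : Quot Γ S P T q) (Q′ : Quot Γ′ S′ P T q′)
               (fibre : ∀ t → t ∈ T → Γ ∣ S ∩ fib q t ≤ Γ′ ∣ S′ ∩ fib q′ t) where

  binary : ∀ {s t} → s ∈ T → t ∈ T → s ≢ t → (∀ i → i ∈ T → i ≡ s ⊎ i ≡ t) → ∀ z → 𝕌 Γ S z → 𝕌 Γ′ S′ z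
  binary {s} {t} s∈ t∈ s≢t only z bz = connect _ refl
    where
    p : Part S (S ∩ fib q s) (S ∩ fib q t)
    p = part-fibres (into Q) only s≢t
    p′ : Part S′ (S′ ∩ fib q′ s) (S′ ∩ fib q′ t)
    p′ = part-fibres (into Q′) only s≢t
    connect : ∀ b → edge P s t ≡ b → 𝕌 Γ′ S′ z
    connect false e = par-intro p′ (λ v w v∈ w∈ → trans (fibre-edge Q′ s≢t v w v∈ w∈) e)
      (λ x bx → up (fibre t t∈) _ (par-elim p sep bz (down (fibre s s∈) x bx)))
      (λ x bx → up (fibre s s∈) _ (par-elim (part-swap p) (noEdge-sym {Γ} sep) bz (down (fibre t t∈) x bx)))
      where
      sep : NoEdge Γ (S ∩ fib q s) (S ∩ fib q t)
      sep v w v∈ w∈ = trans (fibre-edge Q s≢t v w v∈ w∈) e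
    connect true e = combine (tensor-elim p (fibre-full Q s≢t e) bz)
      where
      combine : Tensor Γ (S ∩ fib q s) (S ∩ fib q t) z → 𝕌 Γ′ S′ z
      combine (x , y , bx , by , f) = closed f (tensor-intro p′ (fibre-full Q′ s≢t e)
        (up (fibre s s∈) x bx) (up (fibre t t∈) y by))

  many : PrimeS P T → Big T → (∀ t → t ∈ T → Γ ∣ S ∖ fib q t ≤ Γ′ ∣ S′ ∖ fib q′ t) → ∀ z → 𝕌 Γ S z → 𝕌 Γ′ S′ z
  many prime bigT cofibre z bz =
    left (Finₚ.any? λ t → (T t Boolₚ.≟ true) ×-dec ¬? (Finₚ.any? λ v → (S ∩ fib q t) v Boolₚ.≟ true))
         (Finₚ.any? λ t → (T t Boolₚ.≟ true) ×-dec ¬? (Finₚ.any? λ v → (S′ ∩ fib q′ t) v Boolₚ.≟ true))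
    where
    em : ∀ {n} {X : Sub n} → ¬ Ne X → Em X
    em ∄ v = ¬∈⇒∉ (λ v∈ → ∄ (v , v∈))
    canon : Canon 𝕌 Γ S P T q z → 𝕌 Γ′ S′ z
    canon (inj₁ (u , bu , f)) = closed f (comp-intro Q′ (λ t t∈ → up (fibre t t∈) (u t) (bu t t∈)))
    canon (inj₂ (i , i∈ , y , u , by , bu , f)) =
      closed f (plug-intro (∩∖-part S′ (fib q′ i)) (fibre-hom Q′ i) (up (cofibre i i∈) y by) (up (fibre i i∈) u bu))
    onto : ∀ {n} {X : Sub n} {r} → ¬ (∃ λ t → t ∈ T × ¬ Ne (X ∩ fib r t)) → Onto X T r
    onto {X = X} {r} occupied t t∈ = [ (λ (v , v∈) → v , ∩₁ v∈ , fib⁻ r {t} {v} (∩₂ {X v} v∈)) , (λ e → ⊥-elim (occupied (t , t∈ , no-Ne e))) ]′ (ne? (X ∩ fib r t))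
    left : Dec (∃ λ t → t ∈ T × ¬ Ne (S ∩ fib q t)) → Dec (∃ λ t → t ∈ T × ¬ Ne (S′ ∩ fib q′ t)) → 𝕌 Γ′ S′ z
    -- An empty fibre of `S` excludes canonical form. But then `S` is its own cofibre, and the empty
    -- graph supplies the realizer of the fibre of `S′`.
    left (yes (t , t∈ , ∄)) _ = closed (≃⇒⇒ (⊔F-identityʳ z)) (plug-intro (∩∖-part S′ (fib q′ t)) (fibre-hom Q′ t)
      (up (cofibre t t∈) z (𝕌-resp (part-Emʳ (∩∖-part S (fib q t)) (em ∄)) (λ v → ∩₁) bz))
      (up (fibre t t∈) emptyF (unit (em ∄))))
    -- The fibre of `S′` vanishes. The empty graph realizes its dual, hence by `down` the dual of
    -- the fibre of `S`, which can therefore be cut off.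
    left (no _) (yes (t , t∈ , ∄)) = closed (≃⇒⇒ (⊔F-identityʳ z)) (𝕌-resp (λ v → ∩₁) (part-Emʳ (∩∖-part S′ (fib q′ t)) (em ∄))
      (up (cofibre t t∈) _ (cut-module (∩∖-part S (fib q t)) (fibre-hom Q t) bz (down (fibre t t∈) emptyF (unit (em ∄))))))
    left (no occ) (no occ′) = canon (primeᵇ (unfold bz) Q (onto occ) prime bigT)

-- Over the prime quotient of `P`, the second alternative of `Canon` asks for a comparison of
-- cofibres besides fibres. Both belong to fewer positions of `P`, so `sub` obtains them by
-- induction.
functor′ : ∀ m {Γ S Γ′ S′ P T q q′} → count T < m → Quot Γ S P T q → Quot Γ′ S′ P T q′ →
  (∀ t → t ∈ T → Γ ∣ S ∩ fib q t ≤ Γ′ ∣ S′ ∩ fib q′ t) → Γ ∣ S ≤ Γ′ ∣ S′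
functor′ (suc m) {Γ} {S} {Γ′} {S′} {P} {T} {q} {q′} (s≤s lt) Q Q′ fibre = first (ne? T)
  where
  Goal : Set₁
  Goal = Γ ∣ S ≤ Γ′ ∣ S′
  first : Ne T ⊎ Em T → Goal
  first (inj₂ em) = le (λ z b → empty-intro em′ (empty-elim emS b)) (λ z b → empty-intro emS (empty-elim em′ b))
    where
    emS : Em S
    emS v = ¬∈⇒∉ (λ v∈ → clash (into Q v v∈) (em (q v)))
    em′ : Em S′
    em′ v = ¬∈⇒∉ (λ v∈ → clash (into Q′ v v∈) (em (q′ v)))
  first (inj₁ (k , k∈)) = second (ne? (T - k))
    where
    second : Ne (T - k) ⊎ Em (T - k) → Goal
    second (inj₂ em) = ≤-trans (≤-≐ (λ v v∈ → ∩⁺ v∈ (fib⁺ q (only (q v) (into Q v v∈)))) (λ v → ∩₁))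
      (≤-trans (fibre k k∈) (≤-≐ (λ v → ∩₁) (λ v v∈ → ∩⁺ v∈ (fib⁺ q′ (only (q′ v) (into Q′ v v∈))))))
      where
      only : ∀ t → t ∈ T → t ≡ k
      only = only-member em
    second (inj₁ (l , l∈)) = quotient (primeQuotient _ P T ℕₚ.≤-refl (k , l , k∈ , ∩₁ l∈ , (λ e → ∉fib⁻ id {k} {l} (∖₂ {T l} l∈) (sym e))))
      where
      quotient : PrimeQuotient P T → Goal
      quotient (pq T₁ r R₁ onto₁ prime (s , t , s∈ , t∈ , s≢t)) =
        [ (λ bigT → le (F.many prime bigT cofibre₁) (F⁻.many (primeS-neg {P} prime) bigT (λ i i∈ → ≤-neg (cofibre₁ i i∈))))
        , (λ only → le (F.binary s∈ t∈ s≢t only) (F⁻.binary s∈ t∈ s≢t only)) ]′ (third? T₁ s∈ t∈ s≢t)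
        where
        Q₁ : Quot Γ S P T₁ (r ∘ q)
        Q₁ = Quot-∘ Q R₁
        Q₁′ : Quot Γ′ S′ P T₁ (r ∘ q′)
        Q₁′ = Quot-∘ Q′ R₁
        sub : ∀ (X : Sub (N P)) → count (T ∩ X) < m → Γ ∣ S ∩ (X ∘ q) ≤ Γ′ ∣ S′ ∩ (X ∘ q′)
        sub X small = functor′ m small (shrink Q) (shrink Q′) λ t t∈ →
          ≤-trans (≤-≐ (∩-≐ {S = S ∩ (X ∘ q)} {S′ = S} (λ v _ → ∩₁)) (∩-≐ (λ v v∈ vS → ∩⁺ vS (trans (cong X (fib⁻ q {t} {v} v∈)) (∩₂ {T t} t∈)))))
            (≤-trans (fibre t (∩₁ t∈))
              (≤-≐ (∩-≐ (λ v v∈ vS → ∩⁺ vS (trans (cong X (fib⁻ q′ {t} {v} v∈)) (∩₂ {T t} t∈)))) (∩-≐ {S = S′ ∩ (X ∘ q′)} {S′ = S′} (λ v _ → ∩₁))))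
          where
          shrink : ∀ {Δ D p} → Quot Δ D P T p → Quot Δ (D ∩ (X ∘ p)) P (T ∩ X) p
          shrink {Δ} {D} {p} R = quot (λ v v∈ → ∩⁺ (into R v (∩₁ v∈)) (∩₂ {D v} v∈)) (λ v w v∈ w∈ → resp R v w (∩₁ v∈) (∩₁ w∈))
        fibre₁ : ∀ i → i ∈ T₁ → Γ ∣ S ∩ fib (r ∘ q) i ≤ Γ′ ∣ S′ ∩ fib (r ∘ q′) i
        fibre₁ i i∈ = sub (fib r i) (part-<ʳ lt (∩∖-part T (fib r i)) (elsewhere onto₁ s∈ t∈ s≢t i))
        cofibre₁ : ∀ i → i ∈ T₁ → Γ ∣ S ∖ fib (r ∘ q) i ≤ Γ′ ∣ S′ ∖ fib (r ∘ q′) i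
        cofibre₁ i i∈ = sub (not ∘ fib r i) (cofibre-< lt onto₁ i i∈)
        module F = Functor Q₁ Q₁′ fibre₁
        module F⁻ = Functor (Quot-neg Q₁′) (Quot-neg Q₁) (λ i i∈ → ≤-neg (fibre₁ i i∈))

functor : ∀ {Γ S Γ′ S′ P T q q′} → Quot Γ S P T q → Quot Γ′ S′ P T q′ →
  (∀ t → t ∈ T → Γ ∣ S ∩ fib q t ≤ Γ′ ∣ S′ ∩ fib q′ t) → Γ ∣ S ≤ Γ′ ∣ S′
functor = functor′ _ ℕₚ.≤-refl

single-intro : ∀ {Γ S z} v → v ∈ S → (∀ w → w ∈ S → w ≡ v) → atomF (dualAtom (plab Γ v)) ⇒ z → 𝕌 Γ S z
single-intro {Γ} {S} {z} v v∈ only f = fold (body (λ em → clash v∈ (em v)) (λ w w∈ _ → atoms w w∈)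
  (λ p d e → ⊥-elim (part≢single p d e v only)) (λ p d e → ⊥-elim (part≢single p d e v only))
  (λ {P} {T} {q} Q onto _ bigT → ⊥-elim (part≢single (∩∖-part S (fib q (Big.a bigT)))
     (cofibre-ne onto bigT (Big.a bigT)) (fibre-ne onto (Big.a bigT) (Big.a∈ bigT)) v only)))
  where
  atoms : ∀ w → w ∈ S → atomF (dualAtom (plab Γ w)) ⇒ z
  atoms w w∈ with only w w∈
  ... | refl = f

single-≤ : ∀ {Γ S Γ′ S′} v v′ → v ∈ S → (∀ w → w ∈ S → w ≡ v) → v′ ∈ S′ → (∀ w → w ∈ S′ → w ≡ v′) → plab Γ v ≡ plab Γ′ v′ → Γ ∣ S ≤ Γ′ ∣ S′
single-≤ {Γ} {S} {Γ′} {S′} v v′ v∈ only v′∈ only′ e = le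
  (λ z b → single-intro v′ v′∈ only′ (≃⇒⇒ (≡⇒≃ (cong (atomF ∘ dualAtom) (sym e))) ▹ atomᵇ (unfold b) v v∈ only))
  (λ z b → single-intro v v∈ only (≃⇒⇒ (≡⇒≃ (cong (atomF ∘ dualAtom) (trans (plab-neg Γ v) (trans (cong dualAtom e) (sym (plab-neg Γ′ v′))))))
     ▹ atomᵇ (unfold b) v′ v′∈ only′))

record Relabel (Γ : PG) (S : Sub (N Γ)) (Γ′ : PG) (S′ : Sub (N Γ′)) (g : Fin (N Γ) → Fin (N Γ′)) : Set where
  constructor relabel
  field
    quotient  : Quot Γ S Γ′ S′ g
    onto      : Onto S S′ g
    injective : ∀ v w → v ∈ S → w ∈ S → g v ≡ g w → v ≡ w
    label     : ∀ v → v ∈ S → plab Γ v ≡ plab Γ′ (g v)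

-- An isomorphism is a quotient map with one-vertex fibres, so invariance is a case of `functor`.
relabel-≤ : ∀ {Γ S Γ′ S′ g} → Relabel Γ S Γ′ S′ g → Γ ∣ S ≤ Γ′ ∣ S′
relabel-≤ {Γ} {S} {Γ′} {S′} {g} (relabel Q onto inj lab) = functor Q (Quot-id Γ′ S′) λ t t∈ → at t t∈ (onto t t∈)
  where
  at : ∀ t → t ∈ S′ → (∃ λ v → v ∈ S × g v ≡ t) → Γ ∣ S ∩ fib g t ≤ Γ′ ∣ S′ ∩ fib id t
  at t t∈ (v , v∈ , refl) = single-≤ v (g v) (∩⁺ v∈ (fib⁺ g refl)) (λ w w∈ → inj w v (∩₁ w∈) v∈ (fib⁻ g {g v} {w} (∩₂ {S w} w∈)))
    (∩⁺ t∈ (fib⁺ id {g v} {g v} refl)) (λ w w∈ → fib⁻ id {g v} {w} (∩₂ {S′ w} w∈)) (lab v v∈)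

relabel-≥ : ∀ {Γ S Γ′ S′ g} → Relabel Γ S Γ′ S′ g → Γ′ ∣ S′ ≤ Γ ∣ S
relabel-≥ {Γ} {S} {Γ′} {S′} {g} (relabel Q onto inj lab) = functor (Quot-id Γ′ S′) Q λ t t∈ → at t t∈ (onto t t∈)
  where
  at : ∀ t → t ∈ S′ → (∃ λ v → v ∈ S × g v ≡ t) → Γ′ ∣ S′ ∩ fib id t ≤ Γ ∣ S ∩ fib g t
  at t t∈ (v , v∈ , refl) = single-≤ (g v) v (∩⁺ t∈ (fib⁺ id {g v} {g v} refl)) (λ w w∈ → fib⁻ id {g v} {w} (∩₂ {S′ w} w∈))
    (∩⁺ v∈ (fib⁺ g refl)) (λ w w∈ → inj w v (∩₁ w∈) v∈ (fib⁻ g {g v} {w} (∩₂ {S w} w∈))) (sym (lab v v∈))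

-- Soundness of the rules

at : (K : FG) → Fin (size (enc K)) → V K
at K = from (enum (fin K))

ix : (K : FG) → V K → Fin (size (enc K))
ix K = to (enum (fin K))

at-ix : ∀ K x → at K (ix K x) ≡ x
at-ix K = strictlyInverseʳ (enum (fin K))

ix-at : ∀ K v → ix K (at K v) ≡ v
ix-at K = strictlyInverseˡ (enum (fin K))

pre : (K : FG) → (V K → Bool) → Sub (size (enc K))
pre K p v = p (at K v)

full : ∀ {n} → Sub n
full _ = true

edgeF : (K : FG) → Bool → V K → V K → Bool
edgeF K b x y = sgn b (adjF K x y)

labᵇ : (K : FG) → Bool → V K → Atom
labᵇ K b x = if b then labF K x else dualAtom (labF K x)

relabelF : ∀ K b (p : V K → Bool) L c (p′ : V L → Bool) (g : V K → V L) →
  (∀ x → p x ≡ true → p′ (g x) ≡ true) →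
  (∀ x y → p x ≡ true → p y ≡ true → x ≢ y → edgeF K b x y ≡ edgeF L c (g x) (g y)) →
  (∀ y → p′ y ≡ true → ∃ λ x → p x ≡ true × g x ≡ y) →
  (∀ x y → p x ≡ true → p y ≡ true → g x ≡ g y → x ≡ y) →
  (∀ x → p x ≡ true → labᵇ K b x ≡ labᵇ L c (g x)) →
  Relabel (enc K ⁺⁻ b) (pre K p) (enc L ⁺⁻ c) (pre L p′) (λ v → ix L (g (at K v)))
relabelF K b p L c p′ g pg eg og ig lg = relabel
  (quot (λ v v∈ → trans (cong p′ (at-ix L _)) (pg _ v∈))
    (λ v w v∈ w∈ ne → trans (eg _ _ v∈ w∈ (λ e → ne (cong (λ x → ix L (g x)) e))) (cong₂ (edgeF L c) (sym (at-ix L _)) (sym (at-ix L _)))))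
  (λ t t∈ → let (x , px , e) = og (at L t) t∈ in
    ix K x , trans (cong p (at-ix K x)) px , trans (cong (λ x → ix L (g x)) (at-ix K x)) (trans (cong (ix L) e) (ix-at L t)))
  (λ v w v∈ w∈ e → trans (sym (ix-at K v)) (trans (cong (ix K) (ig _ _ v∈ w∈ (trans (sym (at-ix L _)) (trans (cong (at L) e) (at-ix L _))))) (ix-at K w)))
  (λ v v∈ → trans (lg _ v∈) (cong (labᵇ L c) (sym (at-ix L _))))

≃⇒≤ : ∀ {K L} b → K ≃ L → enc K ⁺⁻ b ∣ full ≤ enc L ⁺⁻ b ∣ full
≃⇒≤ {K} {L} b f = relabel-≤ (relabelF K b (λ _ → true) L b (λ _ → true) (to (bij f)) (λ _ _ → refl)
  (λ x y _ _ _ → cong (sgn b) (sym (adj-eq f x y))) (λ y _ → from (bij f) y , refl , strictlyInverseˡ (bij f) y)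
  (λ x y _ _ e → trans (sym (strictlyInverseʳ (bij f) x)) (trans (cong (from (bij f)) e) (strictlyInverseʳ (bij f) y)))
  (λ x _ → cong (λ a → if b then a else dualAtom a) (sym (lab-eq f x))))

same-≤ : ∀ K L b (p : V K → Bool) (g : V K → V L) (p′ : V L → Bool) → (∀ x → p′ (g x) ≡ p x) →
  (∀ y → ∃ λ x → g x ≡ y) → (∀ x y → g x ≡ g y → x ≡ y) → (∀ x → labF L (g x) ≡ labF K x) →
  (∀ x y → p x ≡ true → p y ≡ true → adjF K x y ≡ adjF L (g x) (g y)) →
  enc K ⁺⁻ b ∣ pre K p ≤ enc L ⁺⁻ b ∣ pre L p′
same-≤ K L b p g p′ pg og ig lg eg = relabel-≤ (relabelF K b p L b p′ g (λ x px → trans (pg x) px)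
  (λ x y px py _ → cong (sgn b) (eg x y px py)) (λ y py → let (x , e) = og y in x , trans (sym (pg x)) (trans (cong p′ e) py) , e)
  (λ x y _ _ → ig x y) (λ x _ → cong (λ a → if b then a else dualAtom a) (sym (lg x))))

-- The common core of the two switch rules: `up` amounts to a cut on the context and a cut on the
-- module, `down` to `plug-intro` in the dual.
switch : ∀ {Γ S C M Γ′ S′ C′ M′} → Part S C M → Hom Γ S M → Part S′ C′ M′ → NoEdge Γ′ C′ M′ →
  Γ ∣ C ≤ Γ′ ∣ C′ → Γ ∣ M ≤ Γ′ ∣ M′ → Γ ∣ S ≤ Γ′ ∣ S′
switch {Γ} {S} {C} {M} {Γ′} {S′} {C′} {M′} p hom p′ sep fC fM = le
  (λ z bz → par-intro p′ sep (λ x bx → up fM _ (cut-context p hom bz (down fC x bx))) (λ x bx → up fC _ (cut-module p hom bz (down fM x bx))))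
  (λ x bx → combine (tensor-elim p′ (noEdge-neg {Γ′} sep) bx))
  where
  combine : ∀ {x} → Tensor (neg Γ′) C′ M′ x → 𝕌 (neg Γ) S x
  combine (y , y′ , by , by′ , f) = closed f (plug-intro p (hom-neg {Γ} hom) (down fC y by) (down fM y′ by′))

-- From E ⊗ X ⊑ B to X ⊑ Ē ⊔ B.
residuate : ∀ {Ξ X Ω S₀ A₀ X₀ Υ S A B} → Part S₀ A₀ X₀ → NoEdge (neg Ω) A₀ X₀ → Part S A B → NoEdge Υ A B →
  neg Υ ∣ A ≤ Ω ∣ A₀ → Ξ ∣ X ≤ Ω ∣ X₀ → Ω ∣ S₀ ≤ Υ ∣ B → Ξ ∣ X ≤ Υ ∣ S
residuate {Ξ} {X} {Ω} {S₀} {A₀} {X₀} {Υ} {S} {A} {B} p₀ full₀ p sep fA fX f = le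
  (λ z bz → par-intro p sep
    (λ x bx → closed (≃⇒⇒ (⊔-comm x z)) (up f _ (tensor-intro p₀ full₀ (up fA x bx) (up fX z bz))))
    (λ x bx → closed (≃⇒⇒ (⊔-comm x z)) (neg²-elim (down fA _ (par-elim (part-swap p₀) (noEdge-sym {neg Ω} full₀) (down f x bx) (neg²-intro (up fX z bz)))))))
  (λ x bx → combine (tensor-elim p (noEdge-neg {Υ} sep) bx))
  where
  combine : ∀ {x} → Tensor (neg Υ) A B x → 𝕌 (neg Ξ) X x
  combine (y , y′ , by , by′ , g) = closed (≃⇒⇒ (⊔-comm y′ y) ▹ g)
    (down fX _ (par-elim p₀ full₀ (down f y′ by′) (neg²-intro (up fA y by))))

-- M̄ ⊗ (M ⊔ N) ⊑ N.
evaluate : ∀ {Γ F A W M Δ Υ B} → Part F A W → NoEdge (neg Γ) A W → Part W M Δ → NoEdge Γ M Δ →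
  Γ ∣ A ≤ neg Γ ∣ M → Γ ∣ Δ ≤ Υ ∣ B → Γ ∣ F ≤ Υ ∣ B
evaluate {Γ} {F} {A} {W} {M} {Δ} {Υ} {B} p full₀ p′ sep fA fB = le
  (λ z bz → combine (tensor-elim p full₀ bz))
  (λ y by → par-intro p full₀
    (λ x bx → closed (≃⇒⇒ (⊔-comm x y)) (tensor-intro p′ (noEdge-neg {Γ} sep) (up fA x (neg²-elim bx)) (down fB y by)))
    (λ x bx → closed (≃⇒⇒ (⊔-comm x y)) (down fA _ (neg²-intro (par-elim (part-swap p′) (noEdge-sym {Γ} sep) (neg²-elim bx) (down fB y by))))))
  where
  combine : ∀ {z} → Tensor Γ A W z → 𝕌 Υ B z
  combine (y , y′ , by , by′ , g) = closed (≃⇒⇒ (⊔-comm y′ y) ▹ g) (up fB _ (par-elim p′ sep by′ (up fA y by)))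

part-pre : ∀ K (p : V K → Bool) → Part full (pre K (not ∘ p)) (pre K p)
part-pre K p = part (λ v _ → side (p (at K v)) refl) (λ _ _ → refl) (λ _ _ → refl)
  (λ v a b → clash b (trans (sym (Boolₚ.not-involutive _)) (cong not a)))
  where
  side : ∀ {c} b → c ≡ b → not c ≡ true ⊎ c ≡ true
  side true  e = inj₂ e
  side false e = inj₁ (cong not e)

isRight : ∀ {A B : Set} → A ⊎ B → Bool
isRight (inj₁ _) = false
isRight (inj₂ _) = true

module _ (B A : FG) (att : V B → Bool) (b : Bool) where

  -- For `b = true` this is `ss↓`. For `b = false` the join on the right is a tensor, both graphs
  -- are read as their duals, and `down` becomes `ss↑`.
  join-switch : enc (plugF B att A) ⁺⁻ b ∣ full ≤ enc (joinF B A (λ _ _ → sgn b false)) ⁺⁻ b ∣ full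
  join-switch = switch (part-pre K isRight) (λ v x y _ v∉ _ x∈ _ y∈ → cong (sgn b) (hom (at K v) (at K x) (at K y) v∉ x∈ y∈))
    (part-pre L isRight) (λ v w v∈ w∈ → sep (at L v) (at L w) v∈ w∈) (side (not ∘ isRight) ok-left) (side isRight ok-right)
    where
    K L : FG
    K = plugF B att A
    L = joinF B A (λ _ _ → sgn b false)
    hom : ∀ v x y → isRight v ≡ false → isRight x ≡ true → isRight y ≡ true → adjF K v x ≡ adjF K v y
    hom (inj₁ v) (inj₂ x) (inj₂ y) _ _ _ = refl
    sep : ∀ v w → not (isRight v) ≡ true → isRight w ≡ true → edgeF L b v w ≡ false
    sep (inj₁ v) (inj₂ w) _ _ = sgn-sgn b
      where
      sgn-sgn : ∀ b → sgn b (sgn b false) ≡ false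
      sgn-sgn true = refl
      sgn-sgn false = refl
    side : ∀ p → (∀ x y → p x ≡ true → p y ≡ true → adjF K x y ≡ adjF L x y) → enc K ⁺⁻ b ∣ pre K p ≤ enc L ⁺⁻ b ∣ pre L p
    side p ok = same-≤ K L b p id p (λ _ → refl) (λ y → y , refl) (λ _ _ e → e) (λ _ → refl) ok
    ok-left : ∀ x y → not (isRight x) ≡ true → not (isRight y) ≡ true → adjF K x y ≡ adjF L x y
    ok-left (inj₁ x) (inj₁ y) _ _ = refl
    ok-right : ∀ x y → isRight x ≡ true → isRight y ≡ true → adjF K x y ≡ adjF L x y
    ok-right (inj₂ x) (inj₂ y) _ _ = refl

infix 4 _⊑_
_⊑_ : FG → FG → Set₁
K ⊑ L = enc K ⁺⁻ true ∣ full ≤ enc L ⁺⁻ true ∣ full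

enc-adj : ∀ K x y → adj (enc K) (ix K x) (ix K y) ≡ adjF K x y
enc-adj K x y = cong₂ (adjF K) (at-ix K x) (at-ix K y)

module _ (C : FG) (att : V C → Bool) {X Y : FG} (X⊑Y : X ⊑ Y) where

  private
    I : FG
    I = plugF C att (atomF (0 , true))
    collapse : ∀ {Z} → V (plugF C att Z) → V I
    collapse (inj₁ c) = inj₁ c
    collapse (inj₂ _) = inj₂ zero
    q̂ : ∀ Z → Fin (size (enc (plugF C att Z))) → Fin (size (enc I))
    q̂ Z v = ix I (collapse {Z} (at (plugF C att Z) v))
    Q : ∀ Z → Quot (enc (plugF C att Z) ⁺⁻ true) full (enc I ⁺⁻ true) full (q̂ Z)
    Q Z = quot (λ _ _ → refl) λ v w _ _ ne →
      trans (edges (at (plugF C att Z) v) (at (plugF C att Z) w) (λ e → ne (cong (ix I) e))) (sym (enc-adj I (collapse {Z} (at (plugF C att Z) v)) (collapse {Z} (at (plugF C att Z) w))))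
      where
      edges : ∀ x y → collapse {Z} x ≢ collapse {Z} y → adjF (plugF C att Z) x y ≡ adjF I (collapse {Z} x) (collapse {Z} y)
      edges (inj₁ _) (inj₁ _) ne = refl
      edges (inj₁ _) (inj₂ _) ne = refl
      edges (inj₂ _) (inj₁ _) ne = refl
      edges (inj₂ _) (inj₂ _) ne = ⊥-elim (ne refl)
    over : ∀ Z → V I → V (plugF C att Z) → Bool
    over Z i x = does (ix I (collapse {Z} x) Fin.≟ ix I i)
    over⁻ : ∀ Z i x → over Z i x ≡ true → collapse {Z} x ≡ i
    over⁻ Z i x e with ix I (collapse {Z} x) Fin.≟ ix I i
    ... | yes e′ = trans (sym (at-ix I _)) (trans (cong (at I) e′) (at-ix I i))
    over⁻ Z i x () | no _
    over⁺ : ∀ Z i x → collapse {Z} x ≡ i → over Z i x ≡ true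
    over⁺ Z i x e = dec-true (_ Fin.≟ _) (cong (ix I) e)
    content : ∀ Z → Relabel (enc Z ⁺⁻ true) full (enc (plugF C att Z) ⁺⁻ true) (pre (plugF C att Z) (over Z (inj₂ zero))) _
    content Z = relabelF Z true (λ _ → true) (plugF C att Z) true (over Z (inj₂ zero)) inj₂ (λ x _ → over⁺ Z (inj₂ zero) (inj₂ x) refl)
      (λ _ _ _ _ _ → refl) onto (λ { x .x _ _ refl → refl }) (λ _ _ → refl)
      where
      onto : ∀ y → over Z (inj₂ zero) y ≡ true → ∃ λ x → true ≡ true × inj₂ x ≡ y
      onto (inj₂ x) _ = x , refl , refl
      onto (inj₁ c) e with over⁻ Z (inj₂ zero) (inj₁ c) e
      ... | ()
    fibre : ∀ i → enc (plugF C att X) ⁺⁻ true ∣ pre (plugF C att X) (over X i) ≤ enc (plugF C att Y) ⁺⁻ true ∣ pre (plugF C att Y) (over Y i)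
    fibre (inj₂ zero) = ≤-trans (relabel-≥ (content X)) (≤-trans X⊑Y (relabel-≤ (content Y)))
    fibre (inj₁ c) = single-≤ (point X) (point Y) (here X) (only X) (here Y) (only Y)
      (trans (cong (labF (plugF C att X)) (at-ix (plugF C att X) (inj₁ c))) (sym (cong (labF (plugF C att Y)) (at-ix (plugF C att Y) (inj₁ c)))))
      where
      point : ∀ Z → Fin (size (enc (plugF C att Z)))
      point Z = ix (plugF C att Z) (inj₁ c)
      here : ∀ Z → point Z ∈ pre (plugF C att Z) (over Z (inj₁ c))
      here Z = trans (cong (over Z (inj₁ c)) (at-ix (plugF C att Z) (inj₁ c))) (over⁺ Z (inj₁ c) (inj₁ c) refl)
      only : ∀ Z w → w ∈ pre (plugF C att Z) (over Z (inj₁ c)) → w ≡ point Z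
      only Z w w∈ = trans (sym (ix-at (plugF C att Z) w)) (cong (ix (plugF C att Z)) (unique (at (plugF C att Z) w) (over⁻ Z (inj₁ c) _ w∈)))
        where
        unique : ∀ x → collapse {Z} x ≡ inj₁ c → x ≡ inj₁ c
        unique (inj₁ .c) refl = refl

  -- Both graphs have the quotient `I`, the context with one vertex in place of the hole. Over that
  -- vertex the fibres are copies of `X` and `Y`, over the others single vertices with equal labels.
  plug-⊑ : plugF C att X ⊑ plugF C att Y
  plug-⊑ = functor (Q X) (Q Y) λ t _ → ≤-trans (≤-≐ (to-over X t) (from-over X t)) (≤-trans (fibre (at I t)) (≤-≐ (from-over Y t) (to-over Y t)))
    where
    to-over : ∀ Z t → full ∩ fib (q̂ Z) t ⊆ pre (plugF C att Z) (over Z (at I t))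
    to-over Z t v v∈ = over⁺ Z (at I t) (at (plugF C att Z) v) (trans (sym (at-ix I (collapse {Z} (at (plugF C att Z) v)))) (cong (at I) (fib⁻ (q̂ Z) {t} {v} v∈)))
    from-over : ∀ Z t → pre (plugF C att Z) (over Z (at I t)) ⊆ full ∩ fib (q̂ Z) t
    from-over Z t v v∈ = fib⁺ (q̂ Z) (trans (cong (ix I) (over⁻ Z (at I t) (at (plugF C att Z) v) v∈)) (ix-at I t))

part-bool : ∀ {n} {S D E : Sub n} → (∀ v → S v ≡ D v ∨ E v) → (∀ v → D v ∧ E v ≡ false) → Part S D E
part-bool {S = S} {D} {E} h d = part (λ v p → ∨⁻ (trans (sym (h v)) p)) (λ v p → trans (h v) (cong (_∨ E v) p))
  (λ v p → trans (h v) (trans (cong (D v ∨_) p) (Boolₚ.∨-zeroʳ (D v)))) (λ v p q → clash (∩⁺ p q) (d v))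
  where
  ∨⁻ : ∀ {a b} → a ∨ b ≡ true → a ≡ true ⊎ b ≡ true
  ∨⁻ {true}  _ = inj₁ refl
  ∨⁻ {false} e = inj₂ e

does⁻ : ∀ {n} {i j : Fin n} → does (i Fin.≟ j) ≡ true → i ≡ j
does⁻ {i = i} {j} = fib⁻ id {j} {i}

sgn-sgn : ∀ b c → sgn b (sgn b c) ≡ c
sgn-sgn true  c = refl
sgn-sgn false c = Boolₚ.not-involutive c

sgn-not : ∀ b c → sgn (not b) (sgn b c) ≡ not c
sgn-not true  c = refl
sgn-not false c = refl

sgn-not′ : ∀ b c → sgn (not b) c ≡ sgn b (not c)
sgn-not′ true  c = refl
sgn-not′ false c = sym (Boolₚ.not-involutive c)

discrete : ℕ → Graph
discrete n = mkGraph n (λ _ → 0 , true) (λ _ _ → false) (λ _ _ → refl) (λ _ → refl)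

-- For b = true this is the rule p↓, for b = false the dual of p↑. With Zᵢ = Mᵢ ⊔ Nᵢ it is
-- the residual of P⟨M̄⟩ ⊗ ⨂ᵢ Zᵢ ⊑ P⟨M̄ᵢ ⊗ Zᵢ⟩ ⊑ P⟨N⟩.
module PrimeRule (P : Graph) (Ms Ns : Fin (size P) → Graph) (b : Bool) where

  -- The bits `sgn b` cancel the polarity in which the graph is read: in polarity `b` the outer join
  -- is always a tensor and the inner one a par.
  Local : Fin (size P) → FG
  Local i = joinF ⌜ dual (Ms i) ⌝ (joinF ⌜ Ms i ⌝ ⌜ Ns i ⌝ (λ _ _ → sgn b false)) (λ _ _ → sgn b true)

  cross : Sub (size P) → ∀ i j → V (Local i) → V (Local j) → Bool
  cross K i j x y = sgn b ((isRight x ∧ K i) ∨ ((isRight y ∧ K j) ∨ adj P i j))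

  Ω-adj : Sub (size P) → ∀ {i j} → Dec (i ≡ j) → V (Local i) → V (Local j) → Bool
  Ω-adj K {i} (yes refl) x y = adjF (Local i) x y
  Ω-adj K {i} {j} (no _) x y = cross K i j x y

  Ω-sym : ∀ K {i j} (d : Dec (i ≡ j)) (d′ : Dec (j ≡ i)) x y → Ω-adj K d x y ≡ Ω-adj K d′ y x
  Ω-sym K {i} (yes refl) (yes refl) x y = symF (Local i) x y
  Ω-sym K (yes refl) (no ne) x y = ⊥-elim (ne refl)
  Ω-sym K (no ne) (yes refl) x y = ⊥-elim (ne refl)
  Ω-sym K {i} {j} (no _) (no _) x y = cong (sgn b) (swap (isRight x ∧ K i) (isRight y ∧ K j) (adj-sym P i j))
    where
    swap : ∀ p q {r r′} → r ≡ r′ → p ∨ (q ∨ r) ≡ q ∨ (p ∨ r′)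
    swap true  true  _ = refl
    swap true  false _ = refl
    swap false true  _ = refl
    swap false false e = e

  Ω-irr : ∀ K {i} (d : Dec (i ≡ i)) x → Ω-adj K d x x ≡ false
  Ω-irr K {i} (yes refl) x = irrF (Local i) x
  Ω-irr K (no ne) x = ⊥-elim (ne refl)

  -- The Zᵢ with i ∈ K are joined to everything outside them, so that removing the
  -- indices from K one at a time leads from P⟨M̄⟩ ⊗ ⨂ᵢ Zᵢ to P⟨M̄ᵢ ⊗ Zᵢ⟩.
  Ω : Sub (size P) → FG
  Ω K = mkFG (Σ (Fin (size P)) (λ i → V (Local i))) (finite-Σ (finite-Fin _) (λ i → fin (Local i)))
    (λ (i , x) → labF (Local i) x) (λ (i , x) (j , y) → Ω-adj K (i Fin.≟ j) x y)
    (λ (i , x) (j , y) → Ω-sym K (i Fin.≟ j) (j Fin.≟ i) x y) (λ (i , x) → Ω-irr K (i Fin.≟ i) x)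

  VΩ : Set
  VΩ = Σ (Fin (size P)) (λ i → V (Local i))

  attached : VΩ → Bool
  attached (i , x) = isRight x

  module _ (K : Sub (size P)) (k : Fin (size P)) (k∈ : k ∈ K) where

    Zₖ : VΩ → Bool
    Zₖ (i , x) = isRight x ∧ does (i Fin.≟ k)

    unattached : ∀ r d κ → not (r ∧ d) ≡ true → r ∧ (κ ∧ not d) ≡ r ∧ κ
    unattached true  false κ _ = Boolₚ.∧-identityʳ κ
    unattached false d     κ _ = refl

    Zₖ-hom : ∀ v x y → Zₖ v ≡ false → Zₖ x ≡ true → Zₖ y ≡ true → adjF (Ω (K - k)) v x ≡ adjF (Ω (K - k)) v y
    Zₖ-hom (j , v) (i , x) (i′ , y) v∉ x∈ y∈ with does⁻ {i = i} {k} (∩₂ {isRight x} x∈) | does⁻ {i = i′} {k} (∩₂ {isRight y} y∈)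
    ... | refl | refl = go (j Fin.≟ k) v x y (∩₁ x∈) (∩₁ y∈) v∉
      where
      go : ∀ {j} (d : Dec (j ≡ k)) v x y → isRight x ≡ true → isRight y ≡ true → isRight v ∧ does d ≡ false →
        Ω-adj (K - k) d v x ≡ Ω-adj (K - k) d v y
      go (yes refl) (inj₁ v) (inj₂ x) (inj₂ y) _ _ _ = refl
      go (no _) v (inj₂ x) (inj₂ y) _ _ _ = refl

    Zₖ-joined : ∀ v w → not (Zₖ v) ≡ true → Zₖ w ≡ true → adjF (Ω K) v w ≡ sgn b true
    Zₖ-joined (j , v) (i , w) v∉ w∈ with does⁻ {i = i} {k} (∩₂ {isRight w} w∈)
    ... | refl = go (j Fin.≟ k) v w (∩₁ w∈) v∉
      where
      go : ∀ {j} (d : Dec (j ≡ k)) v w → isRight w ≡ true → not (isRight v ∧ does d) ≡ true → Ω-adj K d v w ≡ sgn b true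
      go (yes refl) (inj₁ v) (inj₂ w) _ _ = refl
      go {j} (no _) v (inj₂ w) _ _ = cong (sgn b) (trans (cong (λ κ → (isRight v ∧ K j) ∨ (κ ∨ adj P j k)) k∈) (Boolₚ.∨-zeroʳ _))

    Zₖ-inner : ∀ x y → Zₖ x ≡ true → Zₖ y ≡ true → adjF (Ω (K - k)) x y ≡ adjF (Ω K) x y
    Zₖ-inner (i , x) (j , y) x∈ y∈ with does⁻ {i = i} {k} (∩₂ {isRight x} x∈) | does⁻ {i = j} {k} (∩₂ {isRight y} y∈)
    ... | refl | refl = go (k Fin.≟ k)
      where
      go : (d : Dec (k ≡ k)) → Ω-adj (K - k) d x y ≡ Ω-adj K d x y
      go (yes refl) = refl
      go (no ne) = ⊥-elim (ne refl)

    Zₖ-outer : ∀ x y → not (Zₖ x) ≡ true → not (Zₖ y) ≡ true → adjF (Ω (K - k)) x y ≡ adjF (Ω K) x y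
    Zₖ-outer (i , x) (j , y) x∉ y∉ = go (i Fin.≟ j)
      where
      go : (d : Dec (i ≡ j)) → Ω-adj (K - k) d x y ≡ Ω-adj K d x y
      go (yes refl) = refl
      go (no _) = cong (sgn b) (cong₂ (λ p q → p ∨ (q ∨ adj P i j)) (unattached (isRight x) _ (K i) x∉) (unattached (isRight y) _ (K j) y∉))

    -- An instance of `switch` in the dual, where `Zₖ` is a par component of `Ω K` and a module of
    -- `Ω (K - k)`.
    detach : enc (Ω K) ⁺⁻ b ∣ full ≤ enc (Ω (K - k)) ⁺⁻ b ∣ full
    detach = ≤-neg⁻ (switch {enc (Ω (K - k)) ⁺⁻ not b} {Γ′ = enc (Ω K) ⁺⁻ not b} (part-pre (Ω (K - k)) Zₖ)
      (λ v x y _ v∉ _ x∈ _ y∈ → cong (sgn (not b)) (Zₖ-hom (at (Ω (K - k)) v) (at (Ω (K - k)) x) (at (Ω (K - k)) y) v∉ x∈ y∈))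
      (part-pre (Ω K) Zₖ)
      (λ v w v∈ w∈ → trans (cong (sgn (not b)) (Zₖ-joined (at (Ω K) v) (at (Ω K) w) v∈ w∈)) (sgn-not b true))
      (side (not ∘ Zₖ) Zₖ-outer) (side Zₖ Zₖ-inner))
      where
      side : ∀ p → (∀ x y → p x ≡ true → p y ≡ true → adjF (Ω (K - k)) x y ≡ adjF (Ω K) x y) →
        enc (Ω (K - k)) ⁺⁻ not b ∣ pre (Ω (K - k)) p ≤ enc (Ω K) ⁺⁻ not b ∣ pre (Ω K) p
      side p = same-≤ (Ω (K - k)) (Ω K) (not b) p id p (λ _ → refl) (λ y → y , refl) (λ _ _ e → e) (λ _ → refl)

  none-attached : Sub (size P)
  none-attached _ = false

  detach-all : ∀ m K → count K < m → enc (Ω K) ⁺⁻ b ∣ full ≤ enc (Ω none-attached) ⁺⁻ b ∣ full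
  detach-all (suc m) K (s≤s lt) = go (ne? K)
    where
    go : Ne K ⊎ Em K → enc (Ω K) ⁺⁻ b ∣ full ≤ enc (Ω none-attached) ⁺⁻ b ∣ full
    go (inj₁ (k , k∈)) = ≤-trans (detach K k k∈)
      (detach-all m (K - k) (remove-< {T = K} {k} lt k∈))
    go (inj₂ em) = same-≤ (Ω K) (Ω none-attached) b (λ _ → true) id (λ _ → true) (λ _ → refl) (λ y → y , refl) (λ _ _ e → e) (λ _ → refl)
      (λ (i , x) (j , y) _ _ → agree (i Fin.≟ j) x y)
      where
      agree : ∀ {i j} (d : Dec (i ≡ j)) x y → Ω-adj K d x y ≡ Ω-adj none-attached d x y
      agree (yes refl) x y = refl
      agree {i} {j} (no _) x y = cong (sgn b) (cong₂ (λ κ κ′ → (isRight x ∧ κ) ∨ ((isRight y ∧ κ′) ∨ adj P i j)) (em i) (em j))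

  -- In polarity `not b` the discrete index graph is complete for `b = true` and edgeless for
  -- `b = false`. So this is the tensor of the `Mᵢ ⊔ Nᵢ` or the par of the `Mᵢ ⊗ Nᵢ`.
  X : FG
  X = Comp (discrete (size P) ⁺⁻ not b) (λ i → joinF ⌜ Ms i ⌝ ⌜ Ns i ⌝ (λ _ _ → sgn b false)) full

  Y : FG
  Y = joinF (Comp (P ⁺⁻ not b) (λ i → ⌜ Ms i ⌝) full) (Comp (P ⁺⁻ b) (λ i → ⌜ Ns i ⌝) full) (λ _ _ → sgn b false)

  X≤Ω : enc X ⁺⁻ b ∣ full ≤ enc (Ω full) ⁺⁻ b ∣ pre (Ω full) attached
  X≤Ω = relabel-≤ (relabelF X b (λ _ → true) (Ω full) b attached (λ (i , _ , x) → i , inj₂ x) (λ _ _ → refl)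
    (λ (i , _ , x) (j , _ , y) _ _ _ → cong (sgn b) (agree (i Fin.≟ j) x y))
    (λ { (i , inj₂ x) _ → (i , refl , x) , refl , refl }) (λ { (i , refl , x) (.i , refl , .x) _ _ refl → refl }) (λ _ _ → refl))
    where
    agree : ∀ {i j} (d : Dec (i ≡ j)) x y → compAdj (discrete (size P) ⁺⁻ not b) (λ i → joinF ⌜ Ms i ⌝ ⌜ Ns i ⌝ (λ _ _ → sgn b false)) d x y
      ≡ Ω-adj full d (inj₂ x) (inj₂ y)
    agree (yes refl) x y = refl
    agree (no _) x y = sgn-not′ b false

  A≤Ω : enc Y ⁺⁻ not b ∣ pre Y (not ∘ isRight) ≤ enc (Ω full) ⁺⁻ b ∣ pre (Ω full) (not ∘ attached)
  A≤Ω = relabel-≤ (relabelF Y (not b) (not ∘ isRight) (Ω full) b (not ∘ attached) g (λ { (inj₁ _) _ → refl })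
    (λ { (inj₁ (i , p , x)) (inj₁ (j , p′ , y)) _ _ ne → agree (i Fin.≟ j) x y (λ { refl refl → ne (cong inj₁ (,-irr refl)) }) })
    (λ { (i , inj₁ x) _ → inj₁ (i , refl , x) , refl , refl })
    (λ { (inj₁ (i , refl , x)) (inj₁ (.i , refl , .x)) _ _ refl → refl })
    (λ { (inj₁ (i , _ , x)) _ → labels b (lab (Ms i) x) }))
    where
    g : V Y → VΩ
    g (inj₁ (i , _ , x)) = i , inj₁ x
    g (inj₂ (i , _ , x)) = i , inj₂ (inj₂ x)
    labels : ∀ b a → (if not b then a else dualAtom a) ≡ (if b then dualAtom a else dualAtom (dualAtom a))
    labels true  a = refl
    labels false a = sym (dual-dual a)
    agree : ∀ {i j} (d : Dec (i ≡ j)) (x : Fin (size (Ms i))) (y : Fin (size (Ms j))) → ((e : i ≡ j) → subst (λ i → Fin (size (Ms i))) e x ≢ y) →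
      sgn (not b) (compAdj (P ⁺⁻ not b) (λ i → ⌜ Ms i ⌝) d x y) ≡ sgn b (Ω-adj full d (inj₁ x) (inj₁ y))
    agree {i} (yes refl) x y ne = trans (sgn-not′ b _) (cong (sgn b) (sym (adj-dual (Ms i) x y (ne refl))))
    agree (no _) x y ne = trans (sgn-sgn (not b) _) (sym (sgn-sgn b _))

  idx : V Y → Fin (size P)
  idx (inj₁ (i , _)) = i
  idx (inj₂ (i , _)) = i

  Ω₀ : FG
  Ω₀ = Ω none-attached

  qΩ : Fin (size (enc Ω₀)) → Fin (size P)
  qΩ v = proj₁ (at Ω₀ v)

  qY : Fin (size (enc Y)) → Fin (size P)
  qY v = idx (at Y v)

  Q-Ω : Quot (enc Ω₀ ⁺⁻ b) full (P ⁺⁻ true) full qΩ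
  Q-Ω = quot (λ _ _ → refl) (λ v w _ _ ne → edges (at Ω₀ v) (at Ω₀ w) ne)
    where
    edges : ∀ x y → proj₁ x ≢ proj₁ y → edgeF Ω₀ b x y ≡ adj P (proj₁ x) (proj₁ y)
    edges (i , x) (j , y) ne = go (i Fin.≟ j)
      where
      go : (d : Dec (i ≡ j)) → sgn b (Ω-adj none-attached d x y) ≡ adj P i j
      go (yes e) = ⊥-elim (ne e)
      go (no _) = trans (sgn-sgn b _) (cong₂ (λ p q → p ∨ (q ∨ adj P i j)) (Boolₚ.∧-zeroʳ (isRight x)) (Boolₚ.∧-zeroʳ (isRight y)))

  Q-Y : Quot (enc Y ⁺⁻ b) (pre Y isRight) (P ⁺⁻ true) full qY
  Q-Y = quot (λ _ _ → refl) (λ v w v∈ w∈ ne → edges (at Y v) (at Y w) v∈ w∈ ne)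
    where
    edges : ∀ x y → isRight x ≡ true → isRight y ≡ true → idx x ≢ idx y → edgeF Y b x y ≡ adj P (idx x) (idx y)
    edges (inj₂ (i , _ , x)) (inj₂ (j , _ , y)) _ _ ne = trans (cong (sgn b) (compAdj-no (P ⁺⁻ b) _ (i Fin.≟ j) ne x y)) (sgn-sgn b _)

  module _ (t : Fin (size P)) where

    within : (∀ {i} → V (Local i) → Bool) → VΩ → Bool
    within p (i , x) = does (i Fin.≟ t) ∧ p x

    isM isN : ∀ {i} → V (Local i) → Bool
    isM (inj₁ _) = false
    isM (inj₂ x) = not (isRight x)
    isN (inj₁ _) = false
    isN (inj₂ x) = isRight x

    isA isZ : ∀ {i} → V (Local i) → Bool
    isA x = not (isRight x)
    isZ x = isRight x

    part-within : ∀ {S} (p p₁ p₂ : ∀ {i} → V (Local i) → Bool) → (∀ v → S v ≡ within p (at Ω₀ v)) →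
      (∀ {i} (x : V (Local i)) → p x ≡ p₁ x ∨ p₂ x) → (∀ {i} (x : V (Local i)) → p₁ x ∧ p₂ x ≡ false) →
      Part S (pre Ω₀ (within p₁)) (pre Ω₀ (within p₂))
    part-within p p₁ p₂ h cover disjoint =
      part-bool (λ v → trans (h v) (cover′ (at Ω₀ v))) (λ v → disjoint′ (at Ω₀ v))
      where
      cover′ : ∀ x → within p x ≡ within p₁ x ∨ within p₂ x
      cover′ (i , x) = trans (cong (does (i Fin.≟ t) ∧_) (cover x)) (Boolₚ.∧-distribˡ-∨ (does (i Fin.≟ t)) (p₁ x) (p₂ x))
      disjoint′ : ∀ x → within p₁ x ∧ within p₂ x ≡ false
      disjoint′ (i , x) with does (i Fin.≟ t)
      ... | true  = disjoint x
      ... | false = refl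

    part-AZ : Part (full ∩ fib qΩ t) (pre Ω₀ (within isA)) (pre Ω₀ (within isZ))
    part-AZ = part-within (λ _ → true) isA isZ (λ v → sym (Boolₚ.∧-identityʳ _))
      (λ { (inj₁ _) → refl ; (inj₂ _) → refl }) (λ { (inj₁ _) → refl ; (inj₂ _) → refl })

    part-MN : Part (pre Ω₀ (within isZ)) (pre Ω₀ (within isM)) (pre Ω₀ (within isN))
    part-MN = part-within isZ isM isN (λ _ → refl)
      (λ { (inj₁ _) → refl ; (inj₂ (inj₁ _)) → refl ; (inj₂ (inj₂ _)) → refl }) (λ { (inj₁ _) → refl ; (inj₂ (inj₁ _)) → refl ; (inj₂ (inj₂ _)) → refl })

    same-block : ∀ (p p′ : ∀ {i} → V (Local i) → Bool) c → (∀ {i} (x y : V (Local i)) → p x ≡ true → p′ y ≡ true → adjF (Local i) x y ≡ c) →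
      ∀ x y → within p x ≡ true → within p′ y ≡ true → adjF Ω₀ x y ≡ c
    same-block p p′ c h (i , x) (j , y) x∈ y∈ with does⁻ {i = i} {t} (∩₁ x∈) | does⁻ {i = j} {t} (∩₁ y∈)
    ... | refl | refl = go (t Fin.≟ t)
      where
      go : (d : Dec (t ≡ t)) → Ω-adj none-attached d x y ≡ c
      go (yes refl) = h x y (∩₂ {does (i Fin.≟ t)} x∈) (∩₂ {does (j Fin.≟ t)} y∈)
      go (no ne) = ⊥-elim (ne refl)

    sep-AZ : NoEdge (enc Ω₀ ⁺⁻ not b) (pre Ω₀ (within isA)) (pre Ω₀ (within isZ))
    sep-AZ v w v∈ w∈ = trans (cong (sgn (not b)) (same-block isA isZ (sgn b true) (λ { (inj₁ _) (inj₂ _) _ _ → refl }) (at Ω₀ v) (at Ω₀ w) v∈ w∈)) (sgn-not b true)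

    sep-MN : NoEdge (enc Ω₀ ⁺⁻ b) (pre Ω₀ (within isM)) (pre Ω₀ (within isN))
    sep-MN v w v∈ w∈ = trans (cong (sgn b) (same-block isM isN (sgn b false) (λ { (inj₂ (inj₁ _)) (inj₂ (inj₂ _)) _ _ → refl }) (at Ω₀ v) (at Ω₀ w) v∈ w∈)) (sgn-sgn b false)

    off : ∀ {i} {A : Set} → does (i Fin.≟ t) ∧ false ≡ true → A
    off {i} e = clash e (Boolₚ.∧-zeroʳ (does (i Fin.≟ t)))

    A≤M : enc Ω₀ ⁺⁻ b ∣ pre Ω₀ (within isA) ≤ enc Ω₀ ⁺⁻ not b ∣ pre Ω₀ (within isM)
    A≤M = relabel-≤ (relabelF Ω₀ b (within isA) Ω₀ (not b) (within isM) g (λ { (i , inj₁ x) e → e ; (i , inj₂ x) e → off {i} e })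
      edges
      (λ { (i , inj₁ x) e → off {i} e ; (i , inj₂ (inj₁ x)) e → (i , inj₁ x) , e , refl
         ; (i , inj₂ (inj₂ x)) e → off {i} e })
      inj
      (λ { (i , inj₁ x) _ → labels b (lab (Ms i) x) ; (i , inj₂ x) e → off {i} e }))
      where
      g : VΩ → VΩ
      g (i , inj₁ x) = i , inj₂ (inj₁ x)
      g x            = x
      inj : ∀ x y → within isA x ≡ true → within isA y ≡ true → g x ≡ g y → x ≡ y
      inj (i , inj₁ x) (.i , inj₁ .x) _ _ refl = refl
      inj (i , inj₂ x) _ e _ _ = off {i} e
      inj (i , inj₁ x) (j , inj₂ y) _ e _ = off {j} e
      labels : ∀ b a → (if b then dualAtom a else dualAtom (dualAtom a)) ≡ (if not b then a else dualAtom a)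
      labels true  a = refl
      labels false a = dual-dual a
      agree : ∀ {i j} (x : Fin (size (Ms i))) (y : Fin (size (Ms j))) → i ≡ t → j ≡ t → (d : Dec (i ≡ j)) →
        _≢_ {A = VΩ} (i , inj₁ x) (j , inj₁ y) → sgn b (Ω-adj none-attached d (inj₁ x) (inj₁ y)) ≡ sgn (not b) (Ω-adj none-attached d (inj₂ (inj₁ x)) (inj₂ (inj₁ y)))
      agree {i} x y refl refl (yes refl) ne = trans (cong (sgn b) (adj-dual (Ms i) x y (λ { refl → ne refl }))) (sym (sgn-not′ b _))
      agree x y refl refl (no ne) _ = ⊥-elim (ne refl)
      edges : ∀ x y → within isA x ≡ true → within isA y ≡ true → x ≢ y → edgeF Ω₀ b x y ≡ edgeF Ω₀ (not b) (g x) (g y)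
      edges (i , inj₁ x) (j , inj₁ y) x∈ y∈ ne = agree x y (does⁻ {i = i} {t} (∩₁ x∈)) (does⁻ {i = j} {t} (∩₁ y∈)) (i Fin.≟ j) ne
      edges (i , inj₂ x) _ e _ _ = off {i} e
      edges (i , inj₁ x) (j , inj₂ y) _ e _ = off {j} e

    onY : V Y → Bool
    onY y = isRight y ∧ does (idx y Fin.≟ t)

    N≤Y : enc Ω₀ ⁺⁻ b ∣ pre Ω₀ (within isN) ≤ enc Y ⁺⁻ b ∣ pre Y onY
    N≤Y = relabel-≤ (relabelF Ω₀ b (within isN) Y b onY g
      (λ { (i , inj₂ (inj₂ x)) e → ∩₁ e ; (i , inj₁ x) e → off {i} e ; (i , inj₂ (inj₁ x)) e → off {i} e })
      edges
      (λ { (inj₂ (i , refl , x)) e → (i , inj₂ (inj₂ x)) , ∩⁺ e refl , refl })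
      inj
      (λ { (i , inj₂ (inj₂ x)) _ → refl ; (i , inj₁ x) e → off {i} e ; (i , inj₂ (inj₁ x)) e → off {i} e }))
      where
      g : VΩ → V Y
      g (i , inj₁ x)        = inj₁ (i , refl , x)
      g (i , inj₂ (inj₁ x)) = inj₁ (i , refl , x)
      g (i , inj₂ (inj₂ x)) = inj₂ (i , refl , x)
      inj : ∀ x y → within isN x ≡ true → within isN y ≡ true → g x ≡ g y → x ≡ y
      inj (i , inj₂ (inj₂ x)) (.i , inj₂ (inj₂ .x)) _ _ refl = refl
      inj (i , inj₁ x) _ e _ _ = off {i} e
      inj (i , inj₂ (inj₁ x)) _ e _ _ = off {i} e
      inj (i , inj₂ (inj₂ x)) (j , inj₁ y) _ e _ = off {j} e
      inj (i , inj₂ (inj₂ x)) (j , inj₂ (inj₁ y)) _ e _ = off {j} e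
      agree : ∀ {i j} (x : Fin (size (Ns i))) (y : Fin (size (Ns j))) → i ≡ t → j ≡ t → (d : Dec (i ≡ j)) →
        Ω-adj none-attached d (inj₂ (inj₂ x)) (inj₂ (inj₂ y)) ≡ compAdj (P ⁺⁻ b) (λ i → ⌜ Ns i ⌝) d x y
      agree x y refl refl (yes refl) = refl
      agree x y refl refl (no ne) = ⊥-elim (ne refl)
      edges : ∀ x y → within isN x ≡ true → within isN y ≡ true → x ≢ y → edgeF Ω₀ b x y ≡ edgeF Y b (g x) (g y)
      edges (i , inj₂ (inj₂ x)) (j , inj₂ (inj₂ y)) x∈ y∈ _ = cong (sgn b) (agree x y (does⁻ {i = i} {t} (∩₁ x∈)) (does⁻ {i = j} {t} (∩₁ y∈)) (i Fin.≟ j))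
      edges (i , inj₁ x) _ e _ _ = off {i} e
      edges (i , inj₂ (inj₁ x)) _ e _ _ = off {i} e
      edges (i , inj₂ (inj₂ x)) (j , inj₁ y) _ e _ = off {j} e
      edges (i , inj₂ (inj₂ x)) (j , inj₂ (inj₁ y)) _ e _ = off {j} e

    block≤ : enc Ω₀ ⁺⁻ b ∣ full ∩ fib qΩ t ≤ enc Y ⁺⁻ b ∣ pre Y isRight ∩ fib qY t
    block≤ = evaluate part-AZ sep-AZ part-MN sep-MN A≤M N≤Y

  Ω≤Y : enc (Ω full) ⁺⁻ b ∣ full ≤ enc Y ⁺⁻ b ∣ pre Y isRight
  Ω≤Y = ≤-trans (detach-all _ full ℕₚ.≤-refl) (functor Q-Ω Q-Y (λ t _ → block≤ t))

  X≤Y : enc X ⁺⁻ b ∣ full ≤ enc Y ⁺⁻ b ∣ full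
  X≤Y = residuate (part-pre (Ω full) attached) sepΩ (part-pre Y isRight) sepY A≤Ω X≤Ω Ω≤Y
    where
    sepΩ : NoEdge (enc (Ω full) ⁺⁻ not b) (pre (Ω full) (not ∘ attached)) (pre (Ω full) attached)
    sepΩ v w v∈ w∈ = trans (cong (sgn (not b)) (joined (at (Ω full) v) (at (Ω full) w) v∈ w∈)) (sgn-not b true)
      where
      joined : ∀ x y → not (attached x) ≡ true → attached y ≡ true → adjF (Ω full) x y ≡ sgn b true
      joined (i , inj₁ x) (j , inj₂ y) _ _ = go (i Fin.≟ j)
        where
        go : (d : Dec (i ≡ j)) → Ω-adj full d (inj₁ x) (inj₂ y) ≡ sgn b true
        go (yes refl) = refl
        go (no _) = refl
    sepY : NoEdge (enc Y ⁺⁻ b) (pre Y (not ∘ isRight)) (pre Y isRight)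
    sepY v w v∈ w∈ = apart (at Y v) (at Y w) v∈ w∈
      where
      apart : ∀ x y → not (isRight x) ≡ true → isRight y ≡ true → edgeF Y b x y ≡ false
      apart (inj₁ _) (inj₂ _) _ _ = sgn-sgn b false

open PrimeRule using (X≤Y)

bigTensor≡ : ∀ n Gs → bigTensor n Gs ≡ composeRaw n (λ _ _ → true) Gs
bigTensor≡ zero    Gs = refl
bigTensor≡ (suc n) Gs = cong (λ G → Gs zero ⊗ G) (bigTensor≡ n (λ i → Gs (suc i)))

bigPar≡ : ∀ n Gs → bigPar n Gs ≡ composeRaw n (λ _ _ → false) Gs
bigPar≡ zero    Gs = refl
bigPar≡ (suc n) Gs = cong (λ G → Gs zero ⊔ G) (bigPar≡ n (λ i → Gs (suc i)))

bigTensor≃ : ∀ P Gs → ⌜ bigTensor (size P) Gs ⌝ ≃ Comp (discrete (size P) ⁺⁻ false) (λ i → ⌜ Gs i ⌝) full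
bigTensor≃ P Gs = ≃-trans (≡⇒≃ (cong ⌜_⌝ (bigTensor≡ (size P) Gs))) (composeRaw≃Comp (discrete (size P)) false (λ _ _ → true) Gs (λ _ _ _ → refl))

bigPar≃ : ∀ P Gs → ⌜ bigPar (size P) Gs ⌝ ≃ Comp (discrete (size P) ⁺⁻ true) (λ i → ⌜ Gs i ⌝) full
bigPar≃ P Gs = ≃-trans (≡⇒≃ (cong ⌜_⌝ (bigPar≡ (size P) Gs))) (composeRaw≃Comp (discrete (size P)) true (λ _ _ → false) Gs (λ _ _ _ → refl))

compose≃ : ∀ P Hs → ⌜ P ⟨ Hs ⟩ ⌝ ≃ Comp (P ⁺⁻ true) (λ i → ⌜ Hs i ⌝) full
compose≃ P Hs = composeRaw≃Comp P true (adj P) Hs (λ _ _ _ → refl)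

dual-compose≃ : ∀ P Hs → ⌜ dual P ⟨ Hs ⟩ ⌝ ≃ Comp (P ⁺⁻ false) (λ i → ⌜ Hs i ⌝) full
dual-compose≃ P Hs = composeRaw≃Comp P false (adj (dual P)) Hs (adj-dual P)

rule-⊑ : ∀ {X Y} → GS X Y → ⌜ X ⌝ ⊑ ⌜ Y ⌝
rule-⊑ (gs-ai↓ (ai↓-inst a)) = le up′ down′
  where
  G : Graph
  G = atomG (dualAtom a) ⊔ atomG a
  Γ : PG
  Γ = G ⁺⁻ true
  A B : Sub 2
  A = fib id zero
  B = fib id (suc zero)
  p : Part full A B
  p = part-bool (λ { zero → refl ; (suc zero) → refl }) (λ { zero → refl ; (suc zero) → refl })
  sep : NoEdge Γ A B
  sep zero (suc zero) _ _ = refl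
  onlyA : ∀ w → w ∈ A → w ≡ zero
  onlyA zero _ = refl
  onlyB : ∀ w → w ∈ B → w ≡ suc zero
  onlyB (suc zero) _ = refl
  up′ : ∀ z → 𝕌 (emptyG ⁺⁻ true) full z → 𝕌 Γ full z
  up′ z bz = par-intro p sep
    (λ x bx → single-intro (suc zero) refl onlyB
      (≃⇒⇒ (≡⇒≃ (cong atomF (sym (dual-dual (dualAtom a))))) ▹ atomᵇ (unfold bx) zero refl onlyA ▹ absorb x))
    (λ x bx → single-intro zero refl onlyA (atomᵇ (unfold bx) (suc zero) refl onlyB ▹ absorb x))
    where
    absorb : ∀ x → x ⇒ z ⊔F x
    absorb x = ⇒-⊔⊢ x (empty-elim (λ ()) bz) ▹ ≃⇒⇒ (⊔-comm x z)
  down′ : ∀ z → 𝕌 (neg Γ) full z → 𝕌 (emptyG ⁺⁻ false) full z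
  down′ z bz = combine (tensor-elim p (noEdge-neg {Γ} sep) bz)
    where
    combine : Tensor (neg Γ) A B z → 𝕌 (emptyG ⁺⁻ false) full z
    combine (x , y , bx , by , f) = empty-intro (λ ()) (⊢-⇒ (⇒-⊔ʳ _ (atomᵇ (unfold bx) zero refl onlyA)
      ▹ ⇒-⊔ˡ x (atomᵇ (unfold by) (suc zero) refl onlyB) ▹ f) (ai-provable (dualAtom (dualAtom a))))
rule-⊑ (gs-ss↓ (ss↓-inst B A S _ _)) = ≤-trans (≃⇒≤ true (joinG≃joinF B A _))
  (≤-trans (join-switch ⌜ B ⌝ ⌜ A ⌝ S true) (≃⇒≤ true (≃-sym (joinG≃joinF B A _))))
rule-⊑ (gs-p↓ (p↓-inst P _ _ Ms Ns _)) = ≤-trans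
  (≃⇒≤ true (≃-trans (bigTensor≃ P (λ i → Ms i ⊔ Ns i)) (Comp-cong (discrete (size P) ⁺⁻ false) full _ _ (λ i _ → joinG≃joinF (Ms i) (Ns i) _))))
  (≤-trans (X≤Y P Ms Ns true)
    (≃⇒≤ true (≃-sym (≃-trans (joinG≃joinF (dual P ⟨ Ms ⟩) (P ⟨ Ns ⟩) _) (joinF-cong (dual-compose≃ P Ms) (compose≃ P Ns) (λ _ _ → refl))))))

≤-refl : ∀ {Γ S} → Γ ∣ S ≤ Γ ∣ S
≤-refl = le (λ _ b → b) (λ _ b → b)

step-⊑ : ∀ {X Y} → Step GS X Y → ⌜ X ⌝ ⊑ ⌜ Y ⌝
step-⊑ (iso-step f) = ≃⇒≤ true (≅⇒≃ f)
step-⊑ (rule-step {X} {Y} C r) = ≤-trans (≃⇒≤ true (joinG≃joinF (ctx C) X _))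
  (≤-trans (plug-⊑ ⌜ ctx C ⌝ (R C) (rule-⊑ r)) (≃⇒≤ true (≃-sym (joinG≃joinF (ctx C) Y _))))

derivation-⊑ : ∀ {X Y} → Derivation GS X Y → ⌜ X ⌝ ⊑ ⌜ Y ⌝
derivation-⊑ ε       = ≤-refl
derivation-⊑ (s ◅ d) = ≤-trans (step-⊑ s) (derivation-⊑ d)

-- Between provability and realizers, and the up-rules

soundness : ∀ {X} → Provable GS X → 𝕌 (X ⁺⁻ true) full emptyF
soundness d = up (derivation-⊑ d) emptyF (empty-intro (λ ()) (≃⇒⟶ ≃-refl))

-- `X` is the composition of its own atoms along itself, and each atom realizes the corresponding
-- vertex of the dual.
self-realized : ∀ X → 𝕌 (X ⁺⁻ false) full ⌜ X ⌝
self-realized X = closed (≃⇒⇒ whole) (comp-intro (Quot-id (X ⁺⁻ false) full) λ t _ →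
  single-intro {z = atomF (lab X t)} t (∩⁺ refl (fib⁺ id {t} {t} refl)) (λ w w∈ → fib⁻ id {t} {w} w∈) (≃⇒⇒ (≡⇒≃ (cong atomF (dual-dual (lab X t))))))
  where
  whole : Comp (X ⁺⁻ true) (λ t → atomF (lab X t)) full ≃ ⌜ X ⌝
  whole = mk≃ (mk↔ₛ′ (λ (t , _) → t) (λ t → t , refl , zero) (λ _ → refl) (λ { (t , refl , zero) → refl })) (λ _ → refl)
    (λ { (s , _ , zero) (t , _ , zero) → agree (s Fin.≟ t) })
    where
    agree : ∀ {s t} (d : Dec (s ≡ t)) → adj X s t ≡ compAdj (X ⁺⁻ true) (λ t → atomF (lab X t)) d zero zero
    agree {s} (yes refl) = adj-irr X s
    agree (no _) = refl

completeness : ∀ {X} → 𝕌 (X ⁺⁻ true) full emptyF → Provable GS X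
completeness {X} b = _⟶_.derivation (orth b (self-realized X) ▸ ≃⇒⟶ (⊔F-identityˡ ⌜ X ⌝))

ai↑-admissible : Admissible ai↑ GS
ai↑-admissible _ _ (ai↑-inst a) _ = ε

ss↑-admissible : Admissible ss↑ GS
ss↑-admissible _ _ (ss↑-inst B A S _ _) d = completeness (up (≃⇒≤ true (≃-sym (joinG≃joinF B A _))) emptyF
  (down (join-switch ⌜ B ⌝ ⌜ A ⌝ S false) emptyF (up (≃⇒≤ true (joinG≃joinF B A _)) emptyF (soundness d))))

p↑-admissible : Admissible p↑ GS
p↑-admissible _ _ (p↑-inst P _ _ Ms Ns _) d = completeness
  (up (≃⇒≤ true (≃-sym (≃-trans (bigPar≃ P (λ i → Ms i ⊗ Ns i)) (Comp-cong (discrete (size P) ⁺⁻ true) full _ _ (λ i _ → joinG≃joinF (Ms i) (Ns i) _))))) emptyF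
    (down (X≤Y P Ms Ns false) emptyF
      (up (≃⇒≤ true (≃-trans (joinG≃joinF (P ⟨ Ms ⟩) (dual P ⟨ Ns ⟩) _) (joinF-cong (compose≃ P Ms) (dual-compose≃ P Ns) (λ _ _ → refl)))) emptyF (soundness d))))

theorem5p5 : Admissible ai↑ GS × Admissible ss↑ GS × Admissible p↑ GS
theorem5p5 = ai↑-admissible , ss↑-admissible , p↑-admissible
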